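{- Let $p\ge 1$ be an integer and let $T$ be a tree. Let $G$ be a graph such that every prime induced subgraph of $G$ has linear rank-width at most $p$. If $\operatorname{lrw}(G)\ge 40(p+2)|V(T)|$, then $G$ contains a vertex-minor isomorphic to $T$.
   Context: All graphs are finite, simple and undirected. For a graph $G$ and $X\subseteq V(G)$, the cut-rank $\operatorname{cutrk}_G(X)$ is the rank over the binary field of the submatrix of the adjacency matrix of $G$ with rows indexed by $X$ and columns indexed by $V(G)\setminus X$. A linear layout of $G$ is an ordering $(x_1,\dots,x_n)$ of $V(G)$; if $n\ge 2$ its width is $\max_{1\le i\le n-1}\operatorname{cutrk}_G(\{x_1,\dots,x_i\})$. The linear rank-width $\operatorname{lrw}(G)$ is the minimum width of a linear layout of $G$ if $|V(G)|\ge 2$, and $0$ otherwise. A split of a connected graph $G$ is a partition $(X,Y)$ of $V(G)$ with $|X|,|Y|\ge 2$ such that the binary adjacency submatrix with rows $X$ and columns $Y$ has rank $1$ (equivalently, the edges between $X$ and $Y$ form a complete bipartite graph between some nonempty $X'\subseteq X$ and $Y'\subseteq Y$). A connected graph is prime if it has no split. The local complementation at a vertex $x$ replaces the subgraph induced on the neighbourhood of $x$ by its complement; a graph $H$ is a vertex-minor of $G$ if $H$ can be obtained from $G$ by a sequence of local complementations and vertex deletions. -}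

module Defs where

open import Data.Nat using (ℕ; zero; suc; _+_; _*_; _∸_; _≤_; _<_; _<ᵇ_)
open import Data.Bool using (Bool; true; false; _∧_; _xor_; not; T)
import Data.Bool.Properties
open import Data.Fin using (Fin; toℕ; inject₁; punchIn; fromℕ)
import Data.Fin as F
open import Data.Fin.Properties using (_≟_)
open import Data.Fin.Permutation using (Permutation; _⟨$⟩ʳ_; _⟨$⟩ˡ_)
open import Data.Product using (Σ; _×_; _,_)
open import Function.Definitions using (Injective)
open import Relation.Nullary using (¬_; yes; no)
open import Relation.Nullary.Decidable using (⌊_⌋)
open import Relation.Binary.PropositionalEquality using (_≡_; refl; sym; cong; cong₂)

record Graph (n : ℕ) : Set where
  field
    adj    : Fin n → Fin n → Bool
    adj-sym    : ∀ u v → adj u v ≡ adj v u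
    adj-irrefl : ∀ u → adj u u ≡ false
open Graph public

Subset : ℕ → Set
Subset n = Fin n → Bool

_⊆_ : ∀ {n} → Subset n → Subset n → Set
S ⊆ X = ∀ v → S v ≡ true → X v ≡ true

count : ∀ {n} → Subset n → ℕ
count {zero}  S = 0
count {suc n} S = (if' (S F.zero)) + count (λ i → S (F.suc i))
  where
  if' : Bool → ℕ
  if' true  = 1
  if' false = 0

⨁ : ∀ {n} → (Fin n → Bool) → Bool
⨁ {zero}  f = false
⨁ {suc n} f = f F.zero xor ⨁ (λ i → f (F.suc i))

-- Cut-rank over GF(2).
-- The matrix A_G[X, V∖X] has row u (u ∈ X) given by w ↦ adj u w (w ∉ X).
-- A set S ⊆ X of rows is linearly independent over GF(2) iff every
-- subset R ⊆ S whose rows sum to the zero vector (on the columns V∖X)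
-- is empty.  The rank is the maximum size of an independent set of rows.

RowsIndependent : ∀ {n} → Graph n → Subset n → Subset n → Set
RowsIndependent {n} G X S =
  ∀ (R : Subset n) → R ⊆ S →
    (∀ w → X w ≡ false → ⨁ (λ u → R u ∧ adj G u w) ≡ false) →
    ∀ u → R u ≡ false

CutRankAtMost : ∀ {n} → Graph n → Subset n → ℕ → Set
CutRankAtMost G X k = ∀ S → S ⊆ X → RowsIndependent G X S → count S ≤ k

-- Linear layouts and linear rank-width.
-- A linear layout is a permutation π, with x_{i+1} = π ⟨$⟩ʳ i.
-- The prefix {x_1,…,x_i} is the set of vertices at position < i.

prefix : ∀ {n} → Permutation n n → ℕ → Subset n
prefix π i v = toℕ (π ⟨$⟩ˡ v) <ᵇ i

-- the layout π has width ≤ k  (vacuous if n < 2)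
LayoutWidthAtMost : ∀ {n} → Graph n → Permutation n n → ℕ → Set
LayoutWidthAtMost {n} G π k =
  ∀ i → 1 ≤ i → i ≤ n ∸ 1 → CutRankAtMost G (prefix π i) k

-- lrw(G) ≤ k  (for |V(G)| < 2 this always holds, matching lrw = 0)
LrwAtMost : ∀ {n} → Graph n → ℕ → Set
LrwAtMost {n} G k = Σ (Permutation n n) λ π → LayoutWidthAtMost G π k

data Reach {n} (G : Graph n) : Fin n → Fin n → Set where
  here : ∀ {u} → Reach G u u
  step : ∀ {u w v} → adj G u w ≡ true → Reach G w v → Reach G u v

Connected : ∀ {n} → Graph n → Set
Connected {n} G = ∀ (u v : Fin n) → Reach G u v

complement : ∀ {n} → Subset n → Subset n
complement X v = not (X v)

IsSplit : ∀ {n} → Graph n → Subset n → Set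
IsSplit G X =
  2 ≤ count X × 2 ≤ count (complement X) ×
  CutRankAtMost G X 1 × ¬ CutRankAtMost G X 0

Prime : ∀ {n} → Graph n → Set
Prime {n} G = Connected G × (∀ (X : Subset n) → ¬ IsSplit G X)

induce : ∀ {m n} → Graph n → (Fin m → Fin n) → Graph m
induce G f = record
  { adj    = λ u v → adj G (f u) (f v)
  ; adj-sym    = λ u v → adj-sym G (f u) (f v)
  ; adj-irrefl = λ u → adj-irrefl G (f u)
  }

IsCycle : ∀ {n} → Graph n → (k : ℕ) → (Fin (suc (suc (suc k))) → Fin n) → Set
IsCycle G k c =
  Injective _≡_ _≡_ c ×
  (∀ (i : Fin (suc (suc k))) → adj G (c (inject₁ i)) (c (F.suc i)) ≡ true) ×
  adj G (c (fromℕ (suc (suc k)))) (c F.zero) ≡ true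

Acyclic : ∀ {n} → Graph n → Set
Acyclic {n} G = ∀ k (c : Fin (suc (suc (suc k))) → Fin n) → ¬ IsCycle G k c

IsTree : ∀ {n} → Graph n → Set
IsTree G = Connected G × Acyclic G

neq : ∀ {n} → Fin n → Fin n → Bool
neq u v = not ⌊ u ≟ v ⌋

neq-sym : ∀ {n} (u v : Fin n) → neq u v ≡ neq v u
neq-sym u v with u ≟ v | v ≟ u
... | yes _ | yes _ = refl
... | no _  | no _  = refl
... | yes p | no q  with q (sym p)
...   | ()
neq-sym u v | no q | yes p with q (sym p)
...   | ()

neq-refl : ∀ {n} (u : Fin n) → neq u u ≡ false
neq-refl u with u ≟ u
... | yes _ = refl
... | no q with q refl
...   | ()

private
  swap∧ : ∀ b c e → (b ∧ c ∧ e) ≡ (c ∧ b ∧ e)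
  swap∧ true  true  e = refl
  swap∧ true  false e = refl
  swap∧ false true  e = refl
  swap∧ false false e = refl

  x∧false : ∀ a b → a xor (b ∧ b ∧ false) ≡ a
  x∧false a true  rewrite Data.Bool.Properties.xor-identityʳ a = refl
  x∧false a false rewrite Data.Bool.Properties.xor-identityʳ a = refl

localComp : ∀ {n} → Graph n → Fin n → Graph n
localComp G x = record
  { adj    = λ u v → adj G u v xor (adj G x u ∧ adj G x v ∧ neq u v)
  ; adj-sym    = λ u v → Relation.Binary.PropositionalEquality.trans
               (cong₂ (λ a b → a xor b) (adj-sym G u v)
                 (cong (λ e → adj G x u ∧ adj G x v ∧ e) (neq-sym u v)))
               (cong (adj G v u xor_) (swap∧ (adj G x u) (adj G x v) (neq v u)))
  ; adj-irrefl = λ u → Relation.Binary.PropositionalEquality.trans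
               (cong (λ e → adj G u u xor (adj G x u ∧ adj G x u ∧ e)) (neq-refl u))
               (Relation.Binary.PropositionalEquality.trans
                 (x∧false (adj G u u) (adj G x u)) (adj-irrefl G u))
  }

delete : ∀ {n} → Graph (suc n) → Fin (suc n) → Graph n
delete G x = induce G (punchIn x)

data VertexMinor : ∀ {n m} → Graph n → Graph m → Set where
  vm-refl : ∀ {n} {G : Graph n} → VertexMinor G G
  vm-lc   : ∀ {n m} {G : Graph n} {H : Graph m} (x : Fin n) →
            VertexMinor (localComp G x) H → VertexMinor G H
  vm-del  : ∀ {n m} {G : Graph (suc n)} {H : Graph m} (x : Fin (suc n)) →
            VertexMinor (delete G x) H → VertexMinor G H

Isomorphic : ∀ {m n} → Graph m → Graph n → Set
Isomorphic {m} {n} G H =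
  Σ (Permutation m n) λ π → ∀ u v → adj H (π ⟨$⟩ʳ u) (π ⟨$⟩ʳ v) ≡ adj G u v

LrwAtLeast : ∀ {n} → Graph n → ℕ → Set
LrwAtLeast G N = ∀ k → LrwAtMost G k → N ≤ k

-- A limb is a set of cut-rank at most one. Call some limbs rich, such that every other limb has a
-- layout of width k. If no two disjoint rich limbs inside a limb X have a union which is not a limb,
-- then X has a layout of width k + p + 3: follow a maximal chain of limbs; between two consecutive
-- ones, contracting the maximal limbs leaves a prime graph, which has a layout of width p.
--
-- A limb supplies a rooted tree τ if local complementations inside it produce a copy of τ attached to
-- the outside at its root only (form A), or with the outside in place of its root (form C). Whether a
-- set is a limb does not depend on local complementations. If two disjoint limbs inside X supply τ
-- and their union is not a limb, then X supplies τ with a new root put on top. Doing this three times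
-- yields τ below a path, and the path can be shortened in different ways: X supplies τ in form A, with
-- a prescribed effect on the outside, as well as in form C. Two disjoint limbs with this freedom can
-- be glued, by which any tree is assembled. Every vertex of the tree costs at most 7 (p + 3) in width.
module Submission where

open import Defs
open import Data.Nat using (ℕ; zero; suc; _+_; _*_; _∸_; _≤_; _<_; z≤n; s≤s; _<ᵇ_)
import Data.Nat.Properties as ℕₚ
open import Data.Nat.Solver using (module +-*-Solver)
open import Data.Bool using (Bool; true; false; _∧_; _∨_; _xor_; not; if_then_else_)
import Data.Bool.Properties as 𝔹ₚ
import Data.Fin as Fin
open import Data.Fin using (Fin; zero; suc; toℕ; fromℕ; fromℕ<; inject₁; punchOut)
import Data.Fin.Properties as Fₚ
open import Data.Fin.Properties using (_≟_; any?; all?)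
open import Data.Fin.Permutation using (Permutation; _⟨$⟩ʳ_; _⟨$⟩ˡ_; permutation; inverseˡ; inverseʳ; ↔⇒≡)
open import Data.List using (List; []; _∷_; _++_; length; map; allFin)
import Data.List.Properties as Lₚ
open import Data.List.Relation.Unary.All using (All; []; _∷_)
import Data.List.Relation.Unary.All as All
import Data.List.Relation.Unary.All.Properties as Allₚ
open import Data.List.Relation.Unary.Any using (here; there)
open import Data.List.Membership.Propositional using (_∈_)
open import Data.List.Membership.Propositional.Properties using (∈-allFin)
open import Data.Product using (Σ; Σ-syntax; _×_; _,_; proj₁; proj₂)
open import Data.Sum using (_⊎_; inj₁; inj₂; [_,_]′)
open import Data.Sum.Properties using (inj₁-injective; inj₂-injective)
open import Data.Empty using (⊥; ⊥-elim)
open import Data.Unit using (⊤; tt)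
open import Function using (_∘_; id; case_of_)
open import Function.Definitions using (Injective)
open import Relation.Nullary using (¬_; Dec; yes; no)
open import Relation.Nullary.Decidable using (⌊_⌋; _×-dec_; _→-dec_; ¬?; map′)
open import Relation.Binary.PropositionalEquality using (_≡_; _≢_; refl; sym; trans; cong; cong₂; subst; module ≡-Reasoning)

-- The obstacle is that complementing inside a limb also changes the graph outside it, so the second
-- of two limbs is treated in a graph that the first has already altered. Therefore a set has to
-- supply a tree in every graph reached by local complementations, while the sets themselves stay
-- fixed. This is affordable because all vertices of a limb V with neighbours outside V share one
-- neighbourhood m there: whatever is done inside V, its effect on the outside is one bit, namely
-- whether m has been complemented. Gluing two limbs then concerns only three places: the two roots
-- and the outside. They form a triangle or a path with one of three centres; the control of the bit
-- and the choice between forms A and C settle all four shapes. That the union of the two limbs is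
-- not a limb matters when a root is put on top: where one limb alone does not suffice, it yields a
-- neighbour of the other limb in X off both limbs, and complementing at that vertex turns form C
-- into form A without leaving X.

-- Boolean identities by truth table

Formula : ℕ → Set
Formula zero    = Bool
Formula (suc n) = Bool → Formula n

valid : ∀ n → Formula n → Bool
valid zero    f = f
valid (suc n) f = valid n (f false) ∧ valid n (f true)

Valid : ∀ n → Formula n → Set
Valid zero    f = f ≡ true
Valid (suc n) f = ∀ b → Valid n (f b)

∧-elim : ∀ {a b} → a ∧ b ≡ true → a ≡ true × b ≡ true
∧-elim {true} {true} refl = refl , refl

∧-intro : ∀ {a b} → a ≡ true → b ≡ true → a ∧ b ≡ true
∧-intro refl refl = refl

-- Reflection: `valid` computes the whole truth table, so its hypothesis is always met by `refl`.
-- Side conditions of an identity are written into the formula with `_⇒_` and discharged by `mp`.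
tautology : ∀ n (f : Formula n) → valid n f ≡ true → Valid n f
tautology zero    f v = v
tautology (suc n) f v false = tautology n (f false) (proj₁ (∧-elim v))
tautology (suc n) f v true  = tautology n (f true) (proj₂ (∧-elim {valid n (f false)} v))

infixr 3 _⇒_
infix 4 _⇔_

_⇒_ : Bool → Bool → Bool
a ⇒ b = not a ∨ b

_⇔_ : Bool → Bool → Bool
a ⇔ b = not (a xor b)

mp : ∀ {a b} → (a ⇒ b) ≡ true → a ≡ true → b ≡ true
mp {true} p refl = p

⇒-intro : ∀ {a b} → (a ≡ true → b ≡ true) → (a ⇒ b) ≡ true
⇒-intro {true}  f = f refl
⇒-intro {false} f = refl

⇔→≡ : ∀ {a b} → (a ⇔ b) ≡ true → a ≡ b
⇔→≡ {false} {false} _ = refl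
⇔→≡ {true}  {true}  _ = refl

≡→⇔ : ∀ {a b} → a ≡ b → (a ⇔ b) ≡ true
≡→⇔ {false} refl = refl
≡→⇔ {true}  refl = refl

true≢false : ∀ {b : Bool} {A : Set} → b ≡ true → b ≡ false → A
true≢false refl ()

¬true→false : ∀ {b} → ¬ (b ≡ true) → b ≡ false
¬true→false {false} _ = refl
¬true→false {true}  h = ⊥-elim (h refl)

¬false→true : ∀ {b} → ¬ (b ≡ false) → b ≡ true
¬false→true {true}  _ = refl
¬false→true {false} h = ⊥-elim (h refl)

bool-ext : ∀ {a b} → (a ≡ true → b ≡ true) → (b ≡ true → a ≡ true) → a ≡ b
bool-ext {false} {false} f g = refl
bool-ext {false} {true}  f g = g refl
bool-ext {true}  {b}     f g = sym (f refl)

split-Bool : (b : Bool) → b ≡ true ⊎ b ≡ false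
split-Bool true  = inj₁ refl
split-Bool false = inj₂ refl

∨-elim : ∀ {a b} → a ∨ b ≡ true → a ≡ true ⊎ b ≡ true
∨-elim {true}  p = inj₁ refl
∨-elim {false} p = inj₂ p

∨-introˡ : ∀ {a b} → a ≡ true → a ∨ b ≡ true
∨-introˡ refl = refl

∨-introʳ : ∀ {a b} → b ≡ true → a ∨ b ≡ true
∨-introʳ {a} refl = 𝔹ₚ.∨-zeroʳ a

∨-false : ∀ {a b} → a ∨ b ≡ false → a ≡ false × b ≡ false
∨-false {false} {false} refl = refl , refl

not-true : ∀ {a} → not a ≡ true → a ≡ false
not-true {false} refl = refl

not-false : ∀ {a} → a ≡ false → not a ≡ true
not-false refl = refl

_≟𝔹_ : (a b : Bool) → Dec (a ≡ b)
_≟𝔹_ = 𝔹ₚ._≟_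

neq-true : ∀ {n} {u v : Fin n} → u ≢ v → neq u v ≡ true
neq-true {u = u} {v} h with u ≟ v
... | yes p = ⊥-elim (h p)
... | no _  = refl

eq : ∀ {n} → Fin n → Fin n → Bool
eq u v = ⌊ u ≟ v ⌋

eq-refl : ∀ {n} (u : Fin n) → eq u u ≡ true
eq-refl u with u ≟ u
... | yes _ = refl
... | no h  = ⊥-elim (h refl)

eq-sound : ∀ {n} {u v : Fin n} → eq u v ≡ true → u ≡ v
eq-sound {u = u} {v} p with u ≟ v
... | yes q = q

eq-false : ∀ {n} {u v : Fin n} → u ≢ v → eq u v ≡ false
eq-false {u = u} {v} h with u ≟ v
... | yes p = ⊥-elim (h p)
... | no _  = refl

-- Sets of vertices: exhaustive search, extensionality, counting

infix 4 _≗ˢ_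
infixr 6 _∪_
infixr 7 _∩_ _∖_

_≗ˢ_ : ∀ {n} → Subset n → Subset n → Set
S ≗ˢ S' = ∀ v → S v ≡ S' v

_∪_ _∩_ _∖_ : ∀ {n} → Subset n → Subset n → Subset n
(S ∪ S') v = S v ∨ S' v
(S ∩ S') v = S v ∧ S' v
(S ∖ S') v = S v ∧ not (S' v)

⁅_⁆ : ∀ {n} → Fin n → Subset n
⁅ x ⁆ v = eq v x

full : ∀ {n} → Subset n
full _ = true

Disjoint : ∀ {n} → Subset n → Subset n → Set
Disjoint S S' = ∀ v → S v ≡ true → S' v ≡ false

Nonempty : ∀ {n} → Subset n → Set
Nonempty S = Σ[ v ∈ _ ] S v ≡ true

Subset? : ∀ {n} (S S' : Subset n) → Dec (S ⊆ S')
Subset? S S' = all? λ v → (S v ≟𝔹 true) →-dec (S' v ≟𝔹 true)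

nonempty? : ∀ {n} (S : Subset n) → Dec (Nonempty S)
nonempty? S = any? λ v → S v ≟𝔹 true

empty-or-nonempty : ∀ {n} (S : Subset n) → Nonempty S ⊎ (∀ v → S v ≡ false)
empty-or-nonempty S with nonempty? S
... | yes p = inj₁ p
... | no ¬p = inj₂ λ v → ¬true→false λ q → ¬p (v , q)

private
  consˢ : ∀ {n} → Bool → Subset n → Subset (suc n)
  consˢ b S zero    = b
  consˢ b S (suc v) = S v

  consˢ-cong : ∀ {n b} {S S' : Subset n} → S ≗ˢ S' → consˢ b S ≗ˢ consˢ b S'
  consˢ-cong p zero    = refl
  consˢ-cong p (suc v) = p v

  η : ∀ {n} b (S : Subset (suc n)) → S zero ≡ b → S ≗ˢ consˢ b (S ∘ suc)
  η b S p zero    = p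
  η b S p (suc v) = refl

-- Minimal sets and intermediate sets are found by brute force over all subsets. A given set agrees
-- only pointwise with the one that the enumeration visits, hence the demand that P respects `_≗ˢ_`.
search : ∀ {n} (P : Subset n → Set) → (∀ S → Dec (P S)) →
  (∀ {S S'} → S ≗ˢ S' → P S → P S') → Σ (Subset n) P ⊎ (∀ S → ¬ P S)
search {zero} P P? resp with P? (λ ())
... | yes p = inj₁ (_ , p)
... | no ¬p = inj₂ λ S p → ¬p (resp (λ ()) p)
search {suc n} P P? resp
  with search (P ∘ consˢ true) (P? ∘ consˢ true) (resp ∘ consˢ-cong)
... | inj₁ (S , p) = inj₁ (_ , p)
... | inj₂ ¬t with search (P ∘ consˢ false) (P? ∘ consˢ false) (resp ∘ consˢ-cong)
...   | inj₁ (S , p) = inj₁ (_ , p)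
...   | inj₂ ¬f = inj₂ λ S p → case split-Bool (S zero) of λ where
          (inj₁ e) → ¬t (S ∘ suc) (resp (η true S e) p)
          (inj₂ e) → ¬f (S ∘ suc) (resp (η false S e) p)

-- Pointwise equal sets have identical canonical forms, so any set-indexed data can be made extensional.
canonical : ∀ {n} → Subset n → Subset n
canonical {zero}  S = λ ()
canonical {suc n} S = if S zero then consˢ true (canonical (S ∘ suc)) else consˢ false (canonical (S ∘ suc))

canonical-≗ : ∀ {n} (S : Subset n) → canonical S ≗ˢ S
canonical-≗ {suc n} S zero with S zero
... | true  = refl
... | false = refl
canonical-≗ {suc n} S (suc v) with S zero
... | true  = canonical-≗ (S ∘ suc) v
... | false = canonical-≗ (S ∘ suc) v

canonical-cong : ∀ {n} {S S' : Subset n} → S ≗ˢ S' → canonical S ≡ canonical S'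
canonical-cong {zero}  p = refl
canonical-cong {suc n} {S} {S'} p
  rewrite p zero | canonical-cong {n} {S ∘ suc} {S' ∘ suc} (p ∘ suc) = refl

private
  b2n : Bool → ℕ
  b2n true  = 1
  b2n false = 0

  count-suc : ∀ {n} (S : Subset (suc n)) → count S ≡ b2n (S zero) + count (S ∘ suc)
  count-suc S with S zero
  ... | true  = refl
  ... | false = refl

  b2n-mono : ∀ {a b} → (a ≡ true → b ≡ true) → b2n a ≤ b2n b
  b2n-mono {false} h = z≤n
  b2n-mono {true}  h rewrite h refl = ℕₚ.≤-refl

count-mono : ∀ {n} {S T : Subset n} → S ⊆ T → count S ≤ count T
count-mono {zero}  h = z≤n
count-mono {suc n} {S} {T} h rewrite count-suc S | count-suc T =
  ℕₚ.+-mono-≤ (b2n-mono (h zero)) (count-mono (h ∘ suc))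

count-strict : ∀ {n} {S T : Subset n} → S ⊆ T → ∀ x → T x ≡ true → S x ≡ false → count S < count T
count-strict {suc n} {S} {T} h zero t s
  rewrite count-suc S | count-suc T | t | s = s≤s (count-mono (h ∘ suc))
count-strict {suc n} {S} {T} h (suc x) t s rewrite count-suc S | count-suc T =
  ℕₚ.+-mono-≤-< (b2n-mono (h zero)) (count-strict (h ∘ suc) x t s)

count-∅ : ∀ {n} {S : Subset n} → (∀ v → S v ≡ false) → count S ≡ 0
count-∅ {zero}  h = refl
count-∅ {suc n} {S} h rewrite count-suc S | h zero = count-∅ (h ∘ suc)

count-pos : ∀ {n} {S : Subset n} → 1 ≤ count S → Nonempty S
count-pos {S = S} h with empty-or-nonempty S
... | inj₁ p = p
... | inj₂ e with count S | count-∅ {S = S} e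
count-pos () | inj₂ e | .0 | refl

count-two : ∀ {n} {S : Subset n} → 2 ≤ count S → Σ[ u ∈ Fin n ] Σ[ v ∈ Fin n ] S u ≡ true × S v ≡ true × u ≢ v
count-two {suc n} {S} h with S zero in e
... | true with count-pos {S = S ∘ suc} (ℕₚ.≤-pred h)
...   | v , p = zero , suc v , e , p , λ ()
count-two {suc n} {S} h | false with count-two {n} {S ∘ suc} h
... | u , v , p , q , u≢v = suc u , suc v , p , q , λ r → u≢v (Fₚ.suc-injective r)

record Enumeration {n} (S : Subset n) : Set where
  field
    size  : ℕ
    elem  : Fin size → Fin n
    inj   : Injective _≡_ _≡_ elem
    sound : ∀ i → S (elem i) ≡ true
    index : ∀ u → S u ≡ true → Fin size
    elem-index : ∀ u p → elem (index u p) ≡ u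

enumerate : ∀ {n} (S : Subset n) → Enumeration S
enumerate {zero} S = record
  { size = 0 ; elem = λ () ; inj = λ { {()} } ; sound = λ () ; index = λ () ; elem-index = λ () }
enumerate {suc n} S with S zero in e | enumerate (S ∘ suc)
... | false | r = record
  { size = size ; elem = suc ∘ elem ; inj = λ p → inj (Fₚ.suc-injective p) ; sound = sound
  ; index = λ { zero p → true≢false p e ; (suc u) p → index u p }
  ; elem-index = λ { zero p → true≢false p e ; (suc u) p → cong suc (elem-index u p) } }
  where open Enumeration r
... | true | r = record
  { size = suc size
  ; elem = λ { zero → zero ; (suc i) → suc (elem i) }
  ; inj = λ { {zero} {zero} p → refl ; {suc i} {suc j} p → cong suc (inj (Fₚ.suc-injective p)) }
  ; sound = λ { zero → e ; (suc i) → sound i }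
  ; index = λ { zero p → zero ; (suc u) p → suc (index u p) }
  ; elem-index = λ { zero p → refl ; (suc u) p → cong suc (elem-index u p) } }
  where open Enumeration r

-- Linear algebra over GF(2)

⨁-cong : ∀ {n} {f g : Fin n → Bool} → (∀ i → f i ≡ g i) → ⨁ f ≡ ⨁ g
⨁-cong {zero}  h = refl
⨁-cong {suc n} h = cong₂ _xor_ (h zero) (⨁-cong (h ∘ suc))

⨁-false : ∀ {n} {f : Fin n → Bool} → (∀ i → f i ≡ false) → ⨁ f ≡ false
⨁-false {zero}  h = refl
⨁-false {suc n} h rewrite h zero = ⨁-false (h ∘ suc)

⨁-xor : ∀ {n} (f g : Fin n → Bool) → ⨁ (λ i → f i xor g i) ≡ ⨁ f xor ⨁ g
⨁-xor {zero}  f g = refl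
⨁-xor {suc n} f g rewrite ⨁-xor (f ∘ suc) (g ∘ suc) =
  ⇔→≡ (tautology 4 (λ a b c d → (a xor b) xor (c xor d) ⇔ (a xor c) xor (b xor d)) refl
    (f zero) (g zero) (⨁ (f ∘ suc)) (⨁ (g ∘ suc)))

⨁-∧ : ∀ {n} (f : Fin n → Bool) c → ⨁ (λ i → f i ∧ c) ≡ ⨁ f ∧ c
⨁-∧ {zero}  f c = refl
⨁-∧ {suc n} f c rewrite ⨁-∧ (f ∘ suc) c =
  sym (𝔹ₚ.∧-distribʳ-xor c (f zero) (⨁ (f ∘ suc)))

⨁-single : ∀ {n} (x : Fin n) (f : Fin n → Bool) → ⨁ (λ i → eq i x ∧ f i) ≡ f x
⨁-single zero f rewrite ⨁-false {f = λ i → eq (suc i) zero ∧ f (suc i)} (λ i → refl) = 𝔹ₚ.xor-identityʳ (f zero)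
⨁-single (suc x) f = trans (⨁-cong λ i → cong (_∧ f (suc i)) (eq-suc i)) (⨁-single x (f ∘ suc))
  where
  eq-suc : ∀ i → eq (suc i) (suc x) ≡ eq i x
  eq-suc i with i ≟ x
  ... | yes refl = refl
  ... | no _ = refl

Term : ℕ → Set
Term n = Subset n × Subset n

eval : ∀ {n} → List (Term n) → Fin n → Fin n → Bool
eval []             u w = false
eval ((a , b) ∷ xs) u w = (a u ∧ b w) xor eval xs u w

-- Cut-rank at most k, witnessed by writing the cut matrix as a sum of rank-one matrices.
record CR {n} (G : Graph n) (X : Subset n) (k : ℕ) : Set where
  constructor mkCR
  field
    terms : List (Term n)
    bound : length terms ≤ k
    sums  : ∀ u w → X u ≡ true → X w ≡ false → adj G u w ≡ eval terms u w

count-remove : ∀ {n} {S : Subset n} x → count S ≤ suc (count (S ∖ ⁅ x ⁆))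
count-remove {suc n} {S} zero =
  ℕₚ.≤-trans (lem (S zero))
    (s≤s (ℕₚ.≤-trans (count-mono {S = S ∘ suc} {T = λ i → (S ∖ ⁅ zero ⁆) (suc i)} (λ v p → trans (𝔹ₚ.∧-identityʳ _) p))
      (tail≤ (S ∖ ⁅ zero ⁆))))
  where
  tail≤ : ∀ {m} (Y : Subset (suc m)) → count (Y ∘ suc) ≤ count Y
  tail≤ Y with Y zero
  ... | true  = ℕₚ.n≤1+n _
  ... | false = ℕₚ.≤-refl
  lem : ∀ b → count S ≤ suc (count (S ∘ suc))
  lem _ with S zero
  ... | true  = ℕₚ.≤-refl
  ... | false = ℕₚ.n≤1+n _
count-remove {suc n} {S} (suc x) with S zero
... | true  = s≤s (ℕₚ.≤-trans (count-remove {n} {S ∘ suc} x) (s≤s (count-mono shift)))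
  where
  shift : ((S ∘ suc) ∖ ⁅ x ⁆) ⊆ (λ i → (S ∖ ⁅ suc x ⁆) (suc i))
  shift v p with v ≟ x
  ... | yes refl = p
  ... | no _ = p
... | false = ℕₚ.≤-trans (count-remove {n} {S ∘ suc} x) (s≤s (count-mono shift))
  where
  shift : ((S ∘ suc) ∖ ⁅ x ⁆) ⊆ (λ i → (S ∖ ⁅ suc x ⁆) (suc i))
  shift v p with v ≟ x
  ... | yes refl = p
  ... | no _ = p

-- Gaussian elimination with the members of `cs` as linear forms: a pivot `u₀` with a(u₀) = 1 clears
-- the column `u₀` from the remaining forms, the induction hypothesis solves these on S without
-- `u₀`, and `u₀` is put back if needed to make a vanish.
dependent : ∀ {n} m (cs : List (Subset n)) → length cs ≡ m → (S : Subset n) → m < count S →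
  Σ[ R ∈ Subset n ] R ⊆ S × Nonempty R × All (λ c → ⨁ (λ u → R u ∧ c u) ≡ false) cs
dependent m [] len S h with count-pos {S = S} (ℕₚ.≤-trans (s≤s z≤n) h)
... | x , p = ⁅ x ⁆ , (λ v q → subst (λ y → S y ≡ true) (sym (eq-sound q)) p) , (x , eq-refl x) , []
dependent (suc m) (a ∷ cs) len S h with empty-or-nonempty (S ∩ a)
... | inj₂ e with dependent m cs (ℕₚ.suc-injective len) S (ℕₚ.<-trans (ℕₚ.n<1+n _) h)
...   | R , R⊆S , ne , z = R , R⊆S , ne , ⨁-false zero-a ∷ z
  where
  zero-a : ∀ u → R u ∧ a u ≡ false
  zero-a u with R u in r
  ... | false = refl
  ... | true  = subst (λ b → b ∧ a u ≡ false) (R⊆S u r) (e u)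
dependent {n} (suc m) (a ∷ cs) len S h | inj₁ (u₀ , p)
  with dependent m (map (λ c u → c u xor (a u ∧ c u₀)) cs) (trans (Lₚ.length-map _ cs) (ℕₚ.suc-injective len)) (S ∖ ⁅ u₀ ⁆)
         (ℕₚ.≤-pred (ℕₚ.≤-trans h (count-remove u₀)))
... | R' , R'⊆ , (x , R'x) , z = R , R⊆S , (x , Rx) , zero-a ∷ All.map fix (Allₚ.map⁻ z)
  where
  -- The parity of a on R'. Adding `u₀` exactly when it is odd makes a vanish; the other forms were
  -- altered beforehand so that they vanish on R as well.
  β : Bool
  β = ⨁ (λ u → R' u ∧ a u)
  R : Subset n
  R u = R' u xor (eq u u₀ ∧ β)
  R⊆S : R ⊆ S
  R⊆S v q with v ≟ u₀
  ... | yes refl = proj₁ (∧-elim p)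
  ... | no _ = proj₁ (∧-elim (R'⊆ v (trans (sym (𝔹ₚ.xor-identityʳ _)) q)))
  Rx : R x ≡ true
  Rx with not-true (proj₂ (∧-elim {S x} (R'⊆ x R'x)))
  ... | e rewrite e | R'x = refl
  expand : ∀ c → ⨁ (λ u → R u ∧ c u) ≡ ⨁ (λ u → R' u ∧ c u) xor (β ∧ c u₀)
  expand c = begin
    ⨁ (λ u → R u ∧ c u)
      ≡⟨ ⨁-cong (λ u → ⇔→≡ (tautology 4 (λ r e b c → ((r xor (e ∧ b)) ∧ c) ⇔ ((r ∧ c) xor (e ∧ (b ∧ c)))) refl (R' u) (eq u u₀) β (c u))) ⟩
    ⨁ (λ u → (R' u ∧ c u) xor (eq u u₀ ∧ (β ∧ c u)))
      ≡⟨ ⨁-xor (λ u → R' u ∧ c u) (λ u → eq u u₀ ∧ (β ∧ c u)) ⟩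
    ⨁ (λ u → R' u ∧ c u) xor ⨁ (λ u → eq u u₀ ∧ (β ∧ c u))
      ≡⟨ cong (⨁ (λ u → R' u ∧ c u) xor_) (⨁-single u₀ (λ u → β ∧ c u)) ⟩
    ⨁ (λ u → R' u ∧ c u) xor (β ∧ c u₀) ∎
    where open ≡-Reasoning
  zero-a : ⨁ (λ u → R u ∧ a u) ≡ false
  zero-a = trans (expand a) (trans (cong (λ b → β xor (β ∧ b)) (proj₂ (∧-elim {S u₀} p)))
             (⇔→≡ (tautology 1 (λ b → b xor (b ∧ true) ⇔ false) refl β)))
  fix : ∀ {c} → ⨁ (λ u → R' u ∧ (c u xor (a u ∧ c u₀))) ≡ false → ⨁ (λ u → R u ∧ c u) ≡ false
  fix {c} h = trans (expand c) (trans (sym expand') h)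
    where
    open ≡-Reasoning
    expand' : ⨁ (λ u → R' u ∧ (c u xor (a u ∧ c u₀))) ≡ ⨁ (λ u → R' u ∧ c u) xor (β ∧ c u₀)
    expand' = begin
      ⨁ (λ u → R' u ∧ (c u xor (a u ∧ c u₀)))
        ≡⟨ ⨁-cong (λ u → ⇔→≡ (tautology 4 (λ r c a d → (r ∧ (c xor (a ∧ d))) ⇔ ((r ∧ c) xor ((r ∧ a) ∧ d))) refl (R' u) (c u) (a u) (c u₀))) ⟩
      ⨁ (λ u → (R' u ∧ c u) xor ((R' u ∧ a u) ∧ c u₀))
        ≡⟨ ⨁-xor (λ u → R' u ∧ c u) (λ u → (R' u ∧ a u) ∧ c u₀) ⟩
      ⨁ (λ u → R' u ∧ c u) xor ⨁ (λ u → (R' u ∧ a u) ∧ c u₀)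
        ≡⟨ cong (⨁ (λ u → R' u ∧ c u) xor_) (⨁-∧ (λ u → R' u ∧ a u) (c u₀)) ⟩
      ⨁ (λ u → R' u ∧ c u) xor (β ∧ c u₀) ∎

-- With more rows than terms, some nonempty set of rows is annihilated by all left factors, hence
-- sums to zero on the cut and is not independent.
CR⇒CutRankAtMost : ∀ {n} {G : Graph n} {X k} → CR G X k → CutRankAtMost G X k
CR⇒CutRankAtMost {n} {G} {X} {k} (mkCR xs len sums) S S⊆X ind with count S ℕₚ.≤? k
... | yes p = p
... | no ¬p with dependent (length xs) (map proj₁ xs) (Lₚ.length-map proj₁ xs) S (ℕₚ.≤-<-trans len (ℕₚ.≰⇒> ¬p))
...   | R , R⊆S , (x , Rx) , z = true≢false Rx (ind R R⊆S rows x)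
  where
  vanish : ∀ ys w → All (λ c → ⨁ (λ u → R u ∧ c u) ≡ false) (map proj₁ ys) → ⨁ (λ u → R u ∧ eval ys u w) ≡ false
  vanish [] w z = ⨁-false (λ u → 𝔹ₚ.∧-zeroʳ (R u))
  vanish ((a , b) ∷ ys) w (za ∷ z) = begin
    ⨁ (λ u → R u ∧ ((a u ∧ b w) xor eval ys u w))
      ≡⟨ ⨁-cong (λ u → ⇔→≡ (tautology 4 (λ r a b e → (r ∧ ((a ∧ b) xor e)) ⇔ (((r ∧ a) ∧ b) xor (r ∧ e))) refl (R u) (a u) (b w) (eval ys u w))) ⟩
    ⨁ (λ u → ((R u ∧ a u) ∧ b w) xor (R u ∧ eval ys u w))
      ≡⟨ ⨁-xor (λ u → (R u ∧ a u) ∧ b w) (λ u → R u ∧ eval ys u w) ⟩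
    ⨁ (λ u → (R u ∧ a u) ∧ b w) xor ⨁ (λ u → R u ∧ eval ys u w)
      ≡⟨ cong₂ _xor_ (trans (⨁-∧ (λ u → R u ∧ a u) (b w)) (cong (_∧ b w) za)) (vanish ys w z) ⟩
    false ∎
    where open ≡-Reasoning
  rows : ∀ w → X w ≡ false → ⨁ (λ u → R u ∧ adj G u w) ≡ false
  rows w Xw = trans (⨁-cong same) (vanish xs w z)
    where
    same : ∀ u → R u ∧ adj G u w ≡ R u ∧ eval xs u w
    same u with R u in r
    ... | false = refl
    ... | true  = sums u w (S⊆X u (R⊆S u r)) Xw

module _ {n} (G : Graph n) (X : Subset n) where

  private
    Spanned : Subset n → Fin n → Subset n → Set
    Spanned S u R = R ⊆ S × (∀ w → X w ≡ false → ⨁ (λ s → R s ∧ adj G s w) ≡ adj G u w)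

    spanned? : ∀ S u → Σ (Subset n) (Spanned S u) ⊎ (∀ R → ¬ Spanned S u R)
    spanned? S u = search (Spanned S u)
      (λ R → Subset? R S ×-dec all? λ w → (X w ≟𝔹 false) →-dec (_ ≟𝔹 _))
      (λ e (p , q) → (λ v r → p v (trans (e v) r)) ,
         λ w x → trans (⨁-cong λ s → cong (_∧ adj G s w) (sym (e s))) (q w x))

    -- Greedy: y joins S only if its row is not yet a sum of rows of S. A vanishing sum that
    -- contains y would express y by the others, so independence is preserved.
    basis : (ys : List (Fin n)) → Σ[ S ∈ Subset n ] S ⊆ X × RowsIndependent G X S ×
      (∀ {v} → v ∈ ys → X v ≡ true → Σ (Subset n) (Spanned S v))
    basis [] = (λ _ → false) , (λ _ ()) , (λ R R⊆ _ u → ¬true→false λ r → true≢false (R⊆ u r) refl) , λ ()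
    basis (y ∷ ys) with basis ys | split-Bool (X y)
    ... | S , S⊆X , ind , sp | inj₂ e = S , S⊆X , ind ,
          λ { (here refl) p → true≢false p e ; (there m) p → sp m p }
    ... | S , S⊆X , ind , sp | inj₁ e with spanned? S y
    ...   | inj₁ r = S , S⊆X , ind , λ { (here refl) p → r ; (there m) p → sp m p }
    ...   | inj₂ ¬r = S ∪ ⁅ y ⁆ ,
          (λ v p → [ S⊆X v , (λ q → subst (λ z → X z ≡ true) (sym (eq-sound q)) e) ]′ (∨-elim p)) , ind' ,
          λ { (here refl) p → ⁅ y ⁆ , (λ v q → ∨-introʳ q) , (λ w _ → ⨁-single y (λ s → adj G s w))
            ; (there m) p → case sp m p of λ { (R , R⊆ , eqn) → R , (λ v q → ∨-introˡ (R⊆ v q)) , eqn } }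
      where
      ind' : RowsIndependent G X (S ∪ ⁅ y ⁆)
      ind' R R⊆ rows with split-Bool (R y)
      ... | inj₂ Ry = ind R (λ v p → [ id , (λ q → true≢false p (subst (λ z → R z ≡ false) (sym (eq-sound q)) Ry)) ]′ (∨-elim (R⊆ v p))) rows
      ... | inj₁ Ry = ⊥-elim (¬r (R ∖ ⁅ y ⁆) (sub , span))
        where
        sub : (R ∖ ⁅ y ⁆) ⊆ S
        sub v p with ∧-elim {R v} p
        ... | r , q with ∨-elim (R⊆ v r)
        ...   | inj₁ s = s
        ...   | inj₂ s = true≢false s (not-true q)
        split : ∀ w → ⨁ (λ s → R s ∧ adj G s w) ≡ ⨁ (λ s → (R ∖ ⁅ y ⁆) s ∧ adj G s w) xor adj G y w
        split w = trans (⨁-cong pt) (trans (⨁-xor (λ s → (R ∖ ⁅ y ⁆) s ∧ adj G s w) (λ s → eq s y ∧ adj G s w))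
                   (cong (⨁ (λ s → (R ∖ ⁅ y ⁆) s ∧ adj G s w) xor_) (⨁-single y (λ s → adj G s w))))
          where
          pt : ∀ s → R s ∧ adj G s w ≡ ((R ∖ ⁅ y ⁆) s ∧ adj G s w) xor (eq s y ∧ adj G s w)
          pt s with s ≟ y
          ... | yes refl rewrite Ry = refl
          ... | no _ rewrite 𝔹ₚ.∧-identityʳ (R s) = sym (𝔹ₚ.xor-identityʳ _)
        span : ∀ w → X w ≡ false → ⨁ (λ s → (R ∖ ⁅ y ⁆) s ∧ adj G s w) ≡ adj G y w
        span w Xw = ⇔→≡ (mp (tautology 2 (λ a b → (a xor b ⇔ false) ⇒ (a ⇔ b)) refl (⨁ (λ s → (R ∖ ⁅ y ⁆) s ∧ adj G s w)) (adj G y w))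
                      (≡→⇔ (trans (sym (split w)) (rows w Xw))))

    listed : ∀ {m} (S : Subset m) (F : Fin m → Term n) → List (Term n)
    listed {zero}  S F = []
    listed {suc m} S F = if S zero then F zero ∷ listed (S ∘ suc) (F ∘ suc) else listed (S ∘ suc) (F ∘ suc)

    listed-length : ∀ {m} (S : Subset m) F → length (listed S F) ≡ count S
    listed-length {zero}  S F = refl
    listed-length {suc m} S F with S zero
    ... | true  = cong suc (listed-length (S ∘ suc) (F ∘ suc))
    ... | false = listed-length (S ∘ suc) (F ∘ suc)

    listed-eval : ∀ {m} (S : Subset m) F u w →
      eval (listed S F) u w ≡ ⨁ (λ s → S s ∧ (proj₁ (F s) u ∧ proj₂ (F s) w))
    listed-eval {zero}  S F u w = refl
    listed-eval {suc m} S F u w with S zero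
    ... | true  = cong ((proj₁ (F zero) u ∧ proj₂ (F zero) w) xor_) (listed-eval (S ∘ suc) (F ∘ suc) u w)
    ... | false = listed-eval (S ∘ suc) (F ∘ suc) u w

  -- A rank factorization: each basis row s contributes one term, with the row itself on the right
  -- and, on the left, the coefficient of s in the expansion of each row u. Vertices off X get no
  -- coefficients, as `sums` does not look at them.
  CutRankAtMost⇒CR : ∀ {k} → CutRankAtMost G X k → CR G X k
  CutRankAtMost⇒CR {k} h with basis (allFin n)
  ... | S , S⊆X , ind , sp = mkCR (listed S F) (subst (_≤ k) (sym (listed-length S F)) (h S S⊆X ind)) eqn
    where
    combination : ∀ u → Σ[ R ∈ Subset n ] (X u ≡ true → Spanned S u R)
    combination u with X u in e
    ... | true  = proj₁ (sp (∈-allFin u) e) , λ _ → proj₂ (sp (∈-allFin u) e)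
    ... | false = (λ _ → false) , λ ()
    coeff : Fin n → Subset n
    coeff u = proj₁ (combination u)
    coeff-spec : ∀ u → X u ≡ true → Spanned S u (coeff u)
    coeff-spec u = proj₂ (combination u)
    F : Fin n → Term n
    F s = (λ u → coeff u s) , adj G s
    eqn : ∀ u w → X u ≡ true → X w ≡ false → adj G u w ≡ eval (listed S F) u w
    eqn u w Xu Xw = sym (trans (listed-eval S F u w) (trans (⨁-cong absorb) (proj₂ (coeff-spec u Xu) w Xw)))
      where
      absorb : ∀ s → S s ∧ (coeff u s ∧ adj G s w) ≡ coeff u s ∧ adj G s w
      absorb s with coeff u s in c
      ... | false = 𝔹ₚ.∧-zeroʳ (S s)
      ... | true rewrite proj₁ (coeff-spec u Xu) s c = refl

-- Limbs and layouts

-- Cut-rank at most one: the edges across the cut form a rectangle.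
record Limb {n} (G : Graph n) (Z : Subset n) : Set where
  constructor mkLimb
  field
    rectangle : ∀ u u' w w' → Z u ≡ true → Z u' ≡ true → Z w ≡ false → Z w' ≡ false →
      adj G u w ≡ true → adj G u' w' ≡ true → adj G u w' ≡ true
open Limb public

Closed : ∀ {n} → Graph n → Subset n → Subset n → Set
Closed G U S = ∀ u v → U u ≡ true → U v ≡ true → S u ≡ true → S v ≡ false → adj G u v ≡ false

-- Connectedness of G[U], phrased by cuts because these behave well under local complementation.
record Conn {n} (G : Graph n) (U : Subset n) : Set where
  constructor mkConn
  field
    spread : ∀ S → Closed G U S → ∀ u v → U u ≡ true → U v ≡ true → S u ≡ true → S v ≡ true
open Conn public

Limb-≗ : ∀ {n} {G : Graph n} {Z Z'} → Z ≗ˢ Z' → Limb G Z → Limb G Z'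
Limb-≗ e h = mkLimb λ u u' w w' p p' q q' →
  rectangle h u u' w w' (trans (e u) p) (trans (e u') p') (trans (e w) q) (trans (e w') q')

limb? : ∀ {n} (G : Graph n) Z → Dec (Limb G Z)
limb? G Z = map′ mkLimb rectangle (all? λ u → all? λ u' → all? λ w → all? λ w' →
  (Z u ≟𝔹 true) →-dec (Z u' ≟𝔹 true) →-dec (Z w ≟𝔹 false) →-dec (Z w' ≟𝔹 false) →-dec
  (adj G u w ≟𝔹 true) →-dec (adj G u' w' ≟𝔹 true) →-dec (adj G u w' ≟𝔹 true))

Limb-∁ : ∀ {n} {G : Graph n} {Z} → Limb G Z → Limb G (complement Z)
Limb-∁ {G = G} h = mkLimb λ u u' w w' p p' q q' e e' → trans (adj-sym G u w')
  (rectangle h w' w u' u (in' q') (in' q) (not-true p') (not-true p) (trans (adj-sym G w' u') e') (trans (adj-sym G w u) e))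
  where
  in' : ∀ {a} → not a ≡ false → a ≡ true
  in' {true} _ = refl

Limb-singleton : ∀ {n} (G : Graph n) x → Limb G ⁅ x ⁆
Limb-singleton G x = mkLimb λ u u' w w' p p' q q' e e' →
  subst (λ z → adj G z w' ≡ true) (trans (eq-sound p') (sym (eq-sound p))) e'

adj-sym-true : ∀ {n} (G : Graph n) {u v} → adj G u v ≡ true → adj G v u ≡ true
adj-sym-true G {u} {v} e = trans (adj-sym G v u) e

adj-sym-false : ∀ {n} (G : Graph n) {u v} → adj G u v ≡ false → adj G v u ≡ false
adj-sym-false G {u} {v} e = trans (adj-sym G v u) e

crossing : ∀ {n} {G : Graph n} {U} → Conn G U → ∀ S {x y} → U x ≡ true → U y ≡ true → S x ≡ true → S y ≡ false →
  Σ[ z ∈ Fin n ] Σ[ t ∈ Fin n ] U z ≡ true × U t ≡ true × S z ≡ true × S t ≡ false × adj G z t ≡ true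
crossing {G = G} {U} conn S {x} {y} Ux Uy Sx Sy
  with (any? λ z → any? λ t → (U z ≟𝔹 true) ×-dec (U t ≟𝔹 true) ×-dec (S z ≟𝔹 true) ×-dec (S t ≟𝔹 false) ×-dec (adj G z t ≟𝔹 true))
... | yes p = p
... | no ¬p = true≢false (spread conn S (λ u v a b c d → ¬true→false λ e → ¬p (u , v , a , b , c , d , e)) x y Ux Uy Sx) Sy

-- An instance of submodularity of cut-rank, shown by hand. If a common vertex z has a neighbour
-- outside the union, every vertex with such a neighbour has the same ones as z. Otherwise
-- connectedness gives an edge from some common z to a vertex in just one of the sets, say Z. Then
-- no vertex of Z' has a neighbour outside the union, for z would share it. So all edges leaving the
-- union start in Z, and the rectangle of Z suffices.
Limb-∪ : ∀ {n} {G : Graph n} {Z Z'} → Conn G full → Limb G Z → Limb G Z' →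
  ∀ {x} → Z x ≡ true → Z' x ≡ true → Limb G (Z ∪ Z')
Limb-∪ {n} {G} {Z} {Z'} conn L L' {x} Zx Z'x = mkLimb united
 where
 united : ∀ u u' w w' → (Z ∪ Z') u ≡ true → (Z ∪ Z') u' ≡ true → (Z ∪ Z') w ≡ false → (Z ∪ Z') w' ≡ false →
   adj G u w ≡ true → adj G u' w' ≡ true → adj G u w' ≡ true
 united u u' w w' p p' q q' e e'
  with (any? λ z → any? λ t → (Z z ≟𝔹 true) ×-dec (Z' z ≟𝔹 true) ×-dec ((Z ∪ Z') t ≟𝔹 false) ×-dec (adj G z t ≟𝔹 true))
 ... | yes (z , t , Zz , Z'z , ∉t , zt) = through u w p q e (through z t (∨-introˡ Zz) ∉t zt zw')
   where
   out : ∀ {v} → (Z ∪ Z') v ≡ false → Z v ≡ false × Z' v ≡ false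
   out = ∨-false
   zw' : adj G z w' ≡ true
   zw' with ∨-elim {Z u'} p'
   ... | inj₁ Zu' = rectangle L z u' t w' Zz Zu' (proj₁ (out ∉t)) (proj₁ (out q')) zt e'
   ... | inj₂ Z'u' = rectangle L' z u' t w' Z'z Z'u' (proj₂ (out ∉t)) (proj₂ (out q')) zt e'
   through : ∀ v y → (Z ∪ Z') v ≡ true → (Z ∪ Z') y ≡ false → adj G v y ≡ true → adj G z w' ≡ true → adj G v w' ≡ true
   through v y pv qy vy zw with ∨-elim {Z v} pv
   ... | inj₁ Zv = rectangle L v z y w' Zv Zz (proj₁ (out qy)) (proj₁ (out q')) vy zw
   ... | inj₂ Z'v = rectangle L' v z y w' Z'v Z'z (proj₂ (out qy)) (proj₂ (out q')) vy zw
 ... | no ¬p with crossing conn (Z ∩ Z') {x} {w} refl refl (∧-intro Zx Z'x) (cong (_∧ Z' w) (proj₁ (∨-false q)))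
 ...   | z , y , _ , _ , zin , yout , zy = concl
   where
   Zz = proj₁ (∧-elim {Z z} zin)
   Z'z = proj₂ (∧-elim {Z z} zin)
   no-edge : ∀ t → (Z ∪ Z') t ≡ false → adj G z t ≡ false
   no-edge t t∉ = ¬true→false λ zt → ¬p (z , t , Zz , Z'z , t∉ , zt)
   concl : adj G u w' ≡ true
   concl with split-Bool (Z y) | split-Bool (Z' y)
   ... | inj₂ a | inj₂ b = true≢false zy (no-edge y (trans (cong (_∨ Z' y) a) b))
   ... | inj₁ a | inj₁ b = true≢false (∧-intro a b) yout
   ... | inj₁ a | inj₂ b = rectangle L u u' w w' (inZ p e q) (inZ p' e' q') (proj₁ (∨-false q)) (proj₁ (∨-false q')) e e'
     where
     inZ : ∀ {v t} → (Z ∪ Z') v ≡ true → adj G v t ≡ true → (Z ∪ Z') t ≡ false → Z v ≡ true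
     inZ {v} {t} pv vt qt with ∨-elim {Z v} pv
     ... | inj₁ r = r
     ... | inj₂ r = true≢false (rectangle L' z v y t Z'z r b (proj₂ (∨-false {Z t} qt)) zy vt) (no-edge t qt)
   ... | inj₂ a | inj₁ b = rectangle L' u u' w w' (inZ' p e q) (inZ' p' e' q') (proj₂ (∨-false {Z w} q)) (proj₂ (∨-false {Z w'} q')) e e'
     where
     inZ' : ∀ {v t} → (Z ∪ Z') v ≡ true → adj G v t ≡ true → (Z ∪ Z') t ≡ false → Z' v ≡ true
     inZ' {v} {t} pv vt qt with ∨-elim {Z v} pv
     ... | inj₂ r = r
     ... | inj₁ r = true≢false (rectangle L z v y t Zz r a (proj₁ (∨-false qt)) zy vt) (no-edge t qt)

module _ {n} {G : Graph n} where

  CR-≗ : ∀ {X Y k} → X ≗ˢ Y → CR G X k → CR G Y k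
  CR-≗ e (mkCR xs l s) = mkCR xs l λ u w p q → s u w (trans (e u) p) (trans (e w) q)

  CR-mono : ∀ {X j k} → j ≤ k → CR G X j → CR G X k
  CR-mono h (mkCR xs l s) = mkCR xs (ℕₚ.≤-trans l h) s

  CR-trivial : ∀ {X} → (∀ u w → X u ≡ true → X w ≡ false → adj G u w ≡ false) → CR G X 0
  CR-trivial h = mkCR [] z≤n h

  private
    mask : Subset n → Term n → Term n
    mask M (a , b) = a ∩ M , b

    eval-mask : ∀ M xs u w → eval (map (mask M) xs) u w ≡ M u ∧ eval xs u w
    eval-mask M [] u w = sym (𝔹ₚ.∧-zeroʳ (M u))
    eval-mask M ((a , b) ∷ xs) u w rewrite eval-mask M xs u w =
      ⇔→≡ (tautology 4 (λ m a b e → (((a ∧ m) ∧ b) xor (m ∧ e)) ⇔ (m ∧ ((a ∧ b) xor e))) refl (M u) (a u) (b w) (eval xs u w))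

    eval-++ : ∀ (xs ys : List (Term n)) u w → eval (xs ++ ys) u w ≡ eval xs u w xor eval ys u w
    eval-++ [] ys u w = refl
    eval-++ ((a , b) ∷ xs) ys u w rewrite eval-++ xs ys u w = sym (𝔹ₚ.xor-assoc (a u ∧ b w) _ _)

    transpose : Term n → Term n
    transpose (a , b) = b , a

    eval-transpose : ∀ xs u w → eval (map transpose xs) u w ≡ eval xs w u
    eval-transpose [] u w = refl
    eval-transpose ((a , b) ∷ xs) u w = cong₂ _xor_ (𝔹ₚ.∧-comm (b u) (a w)) (eval-transpose xs u w)

  -- The rows of X use the first family of terms and the rows of Y off X the second; the masks keep
  -- the families from interfering.
  CR-∪ : ∀ {X Y j k} → CR G X j → CR G Y k → CR G (X ∪ Y) (j + k)
  CR-∪ {X} {Y} {j} {k} (mkCR xs l s) (mkCR ys l' s') = mkCR zs len eqn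
    where
    zs = map (mask X) xs ++ map (mask (complement X)) ys
    len : length zs ≤ j + k
    len rewrite Lₚ.length-++ (map (mask X) xs) {map (mask (complement X)) ys} | Lₚ.length-map (mask X) xs | Lₚ.length-map (mask (complement X)) ys =
      ℕₚ.+-mono-≤ l l'
    eqn : ∀ u w → (X ∪ Y) u ≡ true → (X ∪ Y) w ≡ false → adj G u w ≡ eval zs u w
    eqn u w p q rewrite eval-++ (map (mask X) xs) (map (mask (complement X)) ys) u w
      | eval-mask X xs u w | eval-mask (complement X) ys u w with X u in Xu
    ... | true  = trans (s u w Xu (proj₁ (∨-false q))) (sym (𝔹ₚ.xor-identityʳ _))
    ... | false = s' u w p (proj₂ (∨-false {X w} q))

  CR-∁ : ∀ {X k} → CR G X k → CR G (complement X) k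
  CR-∁ {X} {k} (mkCR xs l s) = mkCR (map transpose xs) (subst (_≤ k) (sym (Lₚ.length-map transpose xs)) l) eqn
    where
    eqn : ∀ u w → not (X u) ≡ true → not (X w) ≡ false → adj G u w ≡ eval (map transpose xs) u w
    eqn u w p q = trans (adj-sym G u w) (trans (s w u (¬false→true λ e → true≢false (cong not e) q) (not-true p))
                    (sym (eval-transpose xs u w)))

  CR-∩ : ∀ {X Y j k} → CR G X j → CR G Y k → CR G (X ∩ Y) (j + k)
  CR-∩ {X} {Y} c d = CR-≗ (λ v → deMorgan (X v) (Y v)) (CR-∁ (CR-∪ (CR-∁ c) (CR-∁ d)))
    where
    deMorgan : ∀ a b → not (not a ∨ not b) ≡ a ∧ b
    deMorgan true  b = 𝔹ₚ.not-involutive b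
    deMorgan false b = refl

  Limb⇒CR : ∀ {Z} → Limb G Z → CR G Z 1
  Limb⇒CR {Z} L with (any? λ u → any? λ w → (Z u ≟𝔹 true) ×-dec (Z w ≟𝔹 false) ×-dec (adj G u w ≟𝔹 true))
  ... | no ¬p = CR-mono z≤n (CR-trivial λ u w p q → ¬true→false λ e → ¬p (u , w , p , q , e))
  ... | yes (u₀ , w₀ , p₀ , q₀ , e₀) = mkCR (((λ u → adj G u w₀) , adj G u₀) ∷ []) ℕₚ.≤-refl λ u w p q →
    bool-ext (λ e → trans (𝔹ₚ.xor-identityʳ _) (∧-intro (rectangle L u u₀ w w₀ p p₀ q q₀ e e₀) (rectangle L u₀ u w₀ w p₀ p q₀ q e₀ e)))
      (λ e → let (a , b) = ∧-elim {adj G u w₀} (trans (sym (𝔹ₚ.xor-identityʳ _)) e) in rectangle L u u₀ w₀ w p p₀ q₀ q a b)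

  CR⇒Limb : ∀ {Z} → CR G Z 1 → Limb G Z
  CR⇒Limb (mkCR [] l s) = mkLimb λ u u' w w' p p' q q' e e' → true≢false e (s u w p q)
  CR⇒Limb {Z} (mkCR ((a , b) ∷ []) l s) = mkLimb λ u u' w w' p p' q q' e e' →
    trans (factor u w' p q') (∧-intro (proj₁ (∧-elim (trans (sym (factor u w p q)) e)))
      (proj₂ (∧-elim {a u'} (trans (sym (factor u' w' p' q')) e'))))
    where
    factor : ∀ u w → Z u ≡ true → Z w ≡ false → adj G u w ≡ a u ∧ b w
    factor u w p q = trans (s u w p q) (𝔹ₚ.xor-identityʳ _)
  CR⇒Limb (mkCR (_ ∷ _ ∷ _) (s≤s ()) s)

  -- A layout of S of width at most k, with the last vertex outermost.
  data Lin (k : ℕ) (S : Subset n) : Set where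
    lin-∅ : (∀ v → S v ≡ false) → Lin k S
    lin-+ : ∀ {S'} v → S v ≡ true → S' v ≡ false → (∀ w → w ≢ v → S w ≡ S' w) → CR G S k → Lin k S' → Lin k S

  Lin-≗ : ∀ {k S T} → S ≗ˢ T → Lin k S → Lin k T
  Lin-≗ e (lin-∅ h) = lin-∅ λ v → trans (sym (e v)) (h v)
  Lin-≗ e (lin-+ v p q r c l) = lin-+ v (trans (sym (e v)) p) q (λ w h → trans (sym (e w)) (r w h)) (CR-≗ e c) l

  Lin-mono : ∀ {j k S} → j ≤ k → Lin j S → Lin k S
  Lin-mono h (lin-∅ e) = lin-∅ e
  Lin-mono h (lin-+ v p q r c l) = lin-+ v p q r (CR-mono h c) (Lin-mono h l)

  -- Y is laid out first and Z after it, vertices already placed being skipped. While Z is added,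
  -- each prefix is Y together with a prefix of Z, so its rank is at most c + k.
  Lin-∪ : ∀ {c k K Y Z} → CR G Y c → c + k ≤ K → Lin K Y → Lin k Z → Lin K (Y ∪ Z)
  Lin-∪ {Y = Y} cY le lY (lin-∅ h) = Lin-≗ (λ v → trans (sym (𝔹ₚ.∨-identityʳ (Y v))) (cong (Y v ∨_) (sym (h v)))) lY
  Lin-∪ {Y = Y} {Z} cY le lY (lin-+ {S'} v p q r cZ lZ) with split-Bool (Y v)
  ... | inj₁ Yv = Lin-≗ same (Lin-∪ cY le lY lZ)
    where
    same : ∀ w → Y w ∨ S' w ≡ Y w ∨ Z w
    same w with w ≟ v
    ... | yes refl rewrite Yv = refl
    ... | no h = cong (Y w ∨_) (sym (r w h))
  ... | inj₂ Yv = lin-+ v (∨-introʳ p) (trans (cong (_∨ S' v) Yv) q) (λ w h → cong (Y w ∨_) (r w h))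
                    (CR-mono le (CR-∪ cY cZ)) (Lin-∪ cY le lY lZ)

-- Prime quotients and layouts along chains of limbs

ProperLimb : ∀ {n} → Graph n → Subset n → Set
ProperLimb {n} G V = Limb G V × Nonempty V × Σ[ w ∈ Fin n ] V w ≡ false

properLimb? : ∀ {n} (G : Graph n) V → Dec (ProperLimb G V)
properLimb? G V = limb? G V ×-dec nonempty? V ×-dec any? λ w → V w ≟𝔹 false

ProperLimb-≗ : ∀ {n} {G : Graph n} {V W} → V ≗ˢ W → ProperLimb G V → ProperLimb G W
ProperLimb-≗ e (L , (v , p) , (w , q)) = Limb-≗ e L , (v , trans (sym (e v)) p) , (w , trans (sym (e w)) q)

Conn⇒Connected : ∀ {n} {G : Graph n} → Conn G full → Connected G
Conn⇒Connected {n} {G} conn u v = grow (count (complement ⁅ u ⁆)) ⁅ u ⁆ ℕₚ.≤-refl (eq-refl u)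
    (λ w p → subst (Reach G u) (sym (eq-sound p)) here)
  where
  snoc : ∀ {x y z} → Reach G x y → adj G y z ≡ true → Reach G x z
  snoc here e = step e here
  snoc (step e' r) e = step e' (snoc r e)
  grow : ∀ N (S : Subset n) → count (complement S) ≤ N → S u ≡ true → (∀ w → S w ≡ true → Reach G u w) → Reach G u v
  grow N S h Su r with split-Bool (S v)
  ... | inj₁ Sv = r v Sv
  ... | inj₂ Sv with crossing conn S {u} {v} refl refl Su Sv
  grow zero S h Su r | inj₂ Sv | _ with ℕₚ.≤-trans (count-strict {S = λ _ → false} {complement S} (λ _ ()) v (not-false Sv) refl) h
  ... | le = ⊥-elim (ℕₚ.n≮0 le)
  grow (suc N) S h Su r | inj₂ Sv | z , t , _ , _ , Sz , St , zt =
    grow N (S ∪ ⁅ t ⁆) (ℕₚ.≤-pred (ℕₚ.≤-trans (count-strict shrink t (not-false St) (cong not (∨-introʳ {S t} (eq-refl t)))) h))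
      (∨-introˡ Su) λ w p → [ r w , (λ q → subst (Reach G u) (sym (eq-sound q)) (snoc (r z Sz) zt)) ]′ (∨-elim {S w} p)
    where
    shrink : complement (S ∪ ⁅ t ⁆) ⊆ complement S
    shrink w p = cong not (proj₁ (∨-false (not-true p)))

<ᵇ-true : ∀ {m n} → m < n → (m <ᵇ n) ≡ true
<ᵇ-true {zero}  (s≤s h) = refl
<ᵇ-true {suc m} (s≤s h) = <ᵇ-true h

<ᵇ-sound : ∀ {m n} → (m <ᵇ n) ≡ true → m < n
<ᵇ-sound {zero}  {suc n} e = s≤s z≤n
<ᵇ-sound {suc m} {suc n} e = s≤s (<ᵇ-sound e)

prefix-zero : ∀ {m} (π : Permutation m m) x → prefix π 0 x ≡ false
prefix-zero π x with toℕ (π ⟨$⟩ˡ x)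
... | zero  = refl
... | suc _ = refl

prefix-full : ∀ {m} (π : Permutation m m) x i → m ≤ i → prefix π i x ≡ true
prefix-full π x i h = <ᵇ-true (ℕₚ.≤-trans (Fₚ.toℕ<n (π ⟨$⟩ˡ x)) h)

prefix-suc : ∀ {m} (π : Permutation m m) i (h : i < m) x →
  prefix π i x ∨ eq x (π ⟨$⟩ʳ fromℕ< h) ≡ prefix π (suc i) x
prefix-suc {m} π i h x = bool-ext to from
  where
  y : Fin m
  y = π ⟨$⟩ʳ fromℕ< h
  to : prefix π i x ∨ eq x y ≡ true → prefix π (suc i) x ≡ true
  to q with ∨-elim {prefix π i x} q
  ... | inj₁ r = <ᵇ-true (ℕₚ.<-trans (<ᵇ-sound r) (ℕₚ.n<1+n i))
  ... | inj₂ r = <ᵇ-true (s≤s (ℕₚ.≤-reflexive (trans (cong (toℕ ∘ (π ⟨$⟩ˡ_)) (eq-sound r))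
                   (trans (cong toℕ (inverseˡ π)) (Fₚ.toℕ-fromℕ< h)))))
  from : prefix π (suc i) x ≡ true → prefix π i x ∨ eq x y ≡ true
  from q with toℕ (π ⟨$⟩ˡ x) ℕₚ.<? i
  ... | yes r = ∨-introˡ (<ᵇ-true r)
  ... | no ¬r = ∨-introʳ (subst (λ z → eq x z ≡ true) x≡y (eq-refl x))
    where
    x≡y : x ≡ y
    x≡y = trans (sym (inverseʳ π)) (cong (π ⟨$⟩ʳ_) (Fₚ.toℕ-injective
      (trans (ℕₚ.≤-antisym (ℕₚ.≤-pred (<ᵇ-sound q)) (ℕₚ.≮⇒≥ ¬r)) (sym (Fₚ.toℕ-fromℕ< h)))))

-- The width condition speaks of 1 ≤ i ≤ m - 1 only; the empty prefix and the full ones have no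
-- crossing edge.
layout-CR : ∀ {m} {H : Graph m} {p} (l : LrwAtMost H p) i → CR H (prefix (proj₁ l) i) p
layout-CR (π , width) zero = CR-mono z≤n (CR-trivial λ u w p q → true≢false p (prefix-zero π u))
layout-CR {m} {H} (π , width) (suc i) with suc i ℕₚ.≤? m ∸ 1
... | yes h = CutRankAtMost⇒CR H _ (width (suc i) (s≤s z≤n) h)
... | no h = CR-mono z≤n (CR-trivial λ u w p q → true≢false (prefix-full π w (suc i) m≤) q)
  where
  m≤ : m ≤ suc i
  m≤ = ℕₚ.≤-trans (ℕₚ.m≤n+m∸n m 1) (ℕₚ.≰⇒> h)

-- ρ picks a representative in each class of a partition into limbs, and bd marks the
-- vertices having a neighbour outside their class.
record Quotient {n} (G : Graph n) : Set where
  field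
    ρ    : Fin n → Fin n
    bd   : Subset n
    ρρ   : ∀ v → ρ (ρ v) ≡ ρ v
    bdρ  : ∀ v → bd (ρ v) ≡ true
    form : ∀ v w → ρ v ≢ ρ w → adj G v w ≡ bd v ∧ (bd w ∧ adj G (ρ v) (ρ w))

  Saturated : Subset n → Set
  Saturated Z = ∀ v → Z v ≡ Z (ρ v)

  fixed : Subset n
  fixed u = eq (ρ u) u

trivialQuotient : ∀ {n} (G : Graph n) → Quotient G
trivialQuotient G = record { ρ = id ; bd = full ; ρρ = λ _ → refl ; bdρ = λ _ → refl ; form = λ _ _ _ → refl }

record Contraction {n} {G : Graph n} (Q : Quotient G) (Z : Subset n) : Set where
  field
    quotient : Quotient G
    z        : Fin n
    z∈Z      : Z z ≡ true
    z-fixed  : Quotient.ρ Q z ≡ z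
    inside   : ∀ v → Z v ≡ true → Quotient.ρ quotient v ≡ z
    outside  : ∀ v → Z v ≡ false → Quotient.ρ quotient v ≡ Quotient.ρ Q v

-- An edge leaving Z, moved to the representatives `z` and `w₀` of its ends, is still an edge by
-- `form`. Since Z is a limb, the vertices of Z with a neighbour outside are exactly the neighbours
-- of `w₀`, and these serve as the new `bd` on Z.
contract : ∀ {n} {G : Graph n} → Conn G full → (Q : Quotient G) → ∀ {Z} → ProperLimb G Z → Quotient.Saturated Q Z → Contraction Q Z
contract {n} {G} conn Q {Z} (L , (x , Zx) , (y , Zy)) sat with crossing conn Z {x} {y} refl refl Zx Zy
... | z₁ , t₁ , _ , _ , Zz₁ , Zt₁ , e₁ = record
  { quotient = record { ρ = ρ' ; bd = bd' ; ρρ = ρρ' ; bdρ = bdρ' ; form = form' }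
  ; z = z ; z∈Z = Zz ; z-fixed = ρρ z₁ ; inside = inside ; outside = outside }
  where
  open Quotient Q
  z w₀ : Fin n
  z = ρ z₁
  w₀ = ρ t₁
  Zz : Z z ≡ true
  Zz = trans (sym (sat z₁)) Zz₁
  Zw₀ : Z w₀ ≡ false
  Zw₀ = trans (sym (sat t₁)) Zt₁
  apart : ∀ {v w} → Z v ≡ true → Z w ≡ false → ρ v ≢ ρ w
  apart {v} {w} p q e = true≢false (trans (sym (sat v)) p) (trans (cong Z e) (trans (sym (sat w)) q))
  zw₀ : adj G z w₀ ≡ true
  zw₀ = proj₂ (∧-elim {bd t₁} (proj₂ (∧-elim {bd z₁} (trans (sym (form z₁ t₁ (apart Zz₁ Zt₁))) e₁))))
  ρ' : Fin n → Fin n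
  ρ' v = if Z v then z else ρ v
  bd' : Subset n
  bd' v = if Z v then adj G v w₀ else bd v
  inside : ∀ v → Z v ≡ true → ρ' v ≡ z
  inside v p rewrite p = refl
  outside : ∀ v → Z v ≡ false → ρ' v ≡ ρ v
  outside v p rewrite p = refl
  bd-inside : ∀ v → Z v ≡ true → bd' v ≡ adj G v w₀
  bd-inside v p rewrite p = refl
  bd-outside : ∀ v → Z v ≡ false → bd' v ≡ bd v
  bd-outside v p rewrite p = refl
  ρρ' : ∀ v → ρ' (ρ' v) ≡ ρ' v
  ρρ' v with split-Bool (Z v)
  ... | inj₁ p rewrite inside v p = inside z Zz
  ... | inj₂ p rewrite outside v p = trans (outside (ρ v) (trans (sym (sat v)) p)) (ρρ v)
  bdρ' : ∀ v → bd' (ρ' v) ≡ true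
  bdρ' v with split-Bool (Z v)
  ... | inj₁ p rewrite inside v p = trans (bd-inside z Zz) zw₀
  ... | inj₂ p rewrite outside v p = trans (bd-outside (ρ v) (trans (sym (sat v)) p)) (bdρ v)
  to-rep : ∀ v w → ρ v ≢ ρ w → adj G v w ≡ bd w ∧ adj G v (ρ w)
  to-rep v w h rewrite form v w h | form v (ρ w) (λ e → h (trans e (ρρ w))) | bdρ w | ρρ w =
    ⇔→≡ (tautology 3 (λ a b c → (a ∧ (b ∧ c)) ⇔ (b ∧ (a ∧ c))) refl (bd v) (bd w) (adj G (ρ v) (ρ w)))
  factor : ∀ v u → Z v ≡ true → Z u ≡ false → adj G v u ≡ adj G v w₀ ∧ adj G z u
  factor v u p q = bool-ext
    (λ e → ∧-intro (rectangle L v z u w₀ p Zz q Zw₀ e zw₀) (rectangle L z v w₀ u Zz p Zw₀ q zw₀ e))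
    (λ e → let (a , b) = ∧-elim {adj G v w₀} e in rectangle L v z w₀ u p Zz Zw₀ q a b)
  cross : ∀ v w → Z v ≡ true → Z w ≡ false → adj G v w ≡ bd' v ∧ (bd' w ∧ adj G (ρ' v) (ρ' w))
  cross v w p q rewrite inside v p | outside w q | bd-inside v p | bd-outside w q
    | to-rep v w (apart p q) | factor v (ρ w) p (trans (sym (sat w)) q) =
    ⇔→≡ (tautology 3 (λ a b c → (b ∧ (a ∧ c)) ⇔ (a ∧ (b ∧ c))) refl (adj G v w₀) (bd w) (adj G z (ρ w)))
  form' : ∀ v w → ρ' v ≢ ρ' w → adj G v w ≡ bd' v ∧ (bd' w ∧ adj G (ρ' v) (ρ' w))
  form' v w h with split-Bool (Z v) | split-Bool (Z w)
  ... | inj₁ p | inj₁ q = ⊥-elim (h (trans (inside v p) (sym (inside w q))))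
  ... | inj₁ p | inj₂ q = cross v w p q
  ... | inj₂ p | inj₁ q = trans (adj-sym G v w) (trans (cross w v q p)
      (trans (cong (λ c → bd' w ∧ (bd' v ∧ c)) (adj-sym G (ρ' w) (ρ' v)))
        (⇔→≡ (tautology 3 (λ a b c → (b ∧ (a ∧ c)) ⇔ (a ∧ (b ∧ c))) refl (bd' v) (bd' w) (adj G (ρ' v) (ρ' w))))))
  ... | inj₂ p | inj₂ q rewrite outside v p | outside w q | bd-outside v p | bd-outside w q = form v w h

PrimesBounded : ∀ {n} → Graph n → ℕ → Set
PrimesBounded {n} G p = ∀ {m : ℕ} (f : Fin m → Fin n) → Injective _≡_ _≡_ f →
  Prime (induce G f) → LrwAtMost (induce G f) p

module Fill {n} {G : Graph n} (conn : Conn G full) {p k : ℕ} (primes : PrimesBounded G p) where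

  -- A and B are consecutive limbs: contracting A, the complement of B and the maximal
  -- limbs of B ∖ A leaves a prime graph, whose layout guides the insertion of B ∖ A.
  module Gap {A B : Subset n} (LA : ProperLimb G A) (LB : ProperLimb G B) (A⊆B : A ⊆ B)
    (gap : ∀ C → Limb G C → A ⊆ C → C ⊆ B → Nonempty (C ∖ A) → ¬ Nonempty (B ∖ C))
    (small : ∀ Z → ProperLimb G Z → Z ⊆ (B ∖ A) → Lin {G = G} k Z)
    {K} (K≥ : suc (suc p) + k ≤ K) (LinA : Lin {G = G} K A) where

    D : Subset n
    D = B ∖ A

    -- The invariant of the contraction process. By `onD` the classes other than those of `a` and
    -- `b` stay within `D`, so that in the end `small` provides layouts for them.
    record State : Set where
      field
        Q : Quotient G
      open Quotient Q public
      field
        a b  : Fin n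
        Aa   : A a ≡ true
        Bb   : B b ≡ false
        onA  : ∀ v → A v ≡ true → ρ v ≡ a
        offB : ∀ v → B v ≡ false → ρ v ≡ b
        onD  : ∀ v → D v ≡ true → D (ρ v) ≡ true

    initial : State
    initial = record
      { Q = C₂.quotient ; a = C₁.z ; b = C₂.z ; Aa = C₁.z∈Z ; Bb = not-true C₂.z∈Z
      ; onA = λ v p → trans (C₂.outside v (cong not (A⊆B v p))) (C₁.inside v p)
      ; offB = λ v p → C₂.inside v (not-false p)
      ; onD = λ v p → subst (λ x → D x ≡ true)
          (sym (trans (C₂.outside v (cong not (proj₁ (∧-elim {B v} p)))) (C₁.outside v (not-true (proj₂ (∧-elim {B v} p)))))) p }
      where
      c₁ = contract conn (trivialQuotient G) LA (λ _ → refl)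
      module C₁ = Contraction c₁
      sat : Quotient.Saturated C₁.quotient (complement B)
      sat v with split-Bool (A v)
      ... | inj₁ p rewrite C₁.inside v p = cong not (trans (A⊆B v p) (sym (A⊆B _ C₁.z∈Z)))
      ... | inj₂ p rewrite C₁.outside v p = refl
      LB' : ProperLimb G (complement B)
      LB' = Limb-∁ (proj₁ LB) , (proj₁ (proj₂ (proj₂ LB)) , not-false (proj₂ (proj₂ (proj₂ LB)))) ,
            (proj₁ (proj₁ (proj₂ LB)) , cong not (proj₂ (proj₁ (proj₂ LB))))
      module C₂ = Contraction (contract conn C₁.quotient LB' sat)

    -- The two distinct representatives u and v ensure progress: after Z is contracted at most one
    -- of them is still fixed by `ρ`, so the number of classes drops and `saturate` terminates.
    Mergeable : State → Subset n → Set
    Mergeable s Z = Saturated Z × Limb G Z × Z ⊆ D ×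
      Σ[ u ∈ Fin n ] Σ[ v ∈ Fin n ] Z u ≡ true × Z v ≡ true × u ≢ v × ρ u ≡ u × ρ v ≡ v
      where open State s

    mergeable? : ∀ s → Σ (Subset n) (Mergeable s) ⊎ (∀ Z → ¬ Mergeable s Z)
    mergeable? s = search (Mergeable s)
      (λ Z → (all? λ v → Z v ≟𝔹 Z (ρ v)) ×-dec limb? G Z ×-dec Subset? Z D ×-dec
        any? λ u → any? λ v → (Z u ≟𝔹 true) ×-dec (Z v ≟𝔹 true) ×-dec ¬? (u ≟ v) ×-dec (ρ u ≟ u) ×-dec (ρ v ≟ v))
      (λ e (sat , L , Z⊆D , u , v , p , q , r) → (λ w → trans (sym (e w)) (trans (sat w) (e (ρ w)))) , Limb-≗ e L ,
        (λ w h → Z⊆D w (trans (e w) h)) , u , v , trans (sym (e u)) p , trans (sym (e v)) q , r)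
      where open State s

    saturate : ∀ N (s : State) → count (State.fixed s) ≤ N → Σ[ s' ∈ State ] (∀ Z → ¬ Mergeable s' Z)
    saturate N s h with mergeable? s
    ... | inj₂ ¬m = s , ¬m
    ... | inj₁ (Z , sat , L , Z⊆D , u , v , Zu , Zv , u≢v , fu , fv) = recurse N h
      where
      open State s
      a∉D : ∀ {x} → A x ≡ true → Z x ≡ false
      a∉D {x} p = ¬true→false λ q → true≢false p (not-true (proj₂ (∧-elim {B x} (Z⊆D x q))))
      b∉D : ∀ {x} → B x ≡ false → Z x ≡ false
      b∉D {x} p = ¬true→false λ q → true≢false (proj₁ (∧-elim {B x} (Z⊆D x q))) p
      module C = Contraction (contract conn Q (L , (u , Zu) , (a , a∉D Aa)) sat)
      s' : State
      s' = record
        { Q = C.quotient ; a = a ; b = b ; Aa = Aa ; Bb = Bb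
        ; onA = λ x p → trans (C.outside x (a∉D p)) (onA x p)
        ; offB = λ x p → trans (C.outside x (b∉D p)) (offB x p)
        ; onD = onD' }
        where
        onD' : ∀ x → D x ≡ true → D (Quotient.ρ C.quotient x) ≡ true
        onD' x p with split-Bool (Z x)
        ... | inj₁ q rewrite C.inside x q = Z⊆D C.z C.z∈Z
        ... | inj₂ q rewrite C.outside x q = onD x p
      fixed⊆ : State.fixed s' ⊆ fixed
      fixed⊆ x q with split-Bool (Z x)
      ... | inj₁ Zx = subst (λ y → fixed y ≡ true) (sym (trans (sym (eq-sound q)) (C.inside x Zx)))
                       (subst (λ y → eq y C.z ≡ true) (sym C.z-fixed) (eq-refl C.z))
      ... | inj₂ Zx = subst (λ y → eq y x ≡ true) (C.outside x Zx) q
      lost : Σ[ x ∈ Fin n ] fixed x ≡ true × State.fixed s' x ≡ false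
      lost with u ≟ C.z
      ... | yes u≡z = v , subst (λ y → eq y v ≡ true) (sym fv) (eq-refl v) ,
            eq-false λ e → u≢v (trans u≡z (trans (sym (C.inside v Zv)) e))
      ... | no u≢z = u , subst (λ y → eq y u ≡ true) (sym fu) (eq-refl u) ,
            eq-false λ e → u≢z (sym (trans (sym (C.inside u Zu)) e))
      recurse : ∀ N → count fixed ≤ N → Σ[ s' ∈ State ] (∀ Z → ¬ Mergeable s' Z)
      recurse zero h = ⊥-elim (ℕₚ.n≮0 (ℕₚ.≤-trans (count-strict fixed⊆ (proj₁ lost) (proj₁ (proj₂ lost)) (proj₂ (proj₂ lost))) h))
      recurse (suc N) h = saturate N s'
        (ℕₚ.≤-pred (ℕₚ.≤-trans (count-strict fixed⊆ (proj₁ lost) (proj₁ (proj₂ lost)) (proj₂ (proj₂ lost))) h))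

    module Final (s : State) (stuck : ∀ Z → ¬ Mergeable s Z) where
      open State s
      open Enumeration (enumerate fixed) renaming (size to m; elem to f; inj to f-inj; sound to f-sound; index to f-index; elem-index to f-index-eq)

      H : Graph m
      H = induce G f

      ρ-fixed : ∀ v → fixed (ρ v) ≡ true
      ρ-fixed v = subst (λ y → eq y (ρ v) ≡ true) (sym (ρρ v)) (eq-refl (ρ v))

      ι : Fin n → Fin m
      ι v = f-index (ρ v) (ρ-fixed v)

      fι : ∀ v → f (ι v) ≡ ρ v
      fι v = f-index-eq (ρ v) (ρ-fixed v)

      ρf : ∀ i → ρ (f i) ≡ f i
      ρf i = eq-sound (f-sound i)

      ιf : ∀ i → ι (f i) ≡ i
      ιf i = f-inj (trans (fι (f i)) (ρf i))

      ι-cong : ∀ {v w} → ρ v ≡ ρ w → ι v ≡ ι w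
      ι-cong {v} {w} e = f-inj (trans (fι v) (trans e (sym (fι w))))

      ιρ : ∀ v → ι (ρ v) ≡ ι v
      ιρ v = ι-cong (ρρ v)

      adj-ι : ∀ v w → ι v ≢ ι w → adj G v w ≡ bd v ∧ (bd w ∧ adj H (ι v) (ι w))
      adj-ι v w h = trans (form v w (λ e → h (ι-cong e)))
        (cong₂ (λ x y → bd v ∧ (bd w ∧ adj G x y)) (sym (fι v)) (sym (fι w)))

      lift : Subset m → Subset n
      lift S v = S (ι v)

      separated : ∀ (S : Subset m) {i j} → S i ≡ true → S j ≡ false → i ≢ j
      separated S p q refl = true≢false p q

      lift-limb : ∀ {S} → Limb H S → Limb G (lift S)
      lift-limb {S} L = mkLimb λ u u' w w' p p' q q' e e' →
        let (bu , _ , uw) = edge p q e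
            (_ , bw' , u'w') = edge p' q' e'
        in trans (adj-ι u w' (separated S p q')) (∧-intro bu (∧-intro bw' (rectangle L (ι u) (ι u') (ι w) (ι w') p p' q q' uw u'w')))
        where
        edge : ∀ {v w} → S (ι v) ≡ true → S (ι w) ≡ false → adj G v w ≡ true →
          bd v ≡ true × bd w ≡ true × adj H (ι v) (ι w) ≡ true
        edge {v} {w} p q e with ∧-elim {bd v} (trans (sym (adj-ι v w (separated S p q))) e)
        ... | x , y with ∧-elim {bd w} y
        ...   | y , z = x , y , z

      lift-CR : ∀ {S j} → CR H S j → CR G (lift S) j
      lift-CR {S} (mkCR xs len sums) = mkCR (map pull xs) (subst (_≤ _) (sym (Lₚ.length-map pull xs)) len) λ u w p q →
        trans (adj-ι u w (separated S p q)) (trans (cong (λ c → bd u ∧ (bd w ∧ c)) (sums (ι u) (ι w) p q)) (sym (eval-pull xs u w)))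
        where
        pull : Term m → Term n
        pull (α , β) = (λ v → bd v ∧ α (ι v)) , (λ w → bd w ∧ β (ι w))
        eval-pull : ∀ xs u w → eval (map pull xs) u w ≡ bd u ∧ (bd w ∧ eval xs (ι u) (ι w))
        eval-pull [] u w = ⇔→≡ (tautology 2 (λ a b → false ⇔ (a ∧ (b ∧ false))) refl (bd u) (bd w))
        eval-pull ((α , β) ∷ xs) u w rewrite eval-pull xs u w =
          ⇔→≡ (tautology 5 (λ a b x y e → (((a ∧ x) ∧ (b ∧ y)) xor (a ∧ (b ∧ e))) ⇔ (a ∧ (b ∧ ((x ∧ y) xor e)))) refl
            (bd u) (bd w) (α (ι u)) (β (ι w)) (eval xs (ι u) (ι w)))

      H-connected : Connected H
      H-connected = Conn⇒Connected (mkConn λ S closed i j _ _ Si →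
        trans (cong S (sym (ιf j))) (spread conn (lift S) (λ u v _ _ p q → trans (adj-ι u v (separated S p q))
          (trans (cong (λ c → bd u ∧ (bd v ∧ c)) (closed (ι u) (ι v) refl refl p q))
            (⇔→≡ (tautology 2 (λ a b → (a ∧ (b ∧ false)) ⇔ false) refl (bd u) (bd v)))))
          (f i) (f j) refl refl (trans (cong S (ιf i)) Si)))

      inD : ∀ S → S (ι a) ≡ false → S (ι b) ≡ false → lift S ⊆ D
      inD S p q v r = ∧-intro (¬false→true λ e → true≢false r (trans (cong S (ι-cong (trans (offB v e) (sym (rep-b))))) q))
          (not-false (¬true→false λ e → true≢false r (trans (cong S (ι-cong (trans (onA v e) (sym (rep-a))))) p)))
        where
        rep-a : ρ a ≡ a
        rep-a = onA a Aa
        rep-b : ρ b ≡ b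
        rep-b = offB b Bb

      TwoIn : Subset m → Set
      TwoIn S = Σ[ i ∈ Fin m ] Σ[ j ∈ Fin m ] S i ≡ true × S j ≡ true × i ≢ j

      -- A split of the quotient pulls back to a limb of G. If `a` and `b` are on the same side, the
      -- other side could still have been merged. If they are separated, the side of `a` is a limb
      -- strictly between A and B: each side has two representatives, and A or the complement of B
      -- accounts for only one of them.
      no-split : ∀ S → Limb H S → TwoIn S → TwoIn (complement S) → ⊥
      no-split S L t t' = cases (split-Bool (S (ι a))) (split-Bool (S (ι b))) L t t'
        where
        merge : ∀ S → S (ι a) ≡ false → S (ι b) ≡ false → Limb H S → TwoIn S → ⊥
        merge S p q L (i , j , Si , Sj , i≢j) = stuck (lift S)
          ((λ v → cong S (sym (ιρ v))) , lift-limb L , inD S p q , f i , f j , trans (cong S (ιf i)) Si , trans (cong S (ιf j)) Sj ,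
           (λ e → i≢j (f-inj e)) , ρf i , ρf j)
        between : ∀ S → S (ι a) ≡ true → S (ι b) ≡ false → Limb H S → TwoIn S → TwoIn (complement S) → ⊥
        between S p q L (i , j , Si , Sj , i≢j) (i' , j' , Si' , Sj' , i'≢j') =
          gap (lift S) (lift-limb L) (λ v r → trans (cong S (ι-cong (trans (onA v r) (sym (onA a Aa))))) p)
            (λ v r → ¬false→true λ e → true≢false r (trans (cong S (ι-cong (trans (offB v e) (sym (offB b Bb))))) q))
            above below
          where
          above : Nonempty (lift S ∖ A)
          above with split-Bool (A (f i)) | split-Bool (A (f j))
          ... | inj₂ e | _ = f i , ∧-intro (trans (cong S (ιf i)) Si) (not-false e)
          ... | _ | inj₂ e = f j , ∧-intro (trans (cong S (ιf j)) Sj) (not-false e)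
          ... | inj₁ e | inj₁ e' = ⊥-elim (i≢j (f-inj (trans (sym (ρf i)) (trans (trans (onA _ e) (sym (onA _ e'))) (ρf j)))))
          below : Nonempty (B ∖ lift S)
          below with split-Bool (B (f i')) | split-Bool (B (f j'))
          ... | inj₁ e | _ = f i' , ∧-intro e (trans (cong (not ∘ S) (ιf i')) Si')
          ... | _ | inj₁ e = f j' , ∧-intro e (trans (cong (not ∘ S) (ιf j')) Sj')
          ... | inj₂ e | inj₂ e' = ⊥-elim (i'≢j' (f-inj (trans (sym (ρf i')) (trans (trans (offB _ e) (sym (offB _ e'))) (ρf j')))))
        double : TwoIn S → TwoIn (complement (complement S))
        double (i , j , p , q , r) = i , j , trans (𝔹ₚ.not-involutive _) p , trans (𝔹ₚ.not-involutive _) q , r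
        cases : S (ι a) ≡ true ⊎ S (ι a) ≡ false → S (ι b) ≡ true ⊎ S (ι b) ≡ false → Limb H S → TwoIn S → TwoIn (complement S) → ⊥
        cases (inj₂ p) (inj₂ q) L t t' = merge S p q L t
        cases (inj₁ p) (inj₁ q) L t t' = merge (complement S) (cong not p) (cong not q) (Limb-∁ L) t'
        cases (inj₁ p) (inj₂ q) L t t' = between S p q L t t'
        cases (inj₂ p) (inj₁ q) L t t' = between (complement S) (cong not p) (cong not q) (Limb-∁ L) t' (double t)

      H-prime : Prime H
      H-prime = H-connected , λ S (two , two' , cr , _) →
        no-split S (CR⇒Limb (CutRankAtMost⇒CR H S cr)) (count-two two) (count-two two')

      layout : LrwAtMost H p
      layout = primes f f-inj H-prime

      π = proj₁ layout

      -- The layout of `H` may place `a` and `b` anywhere. Including A from the start and cutting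
      -- down to B repairs this; each correction costs one unit of rank, which makes p + 2.
      Y : ℕ → Subset n
      Y i = A ∪ (B ∩ lift (prefix π i))

      Y-CR : ∀ i → CR G (Y i) (suc (suc p))
      Y-CR i = CR-∪ (Limb⇒CR (proj₁ LA)) (CR-∩ (Limb⇒CR (proj₁ LB)) (lift-CR (layout-CR layout i)))

      added : Fin m → Subset n
      added x v = D v ∧ eq (ι v) x

      added-Lin : ∀ x → Lin {G = G} k (added x)
      added-Lin x with split-Bool (D (f x))
      ... | inj₂ e = lin-∅ λ v → ¬true→false λ q → let (r , s) = ∧-elim {D v} q in
              true≢false (subst (λ y → D y ≡ true) (trans (sym (fι v)) (cong f (eq-sound s))) (onD v r)) e
      ... | inj₁ e = small (added x) (L , (f x , ∧-intro e (subst (λ y → eq y x ≡ true) (sym (ιf x)) (eq-refl x))) ,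
              (b , cong (λ c → (c ∧ not (A b)) ∧ eq (ι b) x) Bb)) (λ v q → proj₁ (∧-elim {D v} q))
        where
        fibre : added x ≗ˢ lift ⁅ x ⁆
        fibre v = bool-ext (λ q → proj₂ (∧-elim {D v} q))
          λ q → ∧-intro (inD ⁅ x ⁆ (eq-false λ h → not-a (trans (sym (fι a)) (cong f h)))
                                   (eq-false λ h → not-b (trans (sym (fι b)) (cong f h))) v q) q
          where
          not-a : ρ a ≢ f x
          not-a h = true≢false (subst (λ y → A y ≡ true) (trans (sym (onA a Aa)) h) Aa) (not-true (proj₂ (∧-elim {B (f x)} e)))
          not-b : ρ b ≢ f x
          not-b h = true≢false (proj₁ (∧-elim {B (f x)} e)) (subst (λ y → B y ≡ false) (trans (sym (offB b Bb)) h) Bb)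
        L : Limb G (added x)
        L = Limb-≗ (λ v → sym (fibre v)) (lift-limb (Limb-singleton H x))

      Y-suc : ∀ i (h : i < m) → (Y i ∪ added (π ⟨$⟩ʳ fromℕ< h)) ≗ˢ Y (suc i)
      Y-suc i h v = trans
          (⇔→≡ (tautology 4 (λ a b c d → ((a ∨ (b ∧ c)) ∨ ((b ∧ not a) ∧ d)) ⇔ (a ∨ (b ∧ (c ∨ d)))) refl
            (A v) (B v) (prefix π i (ι v)) (eq (ι v) (π ⟨$⟩ʳ fromℕ< h))))
          (cong (λ c → A v ∨ (B v ∧ c)) (prefix-suc π i h (ι v)))

      insert : ∀ i → i ≤ m → Lin {G = G} K (Y i)
      insert zero h = Lin-≗ (λ v → trans (⇔→≡ (tautology 2 (λ a b → a ⇔ (a ∨ (b ∧ false))) refl (A v) (B v)))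
        (cong (λ c → A v ∨ (B v ∧ c)) (sym (prefix-zero π (ι v))))) LinA
      insert (suc i) h = Lin-≗ (Y-suc i h) (Lin-∪ (Y-CR i) K≥ (insert i (ℕₚ.<⇒≤ h)) (added-Lin _))

      filled : Lin {G = G} K B
      filled = Lin-≗ (λ v → trans (cong (λ c → A v ∨ (B v ∧ c)) (<ᵇ-true (Fₚ.toℕ<n (π ⟨$⟩ˡ ι v)))) (last v)) (insert m ℕₚ.≤-refl)
        where
        last : ∀ v → A v ∨ (B v ∧ true) ≡ B v
        last v with split-Bool (A v)
        ... | inj₁ e rewrite e = sym (A⊆B v e)
        ... | inj₂ e rewrite e = 𝔹ₚ.∧-identityʳ (B v)

    fill : Lin {G = G} K B
    fill = Final.filled (proj₁ r) (proj₂ r)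
      where r = saturate (count (State.fixed initial)) initial ℕₚ.≤-refl

module _ {n} {G : Graph n} (conn : Conn G full) {p k : ℕ} (primes : PrimesBounded G p) where

  -- An intermediate limb C splits the task into two with fewer vertices between the ends, at no
  -- cost in width because the layout of C becomes the start of the second task. Without such a C,
  -- the limbs are consecutive and `fill` applies.
  climb : ∀ {K} → suc (suc p) + k ≤ K → ∀ N A B → count (B ∖ A) ≤ N → ProperLimb G A → ProperLimb G B → A ⊆ B →
    (∀ Z → ProperLimb G Z → Z ⊆ (B ∖ A) → Lin {G = G} k Z) → Lin {G = G} K A → Lin {G = G} K B
  climb {K} K≥ N A B h LA LB A⊆B small LinA
    with search (λ C → Limb G C × A ⊆ C × C ⊆ B × Nonempty (C ∖ A) × Nonempty (B ∖ C))
      (λ C → limb? G C ×-dec Subset? A C ×-dec Subset? C B ×-dec nonempty? (C ∖ A) ×-dec nonempty? (B ∖ C))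
      (λ e (L , s , t , (x , p) , (y , q)) → Limb-≗ e L , (λ v r → trans (sym (e v)) (s v r)) , (λ v r → t v (trans (e v) r)) ,
        (x , trans (cong (_∧ not (A x)) (sym (e x))) p) , (y , trans (cong (λ c → B y ∧ not c) (sym (e y))) q))
  ... | inj₂ none = Fill.Gap.fill conn primes LA LB A⊆B (λ C L s t x y → none C (L , s , t , x , y)) small K≥ LinA
  climb {K} K≥ N A B h LA LB A⊆B small LinA | inj₁ (C , LC , A⊆C , C⊆B , (x , p) , (y , q)) with ∧-elim {C x} p | ∧-elim {B y} q
  climb {K} K≥ zero A B h LA LB A⊆B small LinA | inj₁ (C , LC , A⊆C , C⊆B , (x , p) , (y , q)) | Cx , Ax | By , Cy =
    ⊥-elim (ℕₚ.n≮0 (ℕₚ.≤-trans (count-strict {S = λ _ → false} {B ∖ A} (λ _ ()) x (∧-intro (C⊆B x Cx) Ax) refl) h))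
  climb {K} K≥ (suc N) A B h LA LB A⊆B small LinA | inj₁ (C , LC , A⊆C , C⊆B , (x , p) , (y , q)) | Cx , Ax | By , Cy =
    climb K≥ N C B (ℕₚ.≤-pred (ℕₚ.≤-trans (count-strict sub₂ x (∧-intro (C⊆B x Cx) Ax) (trans (cong (λ c → B x ∧ not c) Cx) (𝔹ₚ.∧-zeroʳ (B x)))) h))
      PC LB C⊆B (λ Z L s → small Z L λ v r → sub₂ v (s v r))
      (climb K≥ N A C (ℕₚ.≤-pred (ℕₚ.≤-trans (count-strict sub₁ y (∧-intro By (not-false Ay)) (cong (_∧ not (A y)) (not-true Cy))) h))
        LA PC A⊆C (λ Z L s → small Z L λ v r → sub₁ v (s v r)) LinA)
    where
    Ay : A y ≡ false
    Ay = ¬true→false λ e → true≢false (A⊆C y e) (not-true Cy)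
    PC : ProperLimb G C
    PC = LC , (x , Cx) , (y , not-true Cy)
    sub₁ : (C ∖ A) ⊆ (B ∖ A)
    sub₁ v r with ∧-elim {C v} r
    ... | a , b = ∧-intro (C⊆B v a) b
    sub₂ : (B ∖ C) ⊆ (B ∖ A)
    sub₂ v r with ∧-elim {B v} r
    ... | a , b = ∧-intro a (not-false (¬true→false λ e → true≢false (A⊆C v e) (not-true b)))

-- A layout or a fork

record Fork {n} (G : Graph n) (Good : Subset n → Set) (X : Subset n) : Set where
  field
    V₁ V₂    : Subset n
    V₁⊆X     : V₁ ⊆ X
    V₂⊆X     : V₂ ⊆ X
    disjoint : Disjoint V₁ V₂
    limb₁    : ProperLimb G V₁
    limb₂    : ProperLimb G V₂
    good₁    : Good V₁
    good₂    : Good V₂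
    nonlimb  : ¬ Limb G (V₁ ∪ V₂)

module _ {n} {G : Graph n} (conn : Conn G full) {p k : ℕ} (primes : PrimesBounded G p)
  {Good : Subset n → Set} (dichotomy : ∀ V → ProperLimb G V → Lin {G = G} k V ⊎ Good V) where

  private
    Verdict : Subset n → Set
    Verdict V = (ProperLimb G V × Good V) ⊎ (ProperLimb G V → Lin {G = G} k V)

    verdict : ∀ V → Verdict V
    verdict V with properLimb? G V
    ... | no ¬L = inj₂ λ L → ⊥-elim (¬L L)
    ... | yes L with dichotomy V L
    ...   | inj₁ lin  = inj₂ λ _ → lin
    ...   | inj₂ good = inj₁ (L , good)

    is-good : ∀ {V} → Verdict V → Bool
    is-good (inj₁ _) = true
    is-good (inj₂ _) = false

    -- Both alternatives of `dichotomy` may hold, so richness is taken to be the answer that it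
    -- happens to give. Asking at the canonical form makes this answer independent of how the set is
    -- presented, as `search` requires.
    big : Subset n → Bool
    big V = is-good (verdict (canonical V))

    big-cong : ∀ {V W} → V ≗ˢ W → big V ≡ big W
    big-cong e = cong (λ S → is-good (verdict S)) (canonical-cong e)

    big-good : ∀ V → big V ≡ true → ProperLimb G (canonical V) × Good (canonical V)
    big-good V e with verdict (canonical V)
    ... | inj₁ r = r

    big-limb : ∀ V → big V ≡ true → ProperLimb G V
    big-limb V e = ProperLimb-≗ (canonical-≗ V) (proj₁ (big-good V e))

    not-big : ∀ V → big V ≡ false → ProperLimb G V → Lin {G = G} k V
    not-big V e L with verdict (canonical V)
    ... | inj₂ f = Lin-≗ (canonical-≗ V) (f (ProperLimb-≗ (λ v → sym (canonical-≗ V v)) L))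

    find-big : ∀ S → (Σ[ V ∈ Subset n ] V ⊆ S × big V ≡ true) ⊎ (∀ V → V ⊆ S → big V ≡ false)
    find-big S with search (λ V → V ⊆ S × big V ≡ true) (λ V → Subset? V S ×-dec (big V ≟𝔹 true))
                      (λ e (s , b) → (λ v r → s v (trans (e v) r)) , trans (sym (big-cong e)) b)
    ... | inj₁ r = inj₁ r
    ... | inj₂ none = inj₂ λ V s → ¬true→false λ b → none V (s , b)

    Minimal : Subset n → Set
    Minimal V = big V ≡ true × (∀ W → W ⊆ V → Nonempty (V ∖ W) → big W ≡ false)

    minimize : ∀ N V → count V ≤ N → big V ≡ true → Σ[ W ∈ Subset n ] W ⊆ V × Minimal W
    minimize N V h b with search (λ W → W ⊆ V × Nonempty (V ∖ W) × big W ≡ true)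
                            (λ W → Subset? W V ×-dec nonempty? (V ∖ W) ×-dec (big W ≟𝔹 true))
                            (λ e (s , (x , p) , c) → (λ v r → s v (trans (e v) r)) ,
                              (x , trans (cong (λ c → V x ∧ not c) (sym (e x))) p) , trans (sym (big-cong e)) c)
    ... | inj₂ none = V , (λ _ r → r) , b , λ W s ne → ¬true→false λ c → none W (s , ne , c)
    minimize N V h b | inj₁ (W , s , (x , p) , c) with count-strict s x (proj₁ (∧-elim {V x} p)) (not-true (proj₂ (∧-elim {V x} p)))
    minimize zero V h b | inj₁ _ | lt = ⊥-elim (ℕₚ.n≮0 (ℕₚ.≤-trans lt h))
    minimize (suc N) V h b | inj₁ (W , s , _ , c) | lt with minimize N W (ℕₚ.≤-pred (ℕₚ.≤-trans lt h)) c
    ... | W' , s' , m = W' , (λ v r → s v (s' v r)) , m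

    -- The chain starts at a single vertex x of V. Limbs inside the rest of V miss x, hence are
    -- proper subsets of V and not big by minimality.
    minimal-Lin : ∀ V → Minimal V → Lin {G = G} (suc (suc p) + k) V
    minimal-Lin V (b , m) with big-limb V b
    ... | LV@(L , (x , Vx) , (y , Vy)) = climb conn primes ℕₚ.≤-refl (count (V ∖ ⁅ x ⁆)) ⁅ x ⁆ V ℕₚ.≤-refl
        (Limb-singleton G x , (x , eq-refl x) , (y , eq-false λ e → true≢false (subst (λ z → V z ≡ true) (sym e) Vx) Vy)) LV
        (λ v e → subst (λ z → V z ≡ true) (sym (eq-sound e)) Vx)
        (λ Z LZ Z⊆ → not-big Z (m Z (λ v r → proj₁ (∧-elim {V v} (Z⊆ v r)))
           (x , ∧-intro Vx (not-false (¬true→false λ r → true≢false (eq-refl x) (not-true (proj₂ (∧-elim {V x} (Z⊆ x r)))))))) LZ)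
        (lin-+ {S' = λ _ → false} x (eq-refl x) refl (λ w h → eq-false h)
          (CR-mono (s≤s z≤n) (Limb⇒CR (Limb-singleton G x))) (lin-∅ λ _ → refl))

    K' : ℕ
    K' = suc (suc (suc p) + k)

    -- Y is a limb around the fixed `V₁` that swallows minimal big limbs V of the rest of X. If `V₁`
    -- and V form a limb together, it meets Y in `V₁`, so `Limb-∪` makes Y ∪ V a limb; the layout of
    -- V is appended, and the cut-rank one of Y is the last unit in p + 3. If they do not, they are
    -- a fork. Once no big limb is left outside Y, `climb` leads from Y to X.
    collect : ∀ X → ProperLimb G X → ∀ V₁ → Minimal V₁ → V₁ ⊆ X → ∀ N Y → count (X ∖ Y) ≤ N → Limb G Y → V₁ ⊆ Y → Y ⊆ X →
      Lin {G = G} K' Y → Lin {G = G} K' X ⊎ Fork G Good X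

    extend : ∀ X → ProperLimb G X → ∀ V₁ → Minimal V₁ → V₁ ⊆ X → ∀ N Y → count (X ∖ Y) ≤ N → Limb G Y → V₁ ⊆ Y → Y ⊆ X →
      Lin {G = G} K' Y → ∀ V → V ⊆ (X ∖ Y) → Minimal V → ProperLimb G (canonical V₁) × Good (canonical V₁) →
      ProperLimb G (canonical V) × Good (canonical V) → Dec (Limb G (V₁ ∪ V)) → Lin {G = G} K' X ⊎ Fork G Good X

    collect X LX V₁ m₁ V₁⊆X N Y h LY V₁⊆Y Y⊆X lin with find-big (X ∖ Y)
    ... | inj₂ none = inj₁ (climb conn primes (ℕₚ.n≤1+n _) (count (X ∖ Y)) Y X ℕₚ.≤-refl
            (LY , (_ , V₁⊆Y _ (proj₂ ne)) , (proj₁ out , ¬true→false λ r → true≢false (Y⊆X _ r) (proj₂ out))) LX Y⊆X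
            (λ Z LZ s → not-big Z (none Z s) LZ) lin)
      where
      ne  = proj₁ (proj₂ (big-limb V₁ (proj₁ m₁)))
      out = proj₂ (proj₂ LX)
    ... | inj₁ (W , W⊆ , bW) with minimize (count W) W ℕₚ.≤-refl bW
    ...   | V , V⊆W , mV = extend X LX V₁ m₁ V₁⊆X N Y h LY V₁⊆Y Y⊆X lin V (λ v r → W⊆ v (V⊆W v r)) mV
            (big-good V₁ (proj₁ m₁)) (big-good V (proj₁ mV)) (limb? G (V₁ ∪ V))

    extend X LX V₁ m₁ V₁⊆X N Y h LY V₁⊆Y Y⊆X lin V V⊆ mV (L₁ , g₁) (L₂ , g₂) (no ¬L) = inj₂ record
        { V₁ = canonical V₁ ; V₂ = canonical V
        ; V₁⊆X = λ v r → V₁⊆X v (c₁ r)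
        ; V₂⊆X = λ v r → proj₁ (∧-elim {X v} (V⊆ v (c₂ r)))
        ; disjoint = λ v r → trans (canonical-≗ V v) (¬true→false λ q → true≢false (V₁⊆Y v (c₁ r)) (not-true (proj₂ (∧-elim {X v} (V⊆ v q)))))
        ; limb₁ = L₁ ; limb₂ = L₂ ; good₁ = g₁ ; good₂ = g₂
        ; nonlimb = λ L → ¬L (Limb-≗ (λ v → cong₂ _∨_ (canonical-≗ V₁ v) (canonical-≗ V v)) L) }
      where
      c₁ : ∀ {v} → canonical V₁ v ≡ true → V₁ v ≡ true
      c₁ {v} r = trans (sym (canonical-≗ V₁ v)) r
      c₂ : ∀ {v} → canonical V v ≡ true → V v ≡ true
      c₂ {v} r = trans (sym (canonical-≗ V v)) r
    extend X LX V₁ m₁ V₁⊆X N Y h LY V₁⊆Y Y⊆X lin V V⊆ mV ((_ , (v₁ , c₁) , _) , g₁) ((_ , (v₂ , c₂) , _) , g₂) (yes L) = recurse N h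
      where
      sub : (X ∖ (Y ∪ V)) ⊆ (X ∖ Y)
      sub v r with ∧-elim {X v} r
      ... | a , c = ∧-intro a (not-false (proj₁ (∨-false (not-true c))))
      Vv₁ : V₁ v₁ ≡ true
      Vv₁ = trans (sym (canonical-≗ V₁ v₁)) c₁
      Vv₂ : V v₂ ≡ true
      Vv₂ = trans (sym (canonical-≗ V v₂)) c₂
      lt : count (X ∖ (Y ∪ V)) < count (X ∖ Y)
      lt = count-strict sub v₂ (V⊆ v₂ Vv₂) (trans (cong (λ c → X v₂ ∧ not c) (∨-introʳ {Y v₂} Vv₂)) (𝔹ₚ.∧-zeroʳ (X v₂)))
      absorb : (Y ∪ V₁ ∪ V) ≗ˢ (Y ∪ V)
      absorb v with split-Bool (V₁ v)
      ... | inj₂ e rewrite e = refl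
      ... | inj₁ e rewrite V₁⊆Y v e = refl
      recurse : ∀ N → count (X ∖ Y) ≤ N → Lin {G = G} K' X ⊎ Fork G Good X
      recurse zero h = ⊥-elim (ℕₚ.n≮0 (ℕₚ.≤-trans lt h))
      recurse (suc N) h = collect X LX V₁ m₁ V₁⊆X N (Y ∪ V) (ℕₚ.≤-pred (ℕₚ.≤-trans lt h))
        (Limb-≗ absorb (Limb-∪ conn LY L {v₁} (V₁⊆Y v₁ Vv₁) (∨-introˡ Vv₁)))
        (λ v r → ∨-introˡ (V₁⊆Y v r)) (λ v r → [ Y⊆X v , (λ q → proj₁ (∧-elim {X v} (V⊆ v q))) ]′ (∨-elim {Y v} r))
        (Lin-∪ (Limb⇒CR LY) ℕₚ.≤-refl lin (minimal-Lin V mV))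

  fork : ∀ X → ProperLimb G X → Lin {G = G} (suc (suc (suc p)) + k) X ⊎ Fork G Good X
  fork X LX with find-big X
  ... | inj₂ none = inj₁ (Lin-mono (ℕₚ.m≤n+m k (suc (suc (suc p)))) (not-big X (none X (λ _ r → r)) LX))
  ... | inj₁ (W , W⊆X , bW) with minimize (count W) W ℕₚ.≤-refl bW
  ...   | V , V⊆W , m = collect X LX V m V⊆X (count (X ∖ V)) V ℕₚ.≤-refl (proj₁ (big-limb V (proj₁ m)))
            (λ _ r → r) V⊆X (Lin-mono (ℕₚ.n≤1+n _) (minimal-Lin V m))
    where
    V⊆X : V ⊆ X
    V⊆X v r = W⊆X v (V⊆W v r)

-- Local complementation

data LC {n} (V : Subset n) : Graph n → Graph n → Set where
  done : ∀ {G} → LC V G G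
  at   : ∀ {G H} x → V x ≡ true → LC V (localComp G x) H → LC V G H

LC-trans : ∀ {n} {V : Subset n} {G H K} → LC V G H → LC V H K → LC V G K
LC-trans done         t = t
LC-trans (at x p s) t = at x p (LC-trans s t)

LC-mono : ∀ {n} {V X : Subset n} {G H} → V ⊆ X → LC V G H → LC X G H
LC-mono s done = done
LC-mono s (at x p r) = at x (s x p) (LC-mono s r)

LC-invariant : ∀ {n} {V : Subset n} (P : Graph n → Set) → (∀ {G} x → V x ≡ true → P G → P (localComp G x)) →
  ∀ {G H} → LC V G H → P G → P H
LC-invariant P h done       p = p
LC-invariant P h (at x q r) p = LC-invariant P h r (h x q p)

module _ {n} (G : Graph n) (x : Fin n) where

  lc-≢ : ∀ {u v} → u ≢ v → adj (localComp G x) u v ≡ adj G u v xor (adj G x u ∧ adj G x v)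
  lc-≢ {u} {v} h rewrite neq-true h = cong (λ c → adj G u v xor (adj G x u ∧ c)) (𝔹ₚ.∧-identityʳ _)

  lc-offˡ : ∀ {u v} → adj G x u ≡ false → adj (localComp G x) u v ≡ adj G u v
  lc-offˡ {u} {v} e rewrite e = 𝔹ₚ.xor-identityʳ _

  lc-offʳ : ∀ {u v} → adj G x v ≡ false → adj (localComp G x) u v ≡ adj G u v
  lc-offʳ {u} {v} e rewrite e | 𝔹ₚ.∧-zeroʳ (adj G x u) = 𝔹ₚ.xor-identityʳ _

  lc-self : ∀ {v} → adj (localComp G x) x v ≡ adj G x v
  lc-self = lc-offˡ (adj-irrefl G x)

  lc-selfʳ : ∀ {u} → adj (localComp G x) u x ≡ adj G u x
  lc-selfʳ = lc-offʳ (adj-irrefl G x)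

Factored : ∀ {n} → Graph n → Subset n → Set
Factored {n} G Z = Σ[ a ∈ Subset n ] Σ[ m ∈ Subset n ] (∀ u w → Z u ≡ true → Z w ≡ false → adj G u w ≡ a u ∧ m w)

Limb⇒Factored : ∀ {n} {G : Graph n} {Z} → Limb G Z → Factored G Z
Limb⇒Factored L with Limb⇒CR L
... | mkCR [] _ s = (λ _ → false) , (λ _ → false) , s
... | mkCR ((a , m) ∷ []) _ s = a , m , λ u w p q → trans (s u w p q) (𝔹ₚ.xor-identityʳ _)
... | mkCR (_ ∷ _ ∷ _) (s≤s ()) _

Factored⇒Limb : ∀ {n} {G : Graph n} {Z} → Factored G Z → Limb G Z
Factored⇒Limb (a , m , f) = mkLimb λ u u' w w' p p' q q' e e' →
  trans (f u w' p q') (∧-intro (proj₁ (∧-elim (trans (sym (f u w p q)) e))) (proj₂ (∧-elim {a u'} (trans (sym (f u' w' p' q')) e'))))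

Limb-∁⁻ : ∀ {n} {G : Graph n} {Z} → Limb G (complement Z) → Limb G Z
Limb-∁⁻ {Z = Z} L = Limb-≗ (λ v → 𝔹ₚ.not-involutive (Z v)) (Limb-∁ L)

∈≢∉ : ∀ {n} (Z : Subset n) {u v} → Z u ≡ true → Z v ≡ false → u ≢ v
∈≢∉ Z p q refl = true≢false p q

private
  Limb-lc-inside : ∀ {n} {G : Graph n} {Z} x → Z x ≡ true → Limb G Z → Limb (localComp G x) Z
  Limb-lc-inside {G = G} {Z} x p L with Limb⇒Factored L
  ... | a , m , f = Factored⇒Limb ((λ u → a u xor (adj G x u ∧ a x)) , m , λ u w pu qw →
    trans (lc-≢ G x (∈≢∉ Z pu qw)) (trans (cong₂ (λ b c → b xor (adj G x u ∧ c)) (f u w pu qw) (f x w p qw))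
      (⇔→≡ (tautology 4 (λ a b c m → ((a ∧ m) xor (b ∧ (c ∧ m))) ⇔ ((a xor (b ∧ c)) ∧ m)) refl (a u) (adj G x u) (a x) (m w)))))

-- For x in Z the complementation adds multiples of row x to other rows of the cut matrix, which
-- cannot raise its rank. For x outside, transposing the matrix exchanges the roles of the two
-- sides.
Limb-lc : ∀ {n} {G : Graph n} {Z} x → Limb G Z → Limb (localComp G x) Z
Limb-lc {Z = Z} x L with split-Bool (Z x)
... | inj₁ p = Limb-lc-inside x p L
... | inj₂ p = Limb-∁⁻ (Limb-lc-inside x (not-false p) (Limb-∁ L))

Limb-adj : ∀ {n} {G H : Graph n} {Z} → (∀ u v → adj G u v ≡ adj H u v) → Limb G Z → Limb H Z
Limb-adj e L = mkLimb λ u u' w w' p p' q q' r r' →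
  trans (sym (e u w')) (rectangle L u u' w w' p p' q q' (trans (e u w) r) (trans (e u' w') r'))

lc-involutive : ∀ {n} (G : Graph n) x u v → adj (localComp (localComp G x) x) u v ≡ adj G u v
lc-involutive G x u v rewrite lc-self G x {u} | lc-self G x {v} =
  ⇔→≡ (tautology 2 (λ a b → ((a xor b) xor b) ⇔ a) refl (adj G u v) (adj G x u ∧ (adj G x v ∧ neq u v)))

Limb-lc⁻ : ∀ {n} {G : Graph n} {Z} x → Limb (localComp G x) Z → Limb G Z
Limb-lc⁻ {G = G} x L = Limb-adj (lc-involutive G x) (Limb-lc x L)

Limb-LC : ∀ {n} {V : Subset n} {G H Z} → LC V G H → Limb G Z → Limb H Z
Limb-LC {Z = Z} = LC-invariant (λ G → Limb G Z) (λ x _ → Limb-lc x)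

¬Limb-LC : ∀ {n} {V : Subset n} {G H Z} → LC V G H → ¬ Limb G Z → ¬ Limb H Z
¬Limb-LC {Z = Z} = LC-invariant (λ G → ¬ Limb G Z) (λ x _ h L → h (Limb-lc⁻ x L))

-- The neighbourhood of x is the same in both graphs. If no edge crosses S afterwards, x has no
-- neighbour on the opposite side of S within U, so no crossing pair was toggled.
Conn-lc : ∀ {n} {G : Graph n} {U} x → U x ≡ true → Conn G U → Conn (localComp G x) U
Conn-lc {G = G} {U} x Ux conn = mkConn λ S closed → spread conn S λ u v Uu Uv Su Sv →
  case split-Bool (S x) of λ where
    (inj₁ Sx) → trans (sym (lc-offʳ G x (trans (sym (lc-self G x)) (closed x v Ux Uv Sx Sv)))) (closed u v Uu Uv Su Sv)
    (inj₂ Sx) → trans (sym (lc-offˡ G x (adj-sym-false G (trans (sym (lc-selfʳ G x)) (closed u x Uu Ux Su Sx))))) (closed u v Uu Uv Su Sv)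

Conn-LC : ∀ {n} {V U : Subset n} {G H} → V ⊆ U → LC V G H → Conn G U → Conn H U
Conn-LC {U = U} s = LC-invariant (λ G → Conn G U) (λ x p → Conn-lc x (s x p))

Conn-≗ : ∀ {n} {G : Graph n} {U U'} → U ≗ˢ U' → Conn G U → Conn G U'
Conn-≗ e conn = mkConn λ S closed u v p q → spread conn S
  (λ a b c d → closed a b (trans (sym (e a)) c) (trans (sym (e b)) d)) u v (trans (e u) p) (trans (e v) q)

-- If S separates G[U - v] and S' separates the other graph, then v has neighbours on both
-- sides of S and of S', while opposite quadrants of the two cuts cannot both contain neighbours of v.
Conn-eliminate : ∀ {n} {G : Graph n} {U} v → Conn G U → U v ≡ true →
  Conn G (U ∖ ⁅ v ⁆) ⊎ Conn (localComp G v) (U ∖ ⁅ v ⁆)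
Conn-eliminate {n} {G} {U} v conn Uv
  with search Separating
    (λ S → closed? S ×-dec any? λ x → any? λ y → (U⁻ x ≟𝔹 true) ×-dec (U⁻ y ≟𝔹 true) ×-dec (S x ≟𝔹 true) ×-dec (S y ≟𝔹 false))
    (λ e (c , x , y , Ux , Uy , Sx , Sy) →
      (λ a b p q r s → c a b p q (trans (e a) r) (trans (e b) s)) , x , y , Ux , Uy , trans (sym (e x)) Sx , trans (sym (e y)) Sy)
  where
  U⁻ = U ∖ ⁅ v ⁆
  Separating : Subset n → Set
  Separating S = Closed G U⁻ S × Σ[ x ∈ Fin n ] Σ[ y ∈ Fin n ] U⁻ x ≡ true × U⁻ y ≡ true × S x ≡ true × S y ≡ false
  closed? : ∀ S → Dec (Closed G U⁻ S)
  closed? S = all? λ a → all? λ b → (U⁻ a ≟𝔹 true) →-dec (U⁻ b ≟𝔹 true) →-dec (S a ≟𝔹 true) →-dec (S b ≟𝔹 false) →-dec (adj G a b ≟𝔹 false)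
... | inj₂ none = inj₁ (mkConn λ S c x y Ux Uy Sx → ¬false→true λ Sy → none S (c , x , y , Ux , Uy , Sx , Sy))
... | inj₁ (S , closed , s , t , Us , Ut , Ss , St) = inj₂ (mkConn λ S' closed' s' t' Us' Ut' S's' →
        ¬false→true λ S't' → quadrants S' closed' s' t' Us' Ut' S's' S't')
  where
  U⁻ : Subset n
  U⁻ = U ∖ ⁅ v ⁆
  U⁻⊆U : ∀ {x} → U⁻ x ≡ true → U x ≡ true
  U⁻⊆U {x} p = proj₁ (∧-elim {U x} p)
  ≢v : ∀ {x} → U⁻ x ≡ true → x ≢ v
  ≢v {x} p refl = true≢false (eq-refl v) (not-true (proj₂ (∧-elim {U x} p)))
  inU⁻ : ∀ {x} → U x ≡ true → x ≢ v → U⁻ x ≡ true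
  inU⁻ p h = ∧-intro p (not-false (eq-false h))
  touches : ∀ T → Closed G U⁻ T → ∀ {x y} → U⁻ x ≡ true → U⁻ y ≡ true → T x ≡ true → T y ≡ false →
    ¬ (∀ z → U⁻ z ≡ true → T z ≡ true → adj G v z ≡ false)
  touches T c {x} {y} Ux Uy Tx Ty h = true≢false (proj₁ (∧-elim {T y} (spread conn (T ∖ ⁅ v ⁆) closedT x y (U⁻⊆U Ux) (U⁻⊆U Uy)
      (∧-intro Tx (not-false (eq-false (≢v Ux))))))) Ty
    where
    closedT : Closed G U (T ∖ ⁅ v ⁆)
    closedT a b Ua Ub Ta Tb with ∧-elim {T a} Ta
    ... | Ta' , a≢ with a ≟ v | b ≟ v
    ...   | no a≢v | yes refl = adj-sym-false G (h a (inU⁻ Ua a≢v) Ta')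
    ...   | no a≢v | no b≢v = c a b (inU⁻ Ua a≢v) (inU⁻ Ub b≢v) Ta' (trans (sym (𝔹ₚ.∧-identityʳ (T b))) Tb)
  quadrants : ∀ S' → Closed (localComp G v) U⁻ S' → ∀ s' t' → U⁻ s' ≡ true → U⁻ t' ≡ true → S' s' ≡ true → S' t' ≡ false → ⊥
  quadrants S' closed' s' t' Us' Ut' S's' S't' =
    touches S closed Us Ut Ss St λ x Ux Sx → ¬true→false λ vx →
    touches (complement S) closedᶜ Ut Us (not-false St) (cong not Ss) λ y Uy Sy → ¬true→false λ vy →
    conflict x y Ux Uy Sx (not-true Sy) vx vy
    where
    closedᶜ : Closed G U⁻ (complement S)
    closedᶜ a b Ua Ub Sa Sb = adj-sym-false G (closed b a Ub Ua (¬false→true λ e → true≢false (cong not e) Sb) (not-true Sa))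
    -- After the complementation no edge crosses S', so in G the crossing pairs that are edges are
    -- precisely the toggled ones, the pairs of neighbours of v.
    product : ∀ {a b} → U⁻ a ≡ true → U⁻ b ≡ true → S' a ≡ true → S' b ≡ false → adj G a b ≡ adj G v a ∧ adj G v b
    product {a} {b} Ua Ub p q = ⇔→≡ (mp (tautology 2 (λ x y → (x xor y ⇔ false) ⇒ (x ⇔ y)) refl (adj G a b) (adj G v a ∧ adj G v b))
      (≡→⇔ (trans (sym (lc-≢ G v (∈≢∉ S' p q))) (closed' a b Ua Ub p q))))
    opposite : ∀ {a b} → U⁻ a ≡ true → U⁻ b ≡ true → S a ≡ true → S b ≡ false → S' a ≢ S' b → adj G v a ≡ true → adj G v b ≡ false
    opposite {a} {b} Ua Ub Sa Sb h va with split-Bool (S' a) | split-Bool (S' b)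
    ... | inj₁ p | inj₁ q = ⊥-elim (h (trans p (sym q)))
    ... | inj₂ p | inj₂ q = ⊥-elim (h (trans p (sym q)))
    ... | inj₁ p | inj₂ q = trans (cong (_∧ adj G v b) (sym va)) (trans (sym (product Ua Ub p q)) (closed a b Ua Ub Sa Sb))
    ... | inj₂ p | inj₁ q = trans (sym (𝔹ₚ.∧-identityʳ _)) (trans (cong (adj G v b ∧_) (sym va))
            (trans (sym (product Ub Ua q p)) (adj-sym-false G (closed a b Ua Ub Sa Sb))))
    conflict : ∀ x y → U⁻ x ≡ true → U⁻ y ≡ true → S x ≡ true → S y ≡ false → adj G v x ≡ true → adj G v y ≡ true → ⊥
    conflict x y Ux Uy Sx Sy vx vy with S' x 𝔹ₚ.≟ S' y
    ... | no h = true≢false vy (opposite Ux Uy Sx Sy h vx)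
    ... | yes same = side (split-Bool (S' x))
      where
      -- A neighbour of v on the other side of S' would lie in the quadrant opposite to x or to y.
      -- So v misses that side altogether, `product` makes S' closed in G too, and `touches` gives
      -- the contradiction.
      far : ∀ z → U⁻ z ≡ true → S' z ≢ S' x → adj G v z ≡ false
      far z Uz h with split-Bool (S z)
      ... | inj₁ Sz = ¬true→false λ vz → true≢false vy (opposite Uz Uy Sz Sy (λ e → h (trans e (sym same))) vz)
      ... | inj₂ Sz = opposite Ux Uz Sx Sz (λ e → h (sym e)) vx
      closed₁ : (∀ z → U⁻ z ≡ true → S' z ≡ true → adj G v z ≡ false) ⊎ (∀ z → U⁻ z ≡ true → S' z ≡ false → adj G v z ≡ false) → Closed G U⁻ S'
      closed₁ (inj₁ h) a b Ua Ub p q = trans (product Ua Ub p q) (cong (_∧ adj G v b) (h a Ua p))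
      closed₁ (inj₂ h) a b Ua Ub p q = trans (product Ua Ub p q) (trans (cong (adj G v a ∧_) (h b Ub q)) (𝔹ₚ.∧-zeroʳ _))
      side : S' x ≡ true ⊎ S' x ≡ false → ⊥
      side (inj₂ S'x) = touches S' (closed₁ (inj₁ h)) Us' Ut' S's' S't' h
        where h = λ z Uz p → far z Uz λ e → true≢false p (trans e S'x)
      side (inj₁ S'x) = touches (complement S') closed₂ Ut' Us' (not-false S't') (cong not S's') λ z Uz p → h z Uz (not-true p)
        where
        h : ∀ z → U⁻ z ≡ true → S' z ≡ false → adj G v z ≡ false
        h z Uz p = far z Uz λ e → true≢false (trans e S'x) p
        closed₂ : Closed G U⁻ (complement S')
        closed₂ a b Ua Ub p q = adj-sym-false G (closed₁ (inj₂ h) b a Ub Ua (¬false→true λ e → true≢false (cong not e) q) (not-true p))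

-- The vertices outside K are dropped one at a time, after a complementation at those whose
-- deletion would disconnect the graph.
eliminate : ∀ {n} (K : Subset n) (Inv Stop : Graph n → Set) →
  (∀ G x → K x ≡ false → Inv G → Inv (localComp G x) ⊎ Stop G) →
  ∀ {G} → Conn G full → Inv G →
  Σ[ H ∈ Graph n ] LC (complement K) G H × (Stop H ⊎ (Conn H K × Inv H))
eliminate {n} K Inv Stop step' {G} conn inv = go (allFin n) G full conn (λ _ _ → refl) (λ v _ _ → ∈-allFin v) inv
  where
  go : ∀ (xs : List (Fin n)) G U → Conn G U → K ⊆ U → (∀ v → U v ≡ true → K v ≡ false → v ∈ xs) → Inv G →
    Σ[ H ∈ Graph n ] LC (complement K) G H × (Stop H ⊎ (Conn H K × Inv H))
  go [] G U conn K⊆U rest inv = G , done , inj₂ (Conn-≗ (λ v → bool-ext (inK v) (K⊆U v)) conn , inv)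
    where
    inK : ∀ v → U v ≡ true → K v ≡ true
    inK v p = ¬false→true λ q → case rest v p q of λ ()
  go (x ∷ xs) G U conn K⊆U rest inv with split-Bool (K x) | split-Bool (U x)
  ... | inj₁ Kx | _ = go xs G U conn K⊆U (λ v p q → case rest v p q of λ { (here refl) → true≢false Kx q ; (there m) → m }) inv
  ... | inj₂ Kx | inj₂ Ux = go xs G U conn K⊆U (λ v p q → case rest v p q of λ { (here refl) → true≢false p Ux ; (there m) → m }) inv
  ... | inj₂ Kx | inj₁ Ux = drop (Conn-eliminate x conn Ux)
    where
    U' : Subset n
    U' = U ∖ ⁅ x ⁆
    K⊆U' : K ⊆ U'
    K⊆U' v p = ∧-intro (K⊆U v p) (not-false (eq-false (∈≢∉ K p Kx)))
    rest' : ∀ v → U' v ≡ true → K v ≡ false → v ∈ xs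
    rest' v p q with ∧-elim {U v} p
    ... | Uv , v≢x with rest v Uv q
    ...   | here refl = true≢false (eq-refl v) (not-true v≢x)
    ...   | there m = m
    drop : Conn G U' ⊎ Conn (localComp G x) U' → Σ[ H ∈ Graph n ] LC (complement K) G H × (Stop H ⊎ (Conn H K × Inv H))
    drop (inj₁ c) = go xs G U' c K⊆U' rest' inv
    drop (inj₂ c) with step' G x Kx inv
    ... | inj₂ stop = G , done , inj₁ stop
    ... | inj₁ inv' with go xs (localComp G x) U' c K⊆U' rest' inv'
    ...   | H , r , out = H , at x (not-false Kx) r , out

-- Rooted trees and their copies

-- join a b hangs the root of b below the root of a, which stays the root.
data RT : Set where
  single : RT
  join   : RT → RT → RT

ext : RT → RT
ext = join single

Node : RT → Set
Node single     = ⊤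
Node (join a b) = Node a ⊎ Node b

root : ∀ τ → Node τ
root single     = tt
root (join a b) = inj₁ (root a)

isRoot : ∀ {τ} → Node τ → Bool
isRoot {single}   x        = true
isRoot {join a b} (inj₁ x) = isRoot x
isRoot {join a b} (inj₂ y) = false

edge : ∀ {τ} → Node τ → Node τ → Bool
edge {single}   _        _        = false
edge {join a b} (inj₁ x) (inj₁ y) = edge x y
edge {join a b} (inj₁ x) (inj₂ y) = isRoot x ∧ isRoot y
edge {join a b} (inj₂ x) (inj₁ y) = isRoot x ∧ isRoot y
edge {join a b} (inj₂ x) (inj₂ y) = edge x y

isRoot-root : ∀ τ → isRoot (root τ) ≡ true
isRoot-root single     = refl
isRoot-root (join a b) = isRoot-root a

isRoot-sound : ∀ {τ} (x : Node τ) → isRoot x ≡ true → x ≡ root τ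
isRoot-sound {single}   tt       e = refl
isRoot-sound {join a b} (inj₁ x) e = cong inj₁ (isRoot-sound x e)

edge-irrefl : ∀ {τ} (x : Node τ) → edge x x ≡ false
edge-irrefl {single}   x        = refl
edge-irrefl {join a b} (inj₁ x) = edge-irrefl x
edge-irrefl {join a b} (inj₂ x) = edge-irrefl x

edge-sym : ∀ {τ} (x y : Node τ) → edge x y ≡ edge y x
edge-sym {single}   x        y        = refl
edge-sym {join a b} (inj₁ x) (inj₁ y) = edge-sym x y
edge-sym {join a b} (inj₁ x) (inj₂ y) = 𝔹ₚ.∧-comm (isRoot x) (isRoot y)
edge-sym {join a b} (inj₂ x) (inj₁ y) = 𝔹ₚ.∧-comm (isRoot x) (isRoot y)
edge-sym {join a b} (inj₂ x) (inj₂ y) = edge-sym x y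

child : ∀ {τ} → Node τ → Bool
child {τ} x = edge (root τ) x

isRoot-unique : ∀ {τ} {x y : Node τ} → x ≢ y → isRoot x ∧ isRoot y ≡ false
isRoot-unique {x = x} {y} h = ¬true→false λ e → let (p , q) = ∧-elim {isRoot x} e in
  h (trans (isRoot-sound x p) (sym (isRoot-sound y q)))

root-edge : ∀ {τ} (x y : Node τ) → isRoot x ≡ true → edge x y ≡ child y
root-edge x y e rewrite isRoot-sound x e = refl

isRoot-child : ∀ {τ} (x : Node τ) → isRoot x ∧ child x ≡ false
isRoot-child {τ} x = ¬true→false λ e → let (p , q) = ∧-elim {isRoot x} e in
  true≢false q (trans (cong child (isRoot-sound x p)) (edge-irrefl (root τ)))

reach : ∀ {τ} → Node τ → Bool
reach x = isRoot x ∨ child x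

rootless : ∀ {τ} → Node τ → Node τ → Bool
rootless x y = edge x y ∧ (not (isRoot x) ∧ not (isRoot y))

-- A copy of a pattern γ inside V in which exactly the nodes of β have neighbours outside V,
-- and all of those have the same ones.
record Form {n} (N : Set) (r : N) (β : N → Bool) (γ : N → N → Bool) (V : Subset n) (H : Graph n) : Set where
  field
    g      : N → Fin n
    g-inj  : ∀ {x y} → g x ≡ g y → x ≡ y
    g∈V    : ∀ x → V (g x) ≡ true
    inner  : ∀ x y → x ≢ y → adj H (g x) (g y) ≡ γ x y
    outer  : ∀ x w → V w ≡ false → adj H (g x) w ≡ β x ∧ adj H (g r) w
    port   : Fin n
    port∉V : V port ≡ false
    joined : adj H (g r) port ≡ true

  r̂ : Fin n
  r̂ = g r

-- In form A the root attaches the copy to the outside. In form C the outside has taken over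
-- the role of the root: it is joined to the children, and the root's own vertex is left pendant.
FormA FormC : ∀ {n} → RT → Subset n → Graph n → Set
FormA τ = Form (Node τ) (root τ) isRoot edge
FormC τ = Form (Node τ) (root τ) reach rootless

module FormA-facts {n} {τ} {V : Subset n} {H} (F : FormA τ V H) where
  open Form F

  from-root : ∀ x → adj H r̂ (g x) ≡ child x
  from-root x with split-Bool (isRoot x)
  ... | inj₁ e rewrite isRoot-sound x e = trans (adj-irrefl H r̂) (sym (edge-irrefl (root τ)))
  ... | inj₂ e = inner (root τ) x λ { refl → true≢false (isRoot-root τ) e }

  inner-nodes : ∀ {s} → V s ≡ false → ∀ x → adj H s (g x) ≡ isRoot x ∧ adj H s r̂
  inner-nodes {s} p x = trans (adj-sym H s (g x)) (trans (outer x s p) (cong (isRoot x ∧_) (adj-sym H r̂ s)))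

-- The root is the only node that s can see, so no pair of nodes is toggled. If s sees the root it
-- becomes the new port; otherwise the row of the root is unchanged.
FormA-lc-outside : ∀ {n τ} {V : Subset n} {H} → FormA τ V H → ∀ s → V s ≡ false → FormA τ V (localComp H s)
FormA-lc-outside {τ = τ} {V} {H} F s s∉V = record
  { g = g ; g-inj = g-inj ; g∈V = g∈V
  ; inner = λ x y h → trans (lc-≢ H s (λ e → h (g-inj e))) (trans (cong₂ (λ b c → adj H (g x) (g y) xor (b ∧ c)) (inner-nodes s∉V x) (inner-nodes s∉V y))
      (trans (⇔→≡ (mp (tautology 4 (λ e p q a → (p ∧ q ⇔ false) ⇒ (e xor ((p ∧ a) ∧ (q ∧ a)) ⇔ e)) refl (adj H (g x) (g y)) (isRoot x) (isRoot y) (adj H s r̂))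
        (≡→⇔ (isRoot-unique h)))) (inner x y h)))
  ; outer = outer'
  ; port = proj₁ port' ; port∉V = proj₁ (proj₂ port') ; joined = proj₂ (proj₂ port') }
  where
  open Form F
  open FormA-facts F
  outer' : ∀ x w → V w ≡ false → adj (localComp H s) (g x) w ≡ isRoot x ∧ adj (localComp H s) r̂ w
  outer' x w q with split-Bool (isRoot x)
  ... | inj₁ e rewrite isRoot-sound x e | isRoot-root τ = refl
  ... | inj₂ e rewrite e = trans (lc-offˡ H s (trans (inner-nodes s∉V x) (cong (_∧ adj H s r̂) e))) (trans (outer x w q) (cong (_∧ adj H r̂ w) e))
  port' : Σ[ w ∈ Fin _ ] V w ≡ false × adj (localComp H s) r̂ w ≡ true
  port' with split-Bool (adj H s r̂)
  ... | inj₁ e = s , s∉V , trans (lc-selfʳ H s) (adj-sym-true H e)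
  ... | inj₂ e = port , port∉V , trans (lc-offˡ H s e) joined

FormA-LC-outside : ∀ {n τ} {V W : Subset n} {G H} → (∀ v → W v ≡ true → V v ≡ false) → LC W G H →
  (F : FormA τ V G) → Σ[ F' ∈ FormA τ V H ] Form.r̂ F' ≡ Form.r̂ F
FormA-LC-outside {τ = τ} {V} d lc F = LC-invariant (λ K → Σ[ F' ∈ FormA τ V K ] Form.r̂ F' ≡ Form.r̂ F)
  (λ x p (F' , e) → FormA-lc-outside F' x (d x p) , e) lc (F , refl)

-- The top vertex of ext τ is complemented at and discarded.
shift : ∀ {n τ} {V : Subset n} {H} (F : FormA (ext τ) V H) → FormA τ V (localComp H (Form.r̂ F))
shift {τ = τ} {V} {H} F = record
  { g = λ x → g (inj₂ x) ; g-inj = λ e → inj₂-injective (g-inj e) ; g∈V = λ x → g∈V (inj₂ x)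
  ; inner = λ x y h → trans (lc-≢ H q λ e → h (inj₂-injective (g-inj e)))
      (trans (cong₂ _xor_ (inner (inj₂ x) (inj₂ y) λ e → h (inj₂-injective e)) (trans (cong₂ _∧_ (from-root (inj₂ x)) (from-root (inj₂ y))) (isRoot-unique h)))
        (𝔹ₚ.xor-identityʳ _))
  ; outer = λ x w w∉ → trans (row x w w∉) (cong (isRoot x ∧_) (sym (trans (row (root τ) w w∉) (cong (_∧ adj H q w) (isRoot-root τ)))))
  ; port = port ; port∉V = port∉V
  ; joined = trans (row (root τ) port port∉V) (∧-intro (isRoot-root τ) joined) }
  where
  open Form F
  open FormA-facts F
  q : Fin _
  q = r̂
  row : ∀ x w → V w ≡ false → adj (localComp H q) (g (inj₂ x)) w ≡ isRoot x ∧ adj H q w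
  row x w w∉ = trans (lc-≢ H q (∈≢∉ V (g∈V (inj₂ x)) w∉)) (cong₂ (λ a b → a xor (b ∧ adj H q w)) (outer (inj₂ x) w w∉) (from-root (inj₂ x)))

-- The second vertex of ext (ext τ) is complemented at and discarded.
skip : ∀ {n τ} {V : Subset n} {H} (F : FormA (ext (ext τ)) V H) →
  FormA (ext τ) V (localComp H (Form.g F (inj₂ (inj₁ tt))))
skip {τ = τ} {V} {H} F = record
  { g = h ; g-inj = λ {x} {y} e → h-inj x y (g-inj e) ; g∈V = λ x → g∈V (emb x)
  ; inner = inner'
  ; outer = λ x w w∉ → trans (lc-offʳ H q (silent w w∉)) (trans (outer (emb x) w w∉) (cong₂ _∧_ (same-root x) (sym (lc-offʳ H q (silent w w∉)))))
  ; port = port ; port∉V = port∉V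
  ; joined = trans (lc-offʳ H q (silent port port∉V)) joined }
  where
  open Form F
  q : Fin _
  q = g (inj₂ (inj₁ tt))
  emb : Node (ext τ) → Node (ext (ext τ))
  emb (inj₁ x) = inj₁ x
  emb (inj₂ y) = inj₂ (inj₂ y)
  h : Node (ext τ) → Fin _
  h x = g (emb x)
  h-inj : ∀ x y → emb x ≡ emb y → x ≡ y
  h-inj (inj₁ x) (inj₁ .x) refl = refl
  h-inj (inj₂ x) (inj₂ .x) refl = refl
  same-root : ∀ x → isRoot (emb x) ≡ isRoot x
  same-root (inj₁ x) = refl
  same-root (inj₂ x) = refl
  silent : ∀ w → V w ≡ false → adj H q w ≡ false
  silent w p = outer (inj₂ (inj₁ tt)) w p
  from-q : ∀ x → adj H q (h x) ≡ edge (inj₂ (inj₁ tt)) (emb x)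
  from-q x = inner _ (emb x) (λ e → miss x (sym e))
    where
    miss : ∀ x → emb x ≢ inj₂ (inj₁ tt)
    miss (inj₁ x) ()
    miss (inj₂ x) ()
  inner' : ∀ x y → x ≢ y → adj (localComp H q) (h x) (h y) ≡ edge x y
  inner' x y x≢y = trans (lc-≢ H q (λ e → x≢y (h-inj x y (g-inj e))))
    (trans (cong₂ _xor_ (inner (emb x) (emb y) (λ e → x≢y (h-inj x y e))) (cong₂ _∧_ (from-q x) (from-q y))) (toggle x y x≢y))
    where
    toggle : ∀ x y → x ≢ y → edge (emb x) (emb y) xor (edge (inj₂ (inj₁ tt)) (emb x) ∧ edge (inj₂ (inj₁ tt)) (emb y)) ≡ edge x y
    toggle (inj₁ tt) (inj₁ tt) h = ⊥-elim (h refl)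
    toggle (inj₁ tt) (inj₂ y)  h = refl
    toggle (inj₂ x)  (inj₁ tt) h rewrite 𝔹ₚ.∧-identityʳ (isRoot x) = refl
    toggle (inj₂ x)  (inj₂ y)  h rewrite isRoot-unique (λ e → h (cong inj₂ e)) = 𝔹ₚ.xor-identityʳ _

-- Pivoting on the edge between the top vertex q of ext τ and the root r of τ.
pivot : ∀ {n τ} {V : Subset n} {H} (F : FormA (ext τ) V H) →
  let q = Form.r̂ F ; r = Form.g F (inj₂ (root τ)) in
  FormC τ V (localComp (localComp (localComp H q) r) q)
pivot {n} {τ} {V} {H} F = record
  { g = k ; g-inj = λ e → inj₂-injective (g-inj e) ; g∈V = λ x → g∈V (inj₂ x)
  ; inner = inner'
  ; outer = λ x w w∉ → trans (row₃ x w w∉) (cong (reach x ∧_) (sym (trans (row₃ (root τ) w w∉) (cong (λ c → (c ∨ child (root τ)) ∧ M w) (isRoot-root τ)))))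
  ; port = port ; port∉V = port∉V
  ; joined = trans (row₃ (root τ) port port∉V) (∧-intro (∨-introˡ (isRoot-root τ)) joined) }
  where
  open Form F
  open FormA-facts F
  q r : Fin n
  q = r̂
  r = g (inj₂ (root τ))
  k : Node τ → Fin n
  k x = g (inj₂ x)
  M : Fin n → Bool
  M w = adj H q w
  k-≢ : ∀ {x y} → x ≢ y → k x ≢ k y
  k-≢ h e = h (inj₂-injective (g-inj e))
  q≢k : ∀ x → q ≢ k x
  q≢k x e with g-inj e
  ... | ()
  H₁ H₂ H₃ : Graph n
  H₁ = localComp H q
  H₂ = localComp H₁ r
  H₃ = localComp H₂ q
  qx : ∀ x → adj H q (k x) ≡ isRoot x
  qx x = from-root (inj₂ x)
  kw : ∀ x w → V w ≡ false → k x ≢ w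
  kw x w = ∈≢∉ V (g∈V (inj₂ x))
  F₁ : FormA τ V H₁
  F₁ = shift F
  inner₁ : ∀ x y → x ≢ y → adj H₁ (k x) (k y) ≡ edge x y
  inner₁ = Form.inner F₁
  rx : ∀ x → adj H₁ r (k x) ≡ child x
  rx = FormA-facts.from-root F₁
  rq : adj H₁ r q ≡ true
  rq = trans (lc-selfʳ H q) (trans (adj-sym H r q) (trans (qx (root τ)) (isRoot-root τ)))
  row₁ : ∀ x w → V w ≡ false → adj H₁ (k x) w ≡ isRoot x ∧ M w
  row₁ x w p = trans (lc-≢ H q (kw x w p)) (cong₂ (λ a b → a xor (b ∧ M w)) (outer (inj₂ x) w p) (qx x))
  inner₂ : ∀ x y → x ≢ y → adj H₂ (k x) (k y) ≡ edge x y xor (child x ∧ child y)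
  inner₂ x y h = trans (lc-≢ H₁ r (k-≢ h)) (cong₂ _xor_ (inner₁ x y h) (cong₂ _∧_ (rx x) (rx y)))
  qx₂ : ∀ x → adj H₂ q (k x) ≡ isRoot x xor child x
  qx₂ x = trans (lc-≢ H₁ r (q≢k x)) (cong₂ _xor_ (trans (lc-self H q) (qx x)) (trans (cong (_∧ adj H₁ r (k x)) rq) (rx x)))
  rw : ∀ w → V w ≡ false → adj H₁ r w ≡ M w
  rw w p = trans (row₁ (root τ) w p) (cong (_∧ M w) (isRoot-root τ))
  row₂ : ∀ x w → V w ≡ false → adj H₂ (k x) w ≡ (isRoot x xor child x) ∧ M w
  row₂ x w p = trans (lc-≢ H₁ r (kw x w p)) (trans (cong₂ _xor_ (row₁ x w p) (cong₂ _∧_ (rx x) (rw w p)))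
    (sym (𝔹ₚ.∧-distribʳ-xor (M w) (isRoot x) (child x))))
  qw₂ : ∀ w → V w ≡ false → adj H₂ q w ≡ false
  qw₂ w p = trans (lc-≢ H₁ r (∈≢∉ V (g∈V (inj₁ tt)) p)) (trans (cong₂ _xor_ (lc-self H q) (trans (cong (_∧ adj H₁ r w) rq) (rw w p))) (𝔹ₚ.xor-same (M w)))
  inner' : ∀ x y → x ≢ y → adj H₃ (k x) (k y) ≡ rootless x y
  inner' x y h = trans (lc-≢ H₂ q (k-≢ h)) (trans (cong₂ _xor_ (inner₂ x y h) (cong₂ _∧_ (qx₂ x) (qx₂ y)))
    (⇔→≡ (mp (mp (mp (tautology 5 (λ e p c p' c' → (p ∧ p' ⇔ false) ⇒ (p ⇒ (e ⇔ c')) ⇒ (p' ⇒ (e ⇔ c)) ⇒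
       ((e xor (c ∧ c')) xor ((p xor c) ∧ (p' xor c')) ⇔ (e ∧ (not p ∧ not p')))) refl (edge x y) (isRoot x) (child x) (isRoot y) (child y))
       (≡→⇔ (isRoot-unique h))) (⇒-intro λ e → ≡→⇔ (root-edge x y e))) (⇒-intro λ e → ≡→⇔ (trans (edge-sym x y) (root-edge y x e))))))
  row₃ : ∀ x w → V w ≡ false → adj H₃ (k x) w ≡ reach x ∧ M w
  row₃ x w p = trans (lc-offʳ H₂ q (qw₂ w p)) (trans (row₂ x w p) (cong (_∧ M w)
    (⇔→≡ (mp (tautology 2 (λ p c → (p ∧ c ⇔ false) ⇒ (p xor c ⇔ p ∨ c)) refl (isRoot x) (child x)) (≡→⇔ (isRoot-child x))))))

-- Complementing at s toggles all pairs among the root and its children, which joins the root to the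
-- children. Complementing at the root then undoes the toggling among the children and, as they
-- agree with the root outside V, detaches them from the outside.
unpivot : ∀ {n τ} {V : Subset n} {H} (F : FormC τ V H) s → V s ≡ false → adj H (Form.r̂ F) s ≡ true →
  FormA τ V (localComp (localComp H s) (Form.r̂ F))
unpivot {n} {τ} {V} {H} F s s∉V rs = record
  { g = g ; g-inj = g-inj ; g∈V = g∈V
  ; inner = inner₂
  ; outer = λ x w w∉ → trans (row₂ x w w∉) (cong (isRoot x ∧_) (sym (trans (row₂ (root τ) w w∉) (cong (_∧ M w) (isRoot-root τ)))))
  ; port = s ; port∉V = s∉V ; joined = trans (row₂ (root τ) s s∉V) (∧-intro (isRoot-root τ) (trans (lc-selfʳ H s) rs)) }
  where
  open Form F
  r : Fin n
  r = r̂
  H₁ H₂ : Graph n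
  H₁ = localComp H s
  H₂ = localComp H₁ r
  M : Fin n → Bool
  M w = adj H₁ r w
  sx : ∀ x → adj H s (g x) ≡ reach x
  sx x = trans (adj-sym H s (g x)) (trans (outer x s s∉V) (trans (cong (reach x ∧_) rs) (𝔹ₚ.∧-identityʳ _)))
  reach-root : reach (root τ) ≡ true
  reach-root = ∨-introˡ (isRoot-root τ)
  inner₁ : ∀ x y → x ≢ y → adj H₁ (g x) (g y) ≡ rootless x y xor (reach x ∧ reach y)
  inner₁ x y h = trans (lc-≢ H s (λ e → h (g-inj e))) (cong₂ _xor_ (inner x y h) (cong₂ _∧_ (sx x) (sx y)))
  row₁ : ∀ x w → V w ≡ false → adj H₁ (g x) w ≡ reach x ∧ M w
  row₁ x w p = trans (general x) (cong (reach x ∧_) (sym (trans (general (root τ)) (cong (_∧ (adj H r w xor adj H s w)) reach-root))))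
    where
    general : ∀ x → adj H₁ (g x) w ≡ reach x ∧ (adj H r w xor adj H s w)
    general x = trans (lc-≢ H s (∈≢∉ V (g∈V x) p)) (trans (cong₂ (λ a b → a xor (b ∧ adj H s w)) (outer x w p) (sx x)) (sym (𝔹ₚ.∧-distribˡ-xor (reach x) (adj H r w) (adj H s w))))
  rx : ∀ x → adj H₁ r (g x) ≡ child x
  rx x with split-Bool (isRoot x)
  ... | inj₁ e rewrite isRoot-sound x e = trans (adj-irrefl H₁ r) (sym (edge-irrefl (root τ)))
  ... | inj₂ e = trans (inner₁ (root τ) x λ { refl → true≢false (isRoot-root τ) e })
      (trans (cong₂ (λ a b → (child x ∧ (not a ∧ not (isRoot x))) xor (b ∧ reach x)) (isRoot-root τ) reach-root)
        (trans (cong₂ (λ a b → a xor (b ∨ child x)) (𝔹ₚ.∧-zeroʳ (child x)) e) refl))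
  inner₂ : ∀ x y → x ≢ y → adj H₂ (g x) (g y) ≡ edge x y
  inner₂ x y h = trans (lc-≢ H₁ r (λ e → h (g-inj e))) (trans (cong₂ _xor_ (inner₁ x y h) (cong₂ _∧_ (rx x) (rx y)))
    (⇔→≡ (mp (mp (mp (mp (mp (tautology 5 (λ e p c p' c' → (p ∧ p' ⇔ false) ⇒ (p ⇒ (e ⇔ c')) ⇒ (p' ⇒ (e ⇔ c)) ⇒ (p ∧ c ⇔ false) ⇒ (p' ∧ c' ⇔ false) ⇒
       (((e ∧ (not p ∧ not p')) xor ((p ∨ c) ∧ (p' ∨ c'))) xor (c ∧ c') ⇔ e)) refl (edge x y) (isRoot x) (child x) (isRoot y) (child y))
       (≡→⇔ (isRoot-unique h))) (⇒-intro λ e → ≡→⇔ (root-edge x y e))) (⇒-intro λ e → ≡→⇔ (trans (edge-sym x y) (root-edge y x e))))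
       (≡→⇔ (isRoot-child x))) (≡→⇔ (isRoot-child y)))))
  row₂ : ∀ x w → V w ≡ false → adj H₂ (g x) w ≡ isRoot x ∧ M w
  row₂ x w p = trans (lc-≢ H₁ r (∈≢∉ V (g∈V x) p)) (trans (cong₂ (λ a b → a xor (b ∧ M w)) (row₁ x w p) (rx x))
    (⇔→≡ (mp (tautology 3 (λ p c m → (p ∧ c ⇔ false) ⇒ (((p ∨ c) ∧ m) xor (c ∧ m) ⇔ p ∧ m)) refl (isRoot x) (child x) (M w)) (≡→⇔ (isRoot-child x)))))

-- The only child of the top is the root of τ. Dropping the pendant top leaves this root as the one
-- node attached to the outside.
peel : ∀ {n τ} {V : Subset n} {H} → FormC (ext τ) V H → FormA τ V H
peel {n} {τ} {V} {H} F = record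
  { g = λ x → g (inj₂ x) ; g-inj = λ e → inj₂-injective (g-inj e) ; g∈V = λ x → g∈V (inj₂ x)
  ; inner = λ x y h → trans (inner (inj₂ x) (inj₂ y) λ e → h (inj₂-injective e)) (𝔹ₚ.∧-identityʳ _)
  ; outer = λ x w p → trans (outer (inj₂ x) w p) (cong (isRoot x ∧_) (sym (trans (outer (inj₂ (root τ)) w p) (cong (_∧ adj H r̂ w) (isRoot-root τ)))))
  ; port = port ; port∉V = port∉V
  ; joined = trans (outer (inj₂ (root τ)) port port∉V) (∧-intro (isRoot-root τ) joined) }
  where
  open Form F

-- Gluing

-- The effect outside V of complementations inside V: the neighbourhood m of V is complemented or not.
record Outside {n} (G : Graph n) (V m : Subset n) (H : Graph n) (j : Bool) : Set where
  field
    rows : ∀ v → V v ≡ true → Σ[ a ∈ Bool ] (∀ w → V w ≡ false → adj H v w ≡ a ∧ m w)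
    out  : ∀ w w' → V w ≡ false → V w' ≡ false → w ≢ w' → adj H w w' ≡ adj G w w' xor (j ∧ (m w ∧ m w'))

  row-of : ∀ {r w₀} → V r ≡ true → V w₀ ≡ false → adj H r w₀ ≡ true → ∀ w → V w ≡ false → adj H r w ≡ m w
  row-of {r} {w₀} p q e w w∉ with rows r p
  ... | a , f = trans (f w w∉) (cong (_∧ m w) (proj₁ (∧-elim (trans (sym (f w₀ q)) e))))

same-row : ∀ {n} {G : Graph n} {V} → Limb G V → ∀ {r s w w'} → V r ≡ true → V s ≡ true → V w ≡ false → V w' ≡ false →
  adj G r w ≡ true → adj G s w' ≡ true → ∀ t → V t ≡ false → adj G r t ≡ adj G s t
same-row L {r} {s} {w} {w'} Vr Vs Vw Vw' e e' t Vt =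
  bool-ext (λ f → rectangle L s r w' t Vs Vr Vw' Vt e' f) (λ f → rectangle L r s w t Vr Vs Vw Vt e f)

outside-start : ∀ {n} {G : Graph n} {V} → Limb G V → ∀ {r w₀} → V r ≡ true → V w₀ ≡ false → adj G r w₀ ≡ true →
  Outside G V (adj G r) G false
outside-start {G = G} {V} L {r} {w₀} Vr Vw₀ e = record
  { rows = λ v Vv → adj G v w₀ , λ w Vw → bool-ext
      (λ f → ∧-intro (rectangle L v r w w₀ Vv Vr Vw Vw₀ f e) (rectangle L r v w₀ w Vr Vv Vw₀ Vw e f))
      (λ f → let (a , b) = ∧-elim {adj G v w₀} f in rectangle L v r w₀ w Vv Vr Vw₀ Vw a b)
  ; out = λ _ _ _ _ _ → sym (𝔹ₚ.xor-identityʳ _) }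

module _ {n} {G : Graph n} {V m : Subset n} where

  -- Outside V, the neighbourhood of x is m or empty according to a, so the bit j flips exactly when
  -- a holds.
  outside-lc : ∀ {H j} x a → (∀ w → V w ≡ false → adj H x w ≡ a ∧ m w) →
    Outside G V m H j → Outside G V m (localComp H x) (j xor a)
  outside-lc {H} {j} x a row O = record
    { rows = λ v Vv → case rows v Vv of λ { (b , f) → b xor (adj H x v ∧ a) , λ w Vw →
        trans (lc-≢ H x (∈≢∉ V Vv Vw)) (trans (cong₂ (λ c d → c xor (adj H x v ∧ d)) (f w Vw) (row w Vw))
          (⇔→≡ (tautology 4 (λ b e a m → ((b ∧ m) xor (e ∧ (a ∧ m))) ⇔ ((b xor (e ∧ a)) ∧ m)) refl b (adj H x v) a (m w)))) }
    ; out = λ w w' Vw Vw' h → trans (lc-≢ H x h) (trans (cong₂ _xor_ (out w w' Vw Vw' h) (cong₂ _∧_ (row w Vw) (row w' Vw')))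
        (⇔→≡ (tautology 5 (λ e j a p q → ((e xor (j ∧ (p ∧ q))) xor ((a ∧ p) ∧ (a ∧ q))) ⇔ (e xor ((j xor a) ∧ (p ∧ q)))) refl
          (adj G w w') j a (m w) (m w')))) }
    where open Outside O

  outside-flip : ∀ {H j} x {w₀} → V x ≡ true → V w₀ ≡ false → adj H x w₀ ≡ true →
    Outside G V m H j → Outside G V m (localComp H x) (j xor true)
  outside-flip x p q e O = outside-lc x true (Outside.row-of O p q e) O

  outside-keep : ∀ {H j} x → (∀ w → V w ≡ false → adj H x w ≡ false) →
    Outside G V m H j → Outside G V m (localComp H x) (j xor false)
  outside-keep x h O = outside-lc x false h O

  outside-LC : ∀ {H K} → LC V H K → (Σ[ j ∈ Bool ] Outside G V m H j) → Σ[ j ∈ Bool ] Outside G V m K j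
  outside-LC = LC-invariant (λ H → Σ[ j ∈ Bool ] Outside G V m H j)
    λ { x p (j , O) → let (a , f) = Outside.rows O x p in _ , outside-lc x a f O }

-- Throughout, every row of V is zero or the same m on the outside; so a new copy in V with another
-- root is attached to the same outside vertices as the old one.
row-stable : ∀ {n} {G H : Graph n} {V} → Limb G V → LC V G H → ∀ {r s w w'} → V r ≡ true → V s ≡ true →
  V w ≡ false → V w' ≡ false → adj G r w ≡ true → adj H s w' ≡ true → ∀ t → V t ≡ false → adj H s t ≡ adj G r t
row-stable L lc Vr Vs Vw Vw' e e' with outside-LC lc (_ , outside-start L Vr Vw e)
... | _ , O = Outside.row-of O Vs Vw' e'

-- The vertex t never lies in the neighbourhood of a vertex of Z, hence no pair containing t is ever
-- toggled.
column-stable : ∀ {n} {Z : Subset n} {G H} → LC Z G H → ∀ t → (∀ x → Z x ≡ true → adj G x t ≡ false) → ∀ u → adj H u t ≡ adj G u t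
column-stable {Z = Z} {G} lc t h = proj₂ (LC-invariant
  (λ K → (∀ x → Z x ≡ true → adj K x t ≡ false) × (∀ u → adj K u t ≡ adj G u t))
  (λ {K} x p (silent , same) → (λ y q → trans (lc-offʳ K x (silent x p)) (silent y q)) , λ u → trans (lc-offʳ K x (silent x p)) (same u))
  lc (h , λ _ → refl))

-- The net effect on the outside is prescribed as odd parity. Gluing uses it to create or remove the
-- edges between the root of the other limb and the outside.
record Toggled {n} (τ : RT) (V : Subset n) (G : Graph n) : Set where
  field
    H      : Graph n
    lc     : LC V G H
    form   : FormA τ V H
    toggle : ∀ w w' → V w ≡ false → V w' ≡ false → w ≢ w' →
      adj H w w' ≡ adj G w w' xor (adj H (Form.r̂ form) w ∧ adj H (Form.r̂ form) w')

Full Supply : ∀ {n} → RT → Subset n → Graph n → Set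
Full τ V G = Toggled τ V G × (Σ[ H ∈ Graph _ ] LC V G H × FormC τ V H)
Supply τ V G = Σ[ H ∈ Graph _ ] LC V G H × (FormA τ V H ⊎ FormC τ V H)

LC-one : ∀ {n} {V : Subset n} {G} x → V x ≡ true → LC V G (localComp G x)
LC-one x p = at x p done

-- A path of three extra vertices on top of τ leaves enough freedom to choose the parity and the form.
supply⇒full : ∀ {n} {τ} {V : Subset n} {G} → Conn G full → Limb G V → Supply (ext (ext (ext τ))) V G → Full τ V G
supply⇒full {n} {τ} {V} {G} conn L (H₀ , lc₀ , f₀) = toggled , isolated
  where
  two : Σ[ H ∈ Graph n ] LC V G H × FormA (ext (ext τ)) V H
  two = case f₀ of λ where
    (inj₁ F) → _ , LC-trans lc₀ (LC-one _ (Form.g∈V F _)) , shift F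
    (inj₂ F) → _ , lc₀ , peel F
  H : Graph n
  H = proj₁ two
  lc : LC V G H
  lc = proj₁ (proj₂ two)
  F : FormA (ext (ext τ)) V H
  F = proj₂ (proj₂ two)
  open Form F
  F₁ : FormA (ext τ) V (localComp H r̂)
  F₁ = shift F
  isolated : Σ[ K ∈ Graph n ] LC V G K × FormC τ V K
  isolated = _ , LC-trans lc (at _ (g∈V _) (at _ (Form.g∈V F₁ _) (at _ (Form.g∈V F₁ (inj₂ (root τ))) (LC-one _ (Form.g∈V F₁ _))))) , pivot F₁
  toggled-from : ∀ {m K} → LC V G K → (F' : FormA τ V K) → Outside G V m K true → Toggled τ V G
  toggled-from {m} {K} lc F' O = record
    { H = K ; lc = lc ; form = F'
    ; toggle = λ w w' p q h → trans (Outside.out O w w' p q h)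
        (sym (cong₂ (λ a b → adj G w w' xor (a ∧ b)) (row w p) (row w' q))) }
    where
    row = Outside.row-of O (Form.g∈V F' _) (Form.port∉V F') (Form.joined F')
  toggled : Toggled τ V G
  toggled with crossing conn V {r̂} {port} refl refl (g∈V _) port∉V
  ... | r₀ , w₀ , _ , _ , Vr₀ , Vw₀ , e₀ with outside-LC lc (_ , outside-start L Vr₀ Vw₀ e₀)
  -- Parity already odd: both spare vertices are removed by `shift`, whose complementations at
  -- attached vertices flip the bit twice.
  ...   | true , O = toggled-from (LC-trans lc (at _ (g∈V _) (LC-one _ (Form.g∈V F₁ _)))) (shift F₁)
            (outside-flip (Form.r̂ F₁) (Form.g∈V F₁ _) (Form.port∉V F₁) (Form.joined F₁) (outside-flip r̂ (g∈V _) port∉V joined O))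
  -- Parity even: one spare vertex is removed by `skip`, at a vertex with no neighbour outside V, so
  -- that only the final `shift` flips the bit.
  ...   | false , O = toggled-from (LC-trans lc (at _ (g∈V (inj₂ (inj₁ tt))) (LC-one _ (Form.g∈V F₂ _)))) (shift F₂)
            (outside-flip (Form.r̂ F₂) (Form.g∈V F₂ _) (Form.port∉V F₂) (Form.joined F₂)
              (outside-keep (g (inj₂ (inj₁ tt))) (λ w p → outer (inj₂ (inj₁ tt)) w p) O))
    where
    F₂ : FormA (ext τ) V (localComp H (g (inj₂ (inj₁ tt))))
    F₂ = skip F

-- The two ways in which q can serve as the new top: joined to an old root that is silent outside X
-- (form A), or pendant while the old root has the same neighbours outside X as q (form C).
module Top {n} {τ} {V X : Subset n} {H} (F : FormA τ V H) (V⊆X : V ⊆ X) (q : Fin n) (Xq : X q ≡ true) (Vq : V q ≡ false)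
  (o : Fin n) (Xo : X o ≡ false) (qo : adj H q o ≡ true) where
  open Form F
  open FormA-facts F

  private
    g' : Node (ext τ) → Fin n
    g' (inj₁ _) = q
    g' (inj₂ x) = g x
    g'-inj : ∀ {x y} → g' x ≡ g' y → x ≡ y
    g'-inj {inj₁ _} {inj₁ _} e = refl
    g'-inj {inj₁ _} {inj₂ y} e = ⊥-elim (∈≢∉ V (g∈V y) Vq (sym e))
    g'-inj {inj₂ x} {inj₁ _} e = ⊥-elim (∈≢∉ V (g∈V x) Vq e)
    g'-inj {inj₂ x} {inj₂ y} e = cong inj₂ (g-inj e)
    g'∈X : ∀ x → X (g' x) ≡ true
    g'∈X (inj₁ _) = Xq
    g'∈X (inj₂ x) = V⊆X _ (g∈V x)

  out-V : ∀ {w} → X w ≡ false → V w ≡ false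
  out-V p = ¬true→false λ e → true≢false (V⊆X _ e) p

  private
    build : (β : Node (ext τ) → Bool) (γ : Node (ext τ) → Node (ext τ) → Bool) → β (inj₁ tt) ≡ true →
      (∀ x → γ (inj₁ tt) (inj₂ x) ≡ isRoot x ∧ adj H q r̂) → (∀ x → γ (inj₂ x) (inj₁ tt) ≡ isRoot x ∧ adj H q r̂) →
      (∀ x y → γ (inj₂ x) (inj₂ y) ≡ edge x y) →
      (∀ x w → X w ≡ false → isRoot x ∧ adj H r̂ w ≡ β (inj₂ x) ∧ adj H q w) → Form (Node (ext τ)) (inj₁ tt) β γ X H
    build β γ b c c' d f = record
      { g = g' ; g-inj = g'-inj ; g∈V = g'∈X
      ; inner = λ { (inj₁ _) (inj₁ _) h → ⊥-elim (h refl)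
                  ; (inj₁ _) (inj₂ y) h → trans (inner-nodes Vq y) (sym (c y))
                  ; (inj₂ x) (inj₁ _) h → trans (adj-sym H (g x) q) (trans (inner-nodes Vq x) (sym (c' x)))
                  ; (inj₂ x) (inj₂ y) h → trans (inner x y (λ e → h (cong inj₂ e))) (sym (d x y)) }
      ; outer = λ { (inj₁ _) w p → sym (cong (_∧ adj H q w) b)
                  ; (inj₂ x) w p → trans (outer x w (out-V p)) (f x w p) }
      ; port = o ; port∉V = Xo ; joined = qo }

  topA : adj H q r̂ ≡ true → (∀ w → X w ≡ false → adj H r̂ w ≡ false) → FormA (ext τ) X H
  topA e silent = build isRoot edge refl
    (λ x → sym (trans (cong (isRoot x ∧_) e) (𝔹ₚ.∧-identityʳ _)))
    (λ x → cong (isRoot x ∧_) (sym e)) (λ _ _ → refl)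
    (λ x w p → trans (cong (isRoot x ∧_) (silent w p)) (𝔹ₚ.∧-zeroʳ (isRoot x)))

  topC : adj H q r̂ ≡ false → (∀ w → X w ≡ false → adj H r̂ w ≡ adj H q w) → FormC (ext τ) X H
  topC e same = build reach rootless refl
    (λ x → trans (𝔹ₚ.∧-zeroʳ (isRoot x)) (sym (trans (cong (isRoot x ∧_) e) (𝔹ₚ.∧-zeroʳ (isRoot x)))))
    (λ x → trans (cong ((isRoot x ∧ true) ∧_) (𝔹ₚ.∧-zeroʳ (not false))) (trans (𝔹ₚ.∧-zeroʳ (isRoot x ∧ true)) (sym (trans (cong (isRoot x ∧_) e) (𝔹ₚ.∧-zeroʳ (isRoot x))))))
    (λ x y → 𝔹ₚ.∧-identityʳ _) (λ x w p → cong (isRoot x ∧_) (same w p))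

touch : ∀ {n} {τ} {V : Subset n} {H} → Limb H V → (F : FormA τ V H) → ∀ {v w} → V v ≡ true → V w ≡ false → adj H v w ≡ true →
  adj H (Form.r̂ F) w ≡ true
touch L F {v} {w} Vv Vw e = rectangle L (Form.r̂ F) v (Form.port F) w (Form.g∈V F _) Vv (Form.port∉V F) Vw (Form.joined F) e

-- If the root sees something outside X, it sees there the same as q. A nonadjacent q gives form C
-- at once; an adjacent q erases the outer edges of the root when complemented at, giving form A. If
-- the root sees nothing outside X, the vertices of X off V are eliminated until a complementation
-- is due at one that sees both the root and the outside of X; that vertex is the top. Otherwise the
-- root stays silent to the end, where V and the complement of X form a connected graph although
-- every edge leaving V has a neighbour of the root as its outer end.
extend-top : ∀ {n} {τ} {V X : Subset n} {G} → Conn G full → Limb G V → Limb G X → V ⊆ X → FormA τ V G →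
  ∀ q o → X q ≡ true → V q ≡ false → X o ≡ false → adj G q o ≡ true → Supply (ext τ) X G
extend-top {n} {τ} {V} {X} {G} conn LV LX V⊆X F q o Xq Vq Xo qo
  with (any? λ w → (X w ≟𝔹 false) ×-dec (adj G (Form.r̂ F) w ≟𝔹 true))
... | yes (w₀ , Xw₀ , rw₀) = direct (split-Bool (adj G q r̂))
  where
  open Form F
  same : ∀ w → X w ≡ false → adj G r̂ w ≡ adj G q w
  same = same-row LX (V⊆X _ (g∈V _)) Xq Xw₀ Xo rw₀ qo
  direct : adj G q r̂ ≡ true ⊎ adj G q r̂ ≡ false → Supply (ext τ) X G
  direct (inj₂ e) = G , done , inj₂ (Top.topC F V⊆X q Xq Vq o Xo qo e same)
  direct (inj₁ e) = localComp G q , LC-one q Xq , inj₁ (Top.topA (FormA-lc-outside F q Vq) V⊆X q Xq Vq o Xo (trans (lc-self G q) qo)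
    (trans (lc-self G q) e) λ w p → trans (lc-≢ G q (∈≢∉ X (V⊆X _ (g∈V _)) p))
      (trans (cong₂ (λ a b → a xor (b ∧ adj G q w)) (same w p) e) (𝔹ₚ.xor-same (adj G q w))))
... | no apart = finish (eliminate K Inv Stop advance conn (F , λ w p → ¬true→false λ e → apart (w , p , e)))
  where
  K : Subset n
  K = V ∪ complement X
  Inv Stop : Graph n → Set
  Inv H = Σ[ F ∈ FormA τ V H ] (∀ w → X w ≡ false → adj H (Form.r̂ F) w ≡ false)
  Stop H = Σ[ F ∈ FormA τ V H ] (∀ w → X w ≡ false → adj H (Form.r̂ F) w ≡ false) ×
    Σ[ q ∈ Fin n ] Σ[ o ∈ Fin n ] X q ≡ true × V q ≡ false × X o ≡ false × adj H q o ≡ true × adj H q (Form.r̂ F) ≡ true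
  outK : ∀ {x} → K x ≡ false → V x ≡ false × X x ≡ true
  outK {x} p = proj₁ (∨-false p) , ¬false→true λ e → true≢false (cong not e) (proj₂ (∨-false {V x} p))
  advance : ∀ H x → K x ≡ false → Inv H → Inv (localComp H x) ⊎ Stop H
  advance H x Kx (F , silent) with outK Kx | split-Bool (adj H x (Form.r̂ F)) | (any? λ w → (X w ≟𝔹 false) ×-dec (adj H x w ≟𝔹 true))
  ... | Vx , Xx | inj₁ e | yes (w , Xw , xw) = inj₂ (F , silent , x , w , Xx , Vx , Xw , xw , e)
  ... | Vx , Xx | inj₂ e | _ = inj₁ (FormA-lc-outside F x Vx , λ w p → trans (lc-offˡ H x e) (silent w p))
  ... | Vx , Xx | inj₁ e | no none = inj₁ (FormA-lc-outside F x Vx , λ w p →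
          trans (lc-offʳ H x (¬true→false λ f → none (w , p , f))) (silent w p))
  finish : Σ[ H ∈ Graph n ] LC (complement K) G H × (Stop H ⊎ (Conn H K × Inv H)) → Supply (ext τ) X G
  finish (H , lc , inj₁ (F , silent , q , o , Xq , Vq , Xo , qo , qr)) =
    H , LC-mono (λ v p → proj₂ (outK (not-true p))) lc , inj₁ (Top.topA F V⊆X q Xq Vq o Xo qo qr silent)
  finish (H , lc , inj₂ (c , F , silent)) with crossing c V {Form.r̂ F} {o} (∨-introˡ (Form.g∈V F _)) (∨-introʳ {V o} (not-false Xo))
                                               (Form.g∈V F _) (¬true→false λ e → true≢false (V⊆X o e) Xo)
  ... | z , t , _ , Kt , Vz , Vt , zt = true≢false (touch (Limb-LC lc LV) F Vz Vt zt)
          (silent t (not-true (trans (sym (cong (_∨ not (X t)) Vt)) Kt)))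

-- The price of form A is one complementation at a neighbour s of V. Later s is chosen within X, so
-- that the work stays inside X.
supplyA : ∀ {n} {τ} {V : Subset n} {G} → Limb G V → ∀ {v s} → V v ≡ true → V s ≡ false → adj G v s ≡ true →
  Supply τ V G → Σ[ H ∈ Graph n ] LC (V ∪ ⁅ s ⁆) G H × FormA τ V H
supplyA L Vv Vs vs (H , lc , inj₁ F) = H , LC-mono (λ _ → ∨-introˡ) lc , F
supplyA {V = V} L {v} {s} Vv Vs vs (H , lc , inj₂ F) =
  _ , LC-trans (LC-mono (λ _ → ∨-introˡ) lc) (at s (∨-introʳ {V s} (eq-refl s)) (LC-one _ (∨-introˡ (Form.g∈V F _)))) ,
  unpivot F s Vs (trans (row-stable L lc Vv (Form.g∈V F _) Vs (Form.port∉V F) vs (Form.joined F) s Vs) vs)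

-- All locally equivalent graphs are included because a limb may be called upon after
-- complementations in its sibling or elsewhere in X.
Supplied : ∀ {n} → Graph n → RT → Subset n → Set
Supplied G τ V = ∀ H → LC full G H → Supply τ V H

record Siblings {n} (G : Graph n) (X V₁ V₂ : Subset n) : Set where
  field
    connected : Conn G full
    limbX     : Limb G X
    limb₁     : Limb G V₁
    limb₂     : Limb G V₂
    sub₁      : V₁ ⊆ X
    sub₂      : V₂ ⊆ X
    apart     : Disjoint V₁ V₂
    inner₁    : Nonempty V₁
    outer     : Nonempty (complement X)

Siblings-LC : ∀ {n} {G H : Graph n} {X V₁ V₂ W} → LC W G H → Siblings G X V₁ V₂ → Siblings H X V₁ V₂
Siblings-LC lc s = record
  { connected = Conn-LC (λ _ _ → refl) lc connected ; limbX = Limb-LC lc limbX ; limb₁ = Limb-LC lc limb₁ ; limb₂ = Limb-LC lc limb₂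
  ; sub₁ = sub₁ ; sub₂ = sub₂ ; apart = apart ; inner₁ = inner₁ ; outer = outer }
  where open Siblings s

-- Some V₂–X edge avoids V₁, unless all edges leaving V₁ ∪ V₂ leave V₁, or all of them leave X.
third : ∀ {n} {G : Graph n} {X V₁ V₂} → Siblings G X V₁ V₂ → ¬ Limb G (V₁ ∪ V₂) →
  (∀ u w → (V₁ ∪ V₂) u ≡ true → (V₁ ∪ V₂) w ≡ false → adj G u w ≡ true →
    (V₂ u ≡ true × X w ≡ true → ⊥) → V₁ u ≡ true) ⊎
  (∀ u w → (V₁ ∪ V₂) u ≡ true → (V₁ ∪ V₂) w ≡ false → adj G u w ≡ true →
    (V₂ u ≡ true × X w ≡ true → ⊥) → X w ≡ false) →
  Σ[ v ∈ Fin n ] Σ[ s ∈ Fin n ] V₂ v ≡ true × V₁ s ≡ false × V₂ s ≡ false × X s ≡ true × adj G v s ≡ true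
third {n} {G} {X} {V₁} {V₂} sib nonlimb h
  with (any? λ v → any? λ s → (V₂ v ≟𝔹 true) ×-dec (V₁ s ≟𝔹 false) ×-dec (V₂ s ≟𝔹 false) ×-dec (X s ≟𝔹 true) ×-dec (adj G v s ≟𝔹 true))
... | yes p = p
... | no none = ⊥-elim (nonlimb (mkLimb (rect h)))
  where
  open Siblings sib
  W : Subset n
  W = V₁ ∪ V₂
  excluded : ∀ {u w} → W w ≡ false → adj G u w ≡ true → V₂ u ≡ true × X w ≡ true → ⊥
  excluded {u} {w} p e (a , b) = none (u , w , a , proj₁ (∨-false p) , proj₂ (∨-false {V₁ w} p) , b , e)
  inX : ∀ {u} → W u ≡ true → X u ≡ true
  inX {u} p = [ sub₁ u , sub₂ u ]′ (∨-elim {V₁ u} p)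
  rect : _ → ∀ u u' w w' → W u ≡ true → W u' ≡ true → W w ≡ false → W w' ≡ false →
    adj G u w ≡ true → adj G u' w' ≡ true → adj G u w' ≡ true
  rect (inj₁ h) u u' w w' p p' q q' e e' = rectangle limb₁ u u' w w' (h u w p q e (excluded q e)) (h u' w' p' q' e' (excluded q' e'))
    (proj₁ (∨-false q)) (proj₁ (∨-false q')) e e'
  rect (inj₂ h) u u' w w' p p' q q' e e' = rectangle limbX u u' w w' (inX p) (inX p') (h u w p q e (excluded q e)) (h u' w' p' q' e' (excluded q' e')) e e'

-- One limb carries the copy, and a vertex q of X off this limb, with a neighbour outside X, becomes
-- the top. If `V₁` has no neighbour in the rest of X, then `V₂` carries the copy and q is a vertex
-- of `V₁` with a neighbour outside X; it is not adjacent to the vertices complemented at, so its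
-- edges survive. Otherwise `V₁` is tried first. If in the resulting graph only vertices of `V₁` see
-- the outside of X, then `V₂` carries the copy after all, q is in `V₁`, and it is the neighbour of
-- q outside X that no complementation affects.
supply-ext : ∀ {n} {τ} {G : Graph n} {X V₁ V₂} → Siblings G X V₁ V₂ → ¬ Limb G (V₁ ∪ V₂) →
  Supplied G τ V₁ → Supplied G τ V₂ → Supply (ext τ) X G
supply-ext {n} {τ} {G} {X} {V₁} {V₂} sib nonlimb S₁ S₂
  with (any? λ v → any? λ s → (V₁ v ≟𝔹 true) ×-dec (V₁ s ≟𝔹 false) ×-dec (X s ≟𝔹 true) ×-dec (adj G v s ≟𝔹 true))
... | no closed = isolated (third sib nonlimb (inj₂ λ u w p q e ex → ¬true→false λ Xw →
        case ∨-elim {V₁ u} p of λ { (inj₁ a) → closed (u , w , a , proj₁ (∨-false q) , Xw , e) ; (inj₂ b) → ex (b , Xw) }))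
  where
  open Siblings sib
  isolated : Σ[ v ∈ Fin n ] Σ[ s ∈ Fin n ] V₂ v ≡ true × V₁ s ≡ false × V₂ s ≡ false × X s ≡ true × adj G v s ≡ true → Supply (ext τ) X G
  isolated (v , s , V₂v , V₁s , V₂s , Xs , vs)
    with supplyA limb₂ V₂v V₂s vs (S₂ G done) | crossing connected V₁ {proj₁ inner₁} {s} refl refl (proj₂ inner₁) V₁s
  ... | H , lc , F | z , t , _ , _ , V₁z , V₁t , zt =
    let Xt = ¬true→false λ e → closed (z , t , V₁z , V₁t , e , zt)
        tz = trans (column-stable lc z quiet t) (adj-sym-true G zt)
        sib' = Siblings-LC lc sib
        (K , lc' , f) = extend-top (Siblings.connected sib') (Siblings.limb₂ sib') (Siblings.limbX sib') sub₂ F z t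
                          (sub₁ z V₁z) (apart z V₁z) Xt (adj-sym-true H tz)
    in K , LC-trans (LC-mono within lc) lc' , f
    where
    within : (V₂ ∪ ⁅ s ⁆) ⊆ X
    within x p = [ sub₂ x , (λ e → subst (λ y → X y ≡ true) (sym (eq-sound e)) Xs) ]′ (∨-elim {V₂ x} p)
    quiet : ∀ x → (V₂ ∪ ⁅ s ⁆) x ≡ true → adj G x z ≡ false
    quiet x p = ¬true→false λ e → closed (z , x , V₁z , notV₁ (∨-elim {V₂ x} p) , within x p , adj-sym-true G e)
      where
      notV₁ : V₂ x ≡ true ⊎ eq x s ≡ true → V₁ x ≡ false
      notV₁ (inj₁ a) = ¬true→false λ b → true≢false a (apart x b)
      notV₁ (inj₂ e) = subst (λ y → V₁ y ≡ false) (sym (eq-sound e)) V₁s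
... | yes (v₁ , s₁ , V₁v₁ , V₁s₁ , Xs₁ , v₁s₁) with supplyA (Siblings.limb₁ sib) V₁v₁ V₁s₁ v₁s₁ (S₁ G done)
...   | G₁ , lc₁ , F₁
  with (any? λ q → any? λ o → (X q ≟𝔹 true) ×-dec (V₁ q ≟𝔹 false) ×-dec (X o ≟𝔹 false) ×-dec (adj G₁ q o ≟𝔹 true))
...     | yes (q , o , Xq , V₁q , Xo , qo) =
    let (K , lc' , f) = extend-top connected limb₁ limbX sub₁ F₁ q o Xq V₁q Xo qo
    in K , LC-trans (LC-mono within lc₁) lc' , f
  where
  open Siblings (Siblings-LC lc₁ sib)
  within : (V₁ ∪ ⁅ s₁ ⁆) ⊆ X
  within x p = [ sub₁ x , (λ e → subst (λ y → X y ≡ true) (sym (eq-sound e)) Xs₁) ]′ (∨-elim {V₁ x} p)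
...     | no only = chosen (third sib₁ (¬Limb-LC lc₁ nonlimb) (inj₁ λ u w p q e ex →
          case ∨-elim {V₁ u} p of λ { (inj₁ a) → a ; (inj₂ b) → ⊥-elim (only (u , w , sub₂ u b , notV₁ b ,
            ¬true→false (λ Xw → ex (b , Xw)) , e)) }))
  where
  sib₁ : Siblings G₁ X V₁ V₂
  sib₁ = Siblings-LC lc₁ sib
  open Siblings sib₁
  notV₁ : ∀ {x} → V₂ x ≡ true → V₁ x ≡ false
  notV₁ {x} a = ¬true→false λ b → true≢false a (apart x b)
  within₁ : (V₁ ∪ ⁅ s₁ ⁆) ⊆ X
  within₁ x p = [ sub₁ x , (λ e → subst (λ y → X y ≡ true) (sym (eq-sound e)) Xs₁) ]′ (∨-elim {V₁ x} p)
  chosen : Σ[ v ∈ Fin n ] Σ[ s ∈ Fin n ] V₂ v ≡ true × V₁ s ≡ false × V₂ s ≡ false × X s ≡ true × adj G₁ v s ≡ true → Supply (ext τ) X G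
  chosen (v , s , V₂v , V₁s , V₂s , Xs , vs)
    with supplyA limb₂ V₂v V₂s vs (S₂ G₁ (LC-mono (λ _ _ → refl) lc₁))
       | crossing connected X {v} {proj₁ outer} refl refl (sub₂ v V₂v) (not-true (proj₂ outer))
  ... | H , lc , F | z , t , _ , _ , Xz , Xt , zt =
    let V₁z = ¬false→true λ e → only (z , t , Xz , e , Xt , zt)
        sib₂ = Siblings-LC lc sib₁
        (K , lc' , f) = extend-top (Siblings.connected sib₂) (Siblings.limb₂ sib₂) (Siblings.limbX sib₂) sub₂ F z t
                          Xz (apart z V₁z) Xt (trans (column-stable lc t quiet z) zt)
    in K , LC-trans (LC-trans (LC-mono within₁ lc₁) (LC-mono within lc)) lc' , f
    where
    within : (V₂ ∪ ⁅ s ⁆) ⊆ X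
    within x p = [ sub₂ x , (λ e → subst (λ y → X y ≡ true) (sym (eq-sound e)) Xs) ]′ (∨-elim {V₂ x} p)
    quiet : ∀ x → (V₂ ∪ ⁅ s ⁆) x ≡ true → adj G₁ x t ≡ false
    quiet x p = ¬true→false λ e → only (x , t , within x p ,
      [ notV₁ , (λ r → subst (λ y → V₁ y ≡ false) (sym (eq-sound r)) V₁s) ]′ (∨-elim {V₂ x} p) , Xt , e)

module Join {n} {a b : RT} {X V₁ V₂ : Subset n} {H : Graph n} (sub₁ : V₁ ⊆ X) (sub₂ : V₂ ⊆ X) (apart : Disjoint V₁ V₂) where

  apart' : Disjoint V₂ V₁
  apart' x p = ¬true→false λ q → true≢false p (apart x q)

  out₁ : ∀ {w} → X w ≡ false → V₁ w ≡ false
  out₁ p = ¬true→false λ e → true≢false (sub₁ _ e) p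

  out₂ : ∀ {w} → X w ≡ false → V₂ w ≡ false
  out₂ p = ¬true→false λ e → true≢false (sub₂ _ e) p

  joinForm : ∀ {β₁ γ₁ β γ} (F₁ : Form (Node a) (root a) β₁ γ₁ V₁ H) (F₂ : FormA b V₂ H) →
    (∀ x y → γ (inj₁ x) (inj₁ y) ≡ γ₁ x y) → (∀ x y → γ (inj₂ x) (inj₂ y) ≡ edge x y) →
    (∀ x y → γ (inj₁ x) (inj₂ y) ≡ β₁ x ∧ (isRoot y ∧ adj H (Form.r̂ F₁) (Form.r̂ F₂))) →
    (∀ x y → γ (inj₂ y) (inj₁ x) ≡ β₁ x ∧ (isRoot y ∧ adj H (Form.r̂ F₁) (Form.r̂ F₂))) →
    (∀ x → β (inj₁ x) ≡ β₁ x) →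
    (∀ y w → X w ≡ false → isRoot y ∧ adj H (Form.r̂ F₂) w ≡ β (inj₂ y) ∧ adj H (Form.r̂ F₁) w) →
    ∀ o → X o ≡ false → adj H (Form.r̂ F₁) o ≡ true →
    Form (Node (join a b)) (inj₁ (root a)) β γ X H
  joinForm {β₁} F₁ F₂ c₁ c₂ c₁₂ c₂₁ d₁ d₂ o Xo ro = record
    { g = g ; g-inj = g-inj
    ; g∈V = λ { (inj₁ x) → sub₁ _ (A.g∈V x) ; (inj₂ y) → sub₂ _ (B.g∈V y) }
    ; inner = λ { (inj₁ x) (inj₁ y) h → trans (A.inner x y (λ e → h (cong inj₁ e))) (sym (c₁ x y))
                ; (inj₂ x) (inj₂ y) h → trans (B.inner x y (λ e → h (cong inj₂ e))) (sym (c₂ x y))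
                ; (inj₁ x) (inj₂ y) h → trans (across x y) (sym (c₁₂ x y))
                ; (inj₂ y) (inj₁ x) h → trans (adj-sym H _ _) (trans (across x y) (sym (c₂₁ x y))) }
    ; outer = λ { (inj₁ x) w p → trans (A.outer x w (out₁ p)) (cong (_∧ adj H A.r̂ w) (sym (d₁ x)))
                ; (inj₂ y) w p → trans (B.outer y w (out₂ p)) (d₂ y w p) }
    ; port = o ; port∉V = Xo ; joined = ro }
    where
    module A = Form F₁
    module B = Form F₂
    g : Node (join a b) → Fin n
    g (inj₁ x) = A.g x
    g (inj₂ y) = B.g y
    g-inj : ∀ {x y} → g x ≡ g y → x ≡ y
    g-inj {inj₁ x} {inj₁ y} e = cong inj₁ (A.g-inj e)
    g-inj {inj₂ x} {inj₂ y} e = cong inj₂ (B.g-inj e)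
    g-inj {inj₁ x} {inj₂ y} e = ⊥-elim (∈≢∉ V₁ (A.g∈V x) (apart' _ (B.g∈V y)) e)
    g-inj {inj₂ x} {inj₁ y} e = ⊥-elim (∈≢∉ V₁ (A.g∈V y) (apart' _ (B.g∈V x)) (sym e))
    across : ∀ x y → adj H (A.g x) (B.g y) ≡ β₁ x ∧ (isRoot y ∧ adj H A.r̂ B.r̂)
    across x y = trans (A.outer x _ (apart' _ (B.g∈V y))) (cong (β₁ x ∧_)
      (FormA-facts.inner-nodes F₂ (apart _ (A.g∈V (root a))) y))

  joinA : (F₁ : FormA a V₁ H) (F₂ : FormA b V₂ H) → adj H (Form.r̂ F₁) (Form.r̂ F₂) ≡ true →
    (∀ w → X w ≡ false → adj H (Form.r̂ F₂) w ≡ false) → ∀ o → X o ≡ false → adj H (Form.r̂ F₁) o ≡ true → FormA (join a b) X H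
  joinA F₁ F₂ e silent = joinForm {β = isRoot} {γ = edge} F₁ F₂ (λ _ _ → refl) (λ _ _ → refl)
    (λ x y → cong (isRoot x ∧_) (sym (last y)))
    (λ x y → trans (𝔹ₚ.∧-comm (isRoot y) (isRoot x)) (cong (isRoot x ∧_) (sym (last y))))
    (λ _ → refl) (λ y w p → trans (cong (isRoot y ∧_) (silent w p)) (𝔹ₚ.∧-zeroʳ (isRoot y)))
    where
    last : ∀ y → isRoot y ∧ adj H (Form.r̂ F₁) (Form.r̂ F₂) ≡ isRoot y
    last y = trans (cong (isRoot y ∧_) e) (𝔹ₚ.∧-identityʳ _)

  -- The root of b is one more child of the missing root: it is attached to the same outside
  -- vertices as the children in a.
  joinC : (F₁ : FormC a V₁ H) (F₂ : FormA b V₂ H) → adj H (Form.r̂ F₁) (Form.r̂ F₂) ≡ false →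
    (∀ w → X w ≡ false → adj H (Form.r̂ F₂) w ≡ adj H (Form.r̂ F₁) w) → ∀ o → X o ≡ false → adj H (Form.r̂ F₁) o ≡ true → FormC (join a b) X H
  joinC F₁ F₂ e same = joinForm {β = reach} {γ = rootless} F₁ F₂ (λ _ _ → refl) (λ _ _ → 𝔹ₚ.∧-identityʳ _)
    (λ x y → trans (⇔→≡ (tautology 2 (λ p q → ((p ∧ q) ∧ (not p ∧ true)) ⇔ false) refl (isRoot x) (isRoot y))) (sym (zero' x y)))
    (λ x y → trans (⇔→≡ (tautology 2 (λ p q → ((q ∧ p) ∧ (true ∧ not p)) ⇔ false) refl (isRoot x) (isRoot y))) (sym (zero' x y)))
    (λ _ → refl) (λ y w p → trans (cong (isRoot y ∧_) (same w p)) (cong (λ c → (c ∧ isRoot y) ∧ adj H (Form.r̂ F₁) w) (sym (isRoot-root a))))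
    where
    zero' : ∀ x y → reach x ∧ (isRoot y ∧ adj H (Form.r̂ F₁) (Form.r̂ F₂)) ≡ false
    zero' x y = trans (cong (λ c → reach x ∧ (isRoot y ∧ c)) e) (trans (cong (reach x ∧_) (𝔹ₚ.∧-zeroʳ (isRoot y))) (𝔹ₚ.∧-zeroʳ (reach x)))

FullySupplied : ∀ {n} → Graph n → RT → Subset n → Set
FullySupplied G τ V = ∀ H → LC full G H → Full τ V H

-- After the rest of X is eliminated, connectedness means that `r₁`, `r₂` and the outside of X are
-- joined as a triangle or as a path. A path centred at `r₁` is form A of the join. The other three
-- shapes are brought to form A or C by the local lemmas below.
supply-join : ∀ {n} {a b : RT} {G : Graph n} {X V₁ V₂} → Siblings G X V₁ V₂ →
  FullySupplied G a V₁ → FullySupplied G b V₂ → Supply (join a b) X G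
supply-join {n} {a} {b} {G} {X} {V₁} {V₂} sib S₁ S₂ =
  reduced (eliminate K (λ _ → ⊤) (λ _ → ⊥) (λ _ _ _ _ → inj₁ tt) (Siblings.connected sib) tt)
  where
  open Siblings sib using (sub₁; sub₂; apart)
  open Join {a = a} {b} {X = X} {H = G} sub₁ sub₂ apart using (apart'; out₁; out₂)
  K : Subset n
  K = V₁ ∪ V₂ ∪ complement X
  widen : ∀ {V : Subset n} {G H} → LC V G H → LC full G H
  widen = LC-mono (λ _ _ → refl)

  finishA : ∀ {H} → LC X G H → (F₁ : FormA a V₁ H) (F₂ : FormA b V₂ H) → adj H (Form.r̂ F₁) (Form.r̂ F₂) ≡ true →
    (∀ w → X w ≡ false → adj H (Form.r̂ F₂) w ≡ false) → ∀ o → X o ≡ false → adj H (Form.r̂ F₁) o ≡ true → Supply (join a b) X G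
  finishA lc F₁ F₂ e silent o Xo ro = _ , lc , inj₁ (Join.joinA sub₁ sub₂ apart F₁ F₂ e silent o Xo ro)

  -- Both roots have the same neighbours outside X. Complementing the neighbourhood of `V₁`, which
  -- contains `r₂` and these neighbours, removes all edges from `r₂` to the outside.
  triangle : ∀ {H} → LC X G H → (F₁ : FormA a V₁ H) (F₂ : FormA b V₂ H) → adj H (Form.r̂ F₁) (Form.r̂ F₂) ≡ true →
    ∀ o o' → X o ≡ false → X o' ≡ false → adj H (Form.r̂ F₁) o ≡ true → adj H (Form.r̂ F₂) o' ≡ true → Supply (join a b) X G
  triangle {H} lc F₁ F₂ e o o' Xo Xo' r₁o r₂o' = finishA (LC-trans lc (LC-mono sub₁ T.lc)) T.form F₂'
      (trans (cong (adj T.H r₁') (proj₂ kept)) r₁'r₂) silent o Xo (trans (stable o (out₁ Xo)) r₁o)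
    where
    module T = Toggled (proj₁ (S₁ H (widen lc)))
    module S = Siblings (Siblings-LC lc sib)
    kept = FormA-LC-outside apart T.lc F₂
    F₂' = proj₁ kept
    r₁ r₁' r₂ : Fin n
    r₁ = Form.r̂ F₁
    r₁' = Form.r̂ T.form
    r₂ = Form.r̂ F₂
    V₁r₂ : V₁ r₂ ≡ false
    V₁r₂ = apart' _ (Form.g∈V F₂ _)
    stable : ∀ t → V₁ t ≡ false → adj T.H r₁' t ≡ adj H r₁ t
    stable = row-stable S.limb₁ T.lc (Form.g∈V F₁ _) (Form.g∈V T.form _) (Form.port∉V F₁) (Form.port∉V T.form) (Form.joined F₁) (Form.joined T.form)
    r₁'r₂ : adj T.H r₁' r₂ ≡ true
    r₁'r₂ = trans (stable r₂ V₁r₂) e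
    silent : ∀ w → X w ≡ false → adj T.H (Form.r̂ F₂') w ≡ false
    silent w p = trans (cong (λ r → adj T.H r w) (proj₂ kept)) (trans (T.toggle r₂ w V₁r₂ (out₁ p) (∈≢∉ X (sub₂ _ (Form.g∈V F₂ _)) p))
      (trans (cong₂ (λ c d → adj H r₂ w xor (c ∧ d)) r₁'r₂
        (trans (stable w (out₁ p)) (same-row S.limbX (sub₁ _ (Form.g∈V F₁ _)) (sub₂ _ (Form.g∈V F₂ _)) Xo Xo' r₁o r₂o' w p))) (𝔹ₚ.xor-same (adj H r₂ w))))

  -- The same toggle, now at `V₂`, joins `r₁` to the outside and so produces the triangle.
  lower-centre : ∀ {H} → LC X G H → (F₁ : FormA a V₁ H) (F₂ : FormA b V₂ H) → adj H (Form.r̂ F₁) (Form.r̂ F₂) ≡ true →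
    ∀ o → X o ≡ false → (∀ w → X w ≡ false → adj H (Form.r̂ F₁) w ≡ false) → adj H (Form.r̂ F₂) o ≡ true → Supply (join a b) X G
  lower-centre {H} lc F₁ F₂ e o Xo silent r₂o = triangle (LC-trans lc (LC-mono sub₂ T.lc)) F₁' T.form
      (subst (λ r → adj T.H r r₂' ≡ true) (sym (proj₂ kept)) (adj-sym-true T.H r₂'r₁)) o o Xo Xo
      (subst (λ r → adj T.H r o ≡ true) (sym (proj₂ kept)) r₁o) r₂'o
    where
    module T = Toggled (proj₁ (S₂ H (widen lc)))
    module S = Siblings (Siblings-LC lc sib)
    kept = FormA-LC-outside apart' T.lc F₁
    F₁' = proj₁ kept
    r₁ r₂ r₂' : Fin n
    r₁ = Form.r̂ F₁
    r₂ = Form.r̂ F₂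
    r₂' = Form.r̂ T.form
    V₂r₁ : V₂ r₁ ≡ false
    V₂r₁ = apart _ (Form.g∈V F₁ _)
    stable : ∀ t → V₂ t ≡ false → adj T.H r₂' t ≡ adj H r₂ t
    stable = row-stable S.limb₂ T.lc (Form.g∈V F₂ _) (Form.g∈V T.form _) (Form.port∉V F₂) (Form.port∉V T.form) (Form.joined F₂) (Form.joined T.form)
    r₂'r₁ : adj T.H r₂' r₁ ≡ true
    r₂'r₁ = trans (stable r₁ V₂r₁) (adj-sym-true H e)
    r₂'o : adj T.H r₂' o ≡ true
    r₂'o = trans (stable o (out₂ Xo)) r₂o
    r₁o : adj T.H r₁ o ≡ true
    r₁o = trans (T.toggle r₁ o V₂r₁ (out₂ Xo) (∈≢∉ X (sub₁ _ (Form.g∈V F₁ _)) Xo))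
      (trans (cong₂ (λ c d → adj H r₁ o xor (c ∧ d)) r₂'r₁ r₂'o) (cong (_xor true) (silent o Xo)))

  -- The outside can only play the part of the common root, so `V₁` is brought to form C. As `r₂`
  -- has no neighbour in `V₁`, its edges are not affected.
  outer-centre : ∀ {H} → LC X G H → (F₁ : FormA a V₁ H) (F₂ : FormA b V₂ H) → adj H (Form.r̂ F₁) (Form.r̂ F₂) ≡ false →
    ∀ o o' → X o ≡ false → X o' ≡ false → adj H (Form.r̂ F₁) o ≡ true → adj H (Form.r̂ F₂) o' ≡ true → Supply (join a b) X G
  outer-centre {H} lc F₁ F₂ e o o' Xo Xo' r₁o r₂o' with proj₂ (S₁ H (widen lc))
  ... | H' , lc' , C = H' , LC-trans lc (LC-mono sub₁ lc') ,
          inj₂ (Join.joinC sub₁ sub₂ apart C (proj₁ kept) (trans (cong (adj H' c) (proj₂ kept)) (trans (stable r₂ V₁r₂) e)) same o Xo co)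
    where
    module S = Siblings (Siblings-LC lc sib)
    module S' = Siblings (Siblings-LC lc' (Siblings-LC lc sib))
    kept = FormA-LC-outside apart lc' F₂
    r₁ r₂ c : Fin n
    r₁ = Form.r̂ F₁
    r₂ = Form.r̂ F₂
    c = Form.r̂ C
    V₁r₂ : V₁ r₂ ≡ false
    V₁r₂ = apart' _ (Form.g∈V F₂ _)
    stable : ∀ t → V₁ t ≡ false → adj H' c t ≡ adj H r₁ t
    stable = row-stable S.limb₁ lc' (Form.g∈V F₁ _) (Form.g∈V C _) (Form.port∉V F₁) (Form.port∉V C) (Form.joined F₁) (Form.joined C)
    co : adj H' c o ≡ true
    co = trans (stable o (out₁ Xo)) r₁o
    quiet : ∀ x → V₁ x ≡ true → adj H x r₂ ≡ false
    quiet x p = ¬true→false λ f → true≢false (touch S.limb₁ F₁ p V₁r₂ f) e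
    r₂o'' : adj H' r₂ o' ≡ true
    r₂o'' = adj-sym-true H' (trans (column-stable lc' r₂ quiet o') (adj-sym-true H r₂o'))
    same : ∀ w → X w ≡ false → adj H' (Form.r̂ (proj₁ kept)) w ≡ adj H' c w
    same w p = trans (cong (λ r → adj H' r w) (proj₂ kept))
      (same-row S'.limbX (sub₂ _ (Form.g∈V F₂ _)) (sub₁ _ (Form.g∈V C _)) Xo' Xo r₂o'' co w p)

  reduced : Σ[ H ∈ Graph n ] LC (complement K) G H × (⊥ ⊎ (Conn H K × ⊤)) → Supply (join a b) X G
  reduced (H₀ , lc₀ , inj₂ (conn₀ , _)) = decide (split-Bool (adj H₂ r₁ r₂)) outward₁ outward₂
    where
    lc₀' : LC X G H₀
    lc₀' = LC-mono (λ v p → ¬false→true λ e → true≢false (cong not e) (proj₂ (∨-false {V₂ v} (proj₂ (∨-false {V₁ v} (not-true p)))))) lc₀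
    -- Both copies are produced before any adjacency is examined, since producing them may change
    -- the edges between the three places.
    module T₁ = Toggled (proj₁ (S₁ H₀ (widen lc₀')))
    lc₁ : LC X G T₁.H
    lc₁ = LC-trans lc₀' (LC-mono sub₁ T₁.lc)
    module T₂ = Toggled (proj₁ (S₂ T₁.H (widen lc₁)))
    H₂ : Graph n
    H₂ = T₂.H
    lc₂ : LC X G H₂
    lc₂ = LC-trans lc₁ (LC-mono sub₂ T₂.lc)
    module S = Siblings (Siblings-LC lc₂ sib)
    V₁⊆K : V₁ ⊆ K
    V₁⊆K v p = ∨-introˡ p
    V₂⊆K : V₂ ⊆ K
    V₂⊆K v p = ∨-introʳ {V₁ v} (∨-introˡ p)
    O⊆K : complement X ⊆ K
    O⊆K v p = ∨-introʳ {V₁ v} (∨-introʳ {V₂ v} p)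
    conn₂ : Conn H₂ K
    conn₂ = Conn-LC V₂⊆K T₂.lc (Conn-LC V₁⊆K T₁.lc conn₀)
    F₁ : FormA a V₁ H₂
    F₁ = proj₁ (FormA-LC-outside apart' T₂.lc T₁.form)
    F₂ : FormA b V₂ H₂
    F₂ = T₂.form
    r₁ r₂ o : Fin n
    r₁ = Form.r̂ F₁
    r₂ = Form.r̂ F₂
    o = proj₁ S.outer
    Xo : X o ≡ false
    Xo = not-true (proj₂ S.outer)
    Outward : Fin n → Set
    Outward r = Σ[ w ∈ Fin n ] X w ≡ false × adj H₂ r w ≡ true
    outward₁ : Outward r₁ ⊎ (∀ w → X w ≡ false → adj H₂ r₁ w ≡ false)
    outward₁ with (any? λ w → (X w ≟𝔹 false) ×-dec (adj H₂ r₁ w ≟𝔹 true))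
    ... | yes p = inj₁ p
    ... | no h = inj₂ λ w p → ¬true→false λ e → h (w , p , e)
    outward₂ : Outward r₂ ⊎ (∀ w → X w ≡ false → adj H₂ r₂ w ≡ false)
    outward₂ with (any? λ w → (X w ≟𝔹 false) ×-dec (adj H₂ r₂ w ≟𝔹 true))
    ... | yes p = inj₁ p
    ... | no h = inj₂ λ w p → ¬true→false λ e → h (w , p , e)
    V₁r₁ = Form.g∈V F₁ (root a)
    V₂r₂ = Form.g∈V F₂ (root b)
    -- Some edge of the connected graph on `K` leaves `V₁`, and by `touch` the root has the outer
    -- end of that edge as a neighbour. If this end lies in `V₂`, then `touch` on the other side
    -- moves it to `r₂`.
    leaves₁ : adj H₂ r₁ r₂ ≡ true ⊎ Outward r₁
    leaves₁ with crossing conn₂ V₁ {r₁} {o} (V₁⊆K _ V₁r₁) (O⊆K _ (not-false Xo)) V₁r₁ (out₁ Xo)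
    ... | z , t , _ , Kt , V₁z , V₁t , zt with touch S.limb₁ F₁ V₁z V₁t zt | split-Bool (X t)
    ...   | rt | inj₂ Xt = inj₂ (t , Xt , rt)
    ...   | rt | inj₁ Xt = inj₁ (adj-sym-true H₂ (touch S.limb₂ F₂ V₂t (apart _ V₁r₁) (adj-sym-true H₂ rt)))
      where
      V₂t : V₂ t ≡ true
      V₂t with ∨-elim {V₁ t} Kt
      ... | inj₁ p = true≢false p V₁t
      ... | inj₂ p with ∨-elim {V₂ t} p
      ...   | inj₁ q = q
      ...   | inj₂ q = true≢false Xt (not-true q)
    leaves₂ : adj H₂ r₁ r₂ ≡ true ⊎ Outward r₂
    leaves₂ with crossing conn₂ V₂ {r₂} {o} (V₂⊆K _ V₂r₂) (O⊆K _ (not-false Xo)) V₂r₂ (out₂ Xo)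
    ... | z , t , _ , Kt , V₂z , V₂t , zt with touch S.limb₂ F₂ V₂z V₂t zt | split-Bool (X t)
    ...   | rt | inj₂ Xt = inj₂ (t , Xt , rt)
    ...   | rt | inj₁ Xt = inj₁ (touch S.limb₁ F₁ V₁t (apart' _ V₂r₂) (adj-sym-true H₂ rt))
      where
      V₁t : V₁ t ≡ true
      V₁t with ∨-elim {V₁ t} Kt
      ... | inj₁ p = p
      ... | inj₂ p with ∨-elim {V₂ t} p
      ...   | inj₁ q = true≢false q V₂t
      ...   | inj₂ q = true≢false Xt (not-true q)
    entered : Outward r₁ ⊎ Outward r₂
    entered with crossing conn₂ (complement X) {o} {r₁} (O⊆K _ (not-false Xo)) (V₁⊆K _ V₁r₁) (not-false Xo) (cong not (sub₁ _ V₁r₁))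
    ... | z , t , _ , Kt , Oz , Ot , zt with ∨-elim {V₁ t} Kt
    ...   | inj₁ p = inj₁ (z , not-true Oz , touch S.limb₁ F₁ p (out₁ (not-true Oz)) (adj-sym-true H₂ zt))
    ...   | inj₂ p with ∨-elim {V₂ t} p
    ...     | inj₁ q = inj₂ (z , not-true Oz , touch S.limb₂ F₂ q (out₂ (not-true Oz)) (adj-sym-true H₂ zt))
    ...     | inj₂ q = true≢false q Ot
    silent≢ : ∀ {r} {A : Set} → Outward r → (∀ w → X w ≡ false → adj H₂ r w ≡ false) → A
    silent≢ (w , p , e) h = true≢false e (h w p)
    decide : adj H₂ r₁ r₂ ≡ true ⊎ adj H₂ r₁ r₂ ≡ false → Outward r₁ ⊎ (∀ w → X w ≡ false → adj H₂ r₁ w ≡ false) →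
      Outward r₂ ⊎ (∀ w → X w ≡ false → adj H₂ r₂ w ≡ false) → Supply (join a b) X G
    decide (inj₁ e) (inj₁ (w , Xw , p)) (inj₁ (w' , Xw' , p')) = triangle lc₂ F₁ F₂ e w w' Xw Xw' p p'
    decide (inj₁ e) (inj₁ (w , Xw , p)) (inj₂ h) = finishA lc₂ F₁ F₂ e h w Xw p
    decide (inj₁ e) (inj₂ h) (inj₁ (w , Xw , p)) = lower-centre lc₂ F₁ F₂ e w Xw h p
    decide (inj₁ e) (inj₂ h) (inj₂ h') = [ (λ q → silent≢ q h) , (λ q → silent≢ q h') ]′ entered
    decide (inj₂ e) (inj₁ (w , Xw , p)) (inj₁ (w' , Xw' , p')) = outer-centre lc₂ F₁ F₂ e w w' Xw Xw' p p'
    decide (inj₂ e) (inj₂ h) _ = [ (λ q → true≢false q e) , (λ q → silent≢ q h) ]′ leaves₁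
    decide (inj₂ e) _ (inj₂ h) = [ (λ q → true≢false q e) , (λ q → silent≢ q h) ]′ leaves₂

-- The width spent on a tree

size : RT → ℕ
size single     = 1
size (join a b) = size a + size b

-- Each 3 + p is one use of `fork`: three for the path in `either-full`, a fourth for `either-join`.
-- The bracketing and the final 0 follow the types of these lemmas, so that `dichotomy` needs no
-- arithmetic.
cost : ℕ → RT → ℕ
cost p single     = (3 + p) + ((3 + p) + ((3 + p) + 0))
cost p (join a b) = (3 + p) + ((3 + p) + ((3 + p) + ((3 + p) + (cost p a + cost p b))))

-- With s nodes there are s occurrences of `single` at three units each and s - 1 of `join` at four,
-- hence 7 s - 4 units; the 4 is moved to the left to avoid truncated subtraction.
cost-bound : ∀ p τ → cost p τ + 4 * (3 + p) ≡ 7 * (3 + p) * size τ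
cost-bound p single = solve 1 (λ p → let q = con 3 :+ p in (q :+ (q :+ (q :+ con 0))) :+ con 4 :* q := con 7 :* q :* con 1) refl p
  where open +-*-Solver
cost-bound p (join a b) = begin
  cost p (join a b) + 4 * (3 + p)
    ≡⟨ solve 3 (λ p x y → let q = con 3 :+ p in (q :+ (q :+ (q :+ (q :+ (x :+ y))))) :+ con 4 :* q := (x :+ con 4 :* q) :+ (y :+ con 4 :* q)) refl p (cost p a) (cost p b) ⟩
  (cost p a + 4 * (3 + p)) + (cost p b + 4 * (3 + p))
    ≡⟨ cong₂ _+_ (cost-bound p a) (cost-bound p b) ⟩
  7 * (3 + p) * size a + 7 * (3 + p) * size b
    ≡⟨ sym (ℕₚ.*-distribˡ-+ (7 * (3 + p)) (size a) (size b)) ⟩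
  7 * (3 + p) * (size a + size b) ∎
  where
  open +-*-Solver
  open ≡-Reasoning

module Dichotomy {n} {G : Graph n} (conn : Conn G full) {p : ℕ} (primes : PrimesBounded G p) where

  Either : ℕ → (Subset n → Set) → Set
  Either k Good = ∀ X → ProperLimb G X → Lin {G = G} k X ⊎ Good X

  siblings : ∀ {Good X} → ProperLimb G X → (f : Fork G Good X) → Siblings G X (Fork.V₁ f) (Fork.V₂ f)
  siblings (LX , _ , (o , Xo)) f = record
    { connected = conn ; limbX = LX ; limb₁ = proj₁ limb₁ ; limb₂ = proj₁ limb₂ ; sub₁ = V₁⊆X ; sub₂ = V₂⊆X
    ; apart = disjoint ; inner₁ = proj₁ (proj₂ limb₁) ; outer = o , not-false Xo }
    where open Fork f

  either-ext : ∀ {k τ} → Either k (Supplied G τ) → Either ((3 + p) + k) (Supplied G (ext τ))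
  either-ext d X LX with fork conn primes d X LX
  ... | inj₁ lin = inj₁ lin
  ... | inj₂ f = inj₂ λ H lc → supply-ext (Siblings-LC lc (siblings LX f)) (¬Limb-LC lc (Fork.nonlimb f))
          (λ H' lc' → Fork.good₁ f H' (LC-trans lc lc')) (λ H' lc' → Fork.good₂ f H' (LC-trans lc lc'))

  either-full : ∀ {k τ} → Either k (Supplied G τ) → Either ((3 + p) + ((3 + p) + ((3 + p) + k))) (FullySupplied G τ)
  either-full d X LX = [ inj₁ , (λ s → inj₂ λ H lc → supply⇒full (Conn-LC (λ _ _ → refl) lc conn) (Limb-LC lc (proj₁ LX)) (s H lc)) ]′
    (either-ext (either-ext (either-ext d)) X LX)

  either-single : Either 0 (Supplied G single)
  either-single X (_ , (x , Xx) , (y , Xy)) = inj₂ supply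
    where
    supply : Supplied G single X
    supply H lc with crossing (Conn-LC (λ _ _ → refl) lc conn) X {x} {y} refl refl Xx Xy
    ... | z , t , _ , _ , Xz , Xt , zt = H , done , inj₁ record
      { g = λ _ → z ; g-inj = λ _ → refl ; g∈V = λ _ → Xz ; inner = λ _ _ h → ⊥-elim (h refl)
      ; outer = λ _ _ _ → refl ; port = t ; port∉V = Xt ; joined = zt }

  -- `fork` works with a single notion of richness, so a limb counts as rich only if it supplies
  -- both trees; any other limb has a layout of width k or of width l, hence of width k + l.
  either-join : ∀ {k l a b} → Either k (FullySupplied G a) → Either l (FullySupplied G b) → Either ((3 + p) + (k + l)) (Supplied G (join a b))
  either-join {k} {l} {a} {b} d e X LX with fork conn primes both X LX
    where
    both : Either (k + l) (λ V → FullySupplied G a V × FullySupplied G b V)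
    both V LV with d V LV | e V LV
    ... | inj₁ lin | _ = inj₁ (Lin-mono (ℕₚ.m≤m+n k l) lin)
    ... | inj₂ _ | inj₁ lin = inj₁ (Lin-mono (ℕₚ.m≤n+m l k) lin)
    ... | inj₂ s | inj₂ t = inj₂ (s , t)
  ... | inj₁ lin = inj₁ lin
  ... | inj₂ f = inj₂ λ H lc → supply-join (Siblings-LC lc (siblings LX f))
          (λ H' lc' → proj₁ (Fork.good₁ f) H' (LC-trans lc lc')) (λ H' lc' → proj₂ (Fork.good₂ f) H' (LC-trans lc lc'))

  dichotomy : ∀ τ → Either (cost p τ) (FullySupplied G τ)
  dichotomy single     = either-full either-single
  dichotomy (join a b) = either-full (either-join (dichotomy a) (dichotomy b))

-- Trees as iterated leaf insertions

-- The leaf is carried down to the `single` that represents the chosen node and is hung below it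
-- there; all roots stay where they were.
insert : ∀ τ → Node τ → RT
insert single     _        = join single single
insert (join a b) (inj₁ x) = join (insert a x) b
insert (join a b) (inj₂ y) = join a (insert b y)

-- The value `inj₂ tt` marks the new leaf. Properties of the enlarged tree are read off through
-- `origin`, with `edge′` as its expected adjacency.
origin : ∀ {τ} (x : Node τ) → Node (insert τ x) → Node τ ⊎ ⊤
origin {single}   _        (inj₁ _) = inj₁ tt
origin {single}   _        (inj₂ _) = inj₂ tt
origin {join a b} (inj₁ x) (inj₁ z) = [ inj₁ ∘ inj₁ , inj₂ ]′ (origin x z)
origin {join a b} (inj₁ x) (inj₂ z) = inj₁ (inj₂ z)
origin {join a b} (inj₂ y) (inj₁ z) = inj₁ (inj₁ z)
origin {join a b} (inj₂ y) (inj₂ z) = [ inj₁ ∘ inj₂ , inj₂ ]′ (origin y z)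

same : ∀ {τ} → Node τ → Node τ → Bool
same {single}   _        _        = true
same {join a b} (inj₁ x) (inj₁ y) = same x y
same {join a b} (inj₁ x) (inj₂ y) = false
same {join a b} (inj₂ x) (inj₁ y) = false
same {join a b} (inj₂ x) (inj₂ y) = same x y

same-sound : ∀ {τ} (x y : Node τ) → same x y ≡ true → x ≡ y
same-sound {single}   _        _        e = refl
same-sound {join a b} (inj₁ x) (inj₁ y) e = cong inj₁ (same-sound x y e)
same-sound {join a b} (inj₂ x) (inj₂ y) e = cong inj₂ (same-sound x y e)

isRoot′ : ∀ {τ} → Node τ ⊎ ⊤ → Bool
isRoot′ = [ isRoot , (λ _ → false) ]′

edge′ : ∀ {τ} → Node τ → Node τ ⊎ ⊤ → Node τ ⊎ ⊤ → Bool
edge′ x (inj₁ y) (inj₁ z) = edge y z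
edge′ x (inj₁ y) (inj₂ _) = same y x
edge′ x (inj₂ _) (inj₁ z) = same z x
edge′ x (inj₂ _) (inj₂ _) = false

origin-root : ∀ {τ} (x : Node τ) z → isRoot z ≡ isRoot′ (origin x z)
origin-root {single}   _        (inj₁ _) = refl
origin-root {single}   _        (inj₂ _) = refl
origin-root {join a b} (inj₁ x) (inj₁ z) with origin x z | origin-root x z
... | inj₁ _ | e = e
... | inj₂ _ | e = e
origin-root {join a b} (inj₁ x) (inj₂ z) = refl
origin-root {join a b} (inj₂ y) (inj₁ z) = refl
origin-root {join a b} (inj₂ y) (inj₂ z) with origin y z
... | inj₁ _ = refl
... | inj₂ _ = refl

origin-edge : ∀ {τ} (x : Node τ) z z' → edge z z' ≡ edge′ x (origin x z) (origin x z')
origin-edge {single}   _ (inj₁ _) (inj₁ _) = refl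
origin-edge {single}   _ (inj₁ _) (inj₂ _) = refl
origin-edge {single}   _ (inj₂ _) (inj₁ _) = refl
origin-edge {single}   _ (inj₂ _) (inj₂ _) = refl
origin-edge {join a b} (inj₁ x) (inj₁ z) (inj₁ z') with origin x z | origin x z' | origin-edge x z z'
... | inj₁ _ | inj₁ _ | e = e
... | inj₁ _ | inj₂ _ | e = e
... | inj₂ _ | inj₁ _ | e = e
... | inj₂ _ | inj₂ _ | e = e
origin-edge {join a b} (inj₁ x) (inj₁ z) (inj₂ z') with origin x z | origin-root x z
... | inj₁ _ | e rewrite e = refl
... | inj₂ _ | e rewrite e = refl
origin-edge {join a b} (inj₁ x) (inj₂ z) (inj₁ z') with origin x z' | origin-root x z'
... | inj₁ _ | e rewrite e = refl
... | inj₂ _ | e rewrite e = 𝔹ₚ.∧-zeroʳ (isRoot z)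
origin-edge {join a b} (inj₁ x) (inj₂ z) (inj₂ z') = refl
origin-edge {join a b} (inj₂ y) (inj₁ z) (inj₁ z') = refl
origin-edge {join a b} (inj₂ y) (inj₁ z) (inj₂ z') with origin y z' | origin-root y z'
... | inj₁ _ | e rewrite e = refl
... | inj₂ _ | e rewrite e = 𝔹ₚ.∧-zeroʳ (isRoot z)
origin-edge {join a b} (inj₂ y) (inj₂ z) (inj₁ z') with origin y z | origin-root y z
... | inj₁ _ | e rewrite e = refl
... | inj₂ _ | e rewrite e = refl
origin-edge {join a b} (inj₂ y) (inj₂ z) (inj₂ z') with origin y z | origin y z' | origin-edge y z z'
... | inj₁ _ | inj₁ _ | e = e
... | inj₁ _ | inj₂ _ | e = e
... | inj₂ _ | inj₁ _ | e = e
... | inj₂ _ | inj₂ _ | e = e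

origin-inj : ∀ {τ} (x : Node τ) z z' → origin x z ≡ origin x z' → z ≡ z'
origin-inj {single}   _ (inj₁ _) (inj₁ _) e = refl
origin-inj {single}   _ (inj₂ _) (inj₂ _) e = refl
origin-inj {join a b} (inj₁ x) (inj₁ z) (inj₁ z') e with origin x z in f | origin x z' in f'
origin-inj {join a b} (inj₁ x) (inj₁ z) (inj₁ z') refl | inj₁ _ | inj₁ _ = cong inj₁ (origin-inj x z z' (trans f (sym f')))
origin-inj {join a b} (inj₁ x) (inj₁ z) (inj₁ z') e    | inj₂ _ | inj₂ _ = cong inj₁ (origin-inj x z z' (trans f (sym f')))
origin-inj {join a b} (inj₁ x) (inj₁ z) (inj₂ z') e with origin x z
origin-inj {join a b} (inj₁ x) (inj₁ z) (inj₂ z') () | inj₁ _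
origin-inj {join a b} (inj₁ x) (inj₁ z) (inj₂ z') () | inj₂ _
origin-inj {join a b} (inj₁ x) (inj₂ z) (inj₁ z') e with origin x z'
origin-inj {join a b} (inj₁ x) (inj₂ z) (inj₁ z') () | inj₁ _
origin-inj {join a b} (inj₁ x) (inj₂ z) (inj₁ z') () | inj₂ _
origin-inj {join a b} (inj₁ x) (inj₂ z) (inj₂ .z) refl = refl
origin-inj {join a b} (inj₂ y) (inj₁ z) (inj₁ .z) refl = refl
origin-inj {join a b} (inj₂ y) (inj₁ z) (inj₂ z') e with origin y z'
origin-inj {join a b} (inj₂ y) (inj₁ z) (inj₂ z') () | inj₁ _
origin-inj {join a b} (inj₂ y) (inj₁ z) (inj₂ z') () | inj₂ _
origin-inj {join a b} (inj₂ y) (inj₂ z) (inj₁ z') e with origin y z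
origin-inj {join a b} (inj₂ y) (inj₂ z) (inj₁ z') () | inj₁ _
origin-inj {join a b} (inj₂ y) (inj₂ z) (inj₁ z') () | inj₂ _
origin-inj {join a b} (inj₂ y) (inj₂ z) (inj₂ z') e with origin y z in f | origin y z' in f'
origin-inj {join a b} (inj₂ y) (inj₂ z) (inj₂ z') refl | inj₁ _ | inj₁ _ = cong inj₂ (origin-inj y z z' (trans f (sym f')))
origin-inj {join a b} (inj₂ y) (inj₂ z) (inj₂ z') e    | inj₂ _ | inj₂ _ = cong inj₂ (origin-inj y z z' (trans f (sym f')))

size-insert : ∀ τ x → size (insert τ x) ≡ suc (size τ)
size-insert single     _        = refl
size-insert (join a b) (inj₁ x) = cong (_+ size b) (size-insert a x)
size-insert (join a b) (inj₂ y) = trans (cong (size a +_) (size-insert b y)) (ℕₚ.+-suc (size a) (size b))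

any-node? : ∀ {τ} (P : Node τ → Set) → (∀ x → Dec (P x)) → Dec (Σ (Node τ) P)
any-node? {single} P P? with P? tt
... | yes p = yes (tt , p)
... | no h = no λ { (tt , p) → h p }
any-node? {join a b} P P? with any-node? (P ∘ inj₁) (P? ∘ inj₁) | any-node? (P ∘ inj₂) (P? ∘ inj₂)
... | yes (x , p) | _ = yes (inj₁ x , p)
... | no h | yes (y , p) = yes (inj₂ y , p)
... | no h | no h' = no λ { (inj₁ x , p) → h (x , p) ; (inj₂ y , p) → h' (y , p) }

nodes : ∀ τ → Σ[ f ∈ (Fin (size τ) → Node τ) ] Injective _≡_ _≡_ f
nodes single = (λ _ → tt) , λ { {zero} {zero} _ → refl }
nodes (join a b) = f ∘ Fin.splitAt (size a) , λ {i} {j} e → trans (sym (Fₚ.join-splitAt (size a) (size b) i))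
    (trans (cong (Fin.join (size a) (size b)) (f-inj (Fin.splitAt (size a) i) (Fin.splitAt (size a) j) e)) (Fₚ.join-splitAt (size a) (size b) j))
  where
  f : Fin (size a) ⊎ Fin (size b) → Node (join a b)
  f (inj₁ i) = inj₁ (proj₁ (nodes a) i)
  f (inj₂ j) = inj₂ (proj₁ (nodes b) j)
  f-inj : ∀ s s' → f s ≡ f s' → s ≡ s'
  f-inj (inj₁ i) (inj₁ j) e = cong inj₁ (proj₂ (nodes a) (inj₁-injective e))
  f-inj (inj₂ i) (inj₂ j) e = cong inj₂ (proj₂ (nodes b) (inj₂-injective e))

data Path {A : Set} (E : A → A → Bool) : ℕ → A → A → Set where
  nil  : ∀ {x} → Path E 0 x x
  cons : ∀ {k x y z} → E x y ≡ true → Path E k y z → Path E (suc k) x z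

module _ {A : Set} {E : A → A → Bool} where

  vertex : ∀ {k x y} → Path E k x y → Fin (suc k) → A
  vertex {x = x} nil        zero    = x
  vertex {x = x} (cons _ p) zero    = x
  vertex         (cons _ p) (suc i) = vertex p i

  Simple : ∀ {k x y} → Path E k x y → Set
  Simple p = ∀ i j → vertex p i ≡ vertex p j → i ≡ j

  vertex-first : ∀ {k x y} (p : Path E k x y) → vertex p zero ≡ x
  vertex-first nil        = refl
  vertex-first (cons _ p) = refl

  vertex-last : ∀ {k x y} (p : Path E k x y) → vertex p (fromℕ k) ≡ y
  vertex-last nil        = refl
  vertex-last (cons _ p) = vertex-last p

  vertex-step : ∀ {k x y} (p : Path E k x y) (i : Fin k) → E (vertex p (inject₁ i)) (vertex p (suc i)) ≡ true
  vertex-step (cons e p) zero    = trans (cong (E _) (vertex-first p)) e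
  vertex-step (cons e p) (suc i) = vertex-step p i

  simple-cons : ∀ {k x y z} (e : E x y ≡ true) (p : Path E k y z) → (∀ i → vertex p i ≢ x) → Simple p → Simple (cons e p)
  simple-cons e p fresh s zero    zero    q = refl
  simple-cons e p fresh s zero    (suc j) q = ⊥-elim (fresh j (sym q))
  simple-cons e p fresh s (suc i) zero    q = ⊥-elim (fresh i q)
  simple-cons e p fresh s (suc i) (suc j) q = cong suc (s i j q)

SimplePath : {A : Set} (E : A → A → Bool) → A → A → Set
SimplePath E x y = Σ[ k ∈ ℕ ] Σ[ p ∈ Path E k x y ] Simple p

module _ {A C : Set} {E : A → A → Bool} {E' : C → C → Bool} (f : A → C) (f-inj : ∀ {x y} → f x ≡ f y → x ≡ y)
  (f-edge : ∀ x y → E' (f x) (f y) ≡ E x y) where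

  map-path : ∀ {k x y} → Path E k x y → Path E' k (f x) (f y)
  map-path nil        = nil
  map-path (cons e p) = cons (trans (f-edge _ _) e) (map-path p)

  map-vertex : ∀ {k x y} (p : Path E k x y) i → vertex (map-path p) i ≡ f (vertex p i)
  map-vertex nil        zero    = refl
  map-vertex (cons e p) zero    = refl
  map-vertex (cons e p) (suc i) = map-vertex p i

  map-simple : ∀ {x y} → SimplePath E x y → SimplePath E' (f x) (f y)
  map-simple (k , p , s) = k , map-path p , λ i j r → s i j (f-inj (trans (sym (map-vertex p i)) (trans r (map-vertex p j))))

  module _ {r c} (rs : E' (f r) c ≡ true) where

    bridge : ∀ {k m x y} → Path E k x r → Path E' m c y → Path E' (k + suc m) (f x) y
    bridge nil        q = cons rs q
    bridge (cons e p) q = cons (trans (f-edge _ _) e) (bridge p q)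

    bridge-vertex : ∀ {k m x y} (p : Path E k x r) (q : Path E' m c y) i →
      (Σ[ j ∈ Fin (suc k) ] vertex (bridge p q) i ≡ f (vertex p j)) ⊎ (Σ[ j ∈ Fin (suc m) ] vertex (bridge p q) i ≡ vertex q j)
    bridge-vertex nil        q zero    = inj₁ (zero , refl)
    bridge-vertex nil        q (suc i) = inj₂ (i , refl)
    bridge-vertex (cons e p) q zero    = inj₁ (zero , refl)
    bridge-vertex (cons e p) q (suc i) with bridge-vertex p q i
    ... | inj₁ (j , r) = inj₁ (suc j , r)
    ... | inj₂ r = inj₂ r

    bridge-simple : ∀ {k m x y} (p : Path E k x r) (q : Path E' m c y) → Simple p → Simple q →
      (∀ v i → vertex q i ≢ f v) → Simple (bridge p q)
    bridge-simple nil q s t d = simple-cons rs q (d r) t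
    bridge-simple (cons {x = x} e p) q s t d = simple-cons _ (bridge p q) fresh
        (bridge-simple p q (λ i j r → Fₚ.suc-injective (s (suc i) (suc j) r)) t d)
      where
      fresh : ∀ i → vertex (bridge p q) i ≢ f x
      fresh i r with bridge-vertex p q i
      ... | inj₁ (j , r') = case s zero (suc j) (f-inj (trans (sym r) r')) of λ ()
      ... | inj₂ (j , r') = d x j (trans (sym r') r)

bridge-paths : {A B C : Set} {E : A → A → Bool} {E″ : B → B → Bool} {E' : C → C → Bool}
  (f : A → C) → (∀ {x y} → f x ≡ f y → x ≡ y) → (∀ x y → E' (f x) (f y) ≡ E x y) →
  (g : B → C) → (∀ {x y} → g x ≡ g y → x ≡ y) → (∀ x y → E' (g x) (g y) ≡ E″ x y) →
  (∀ {x y} → f x ≢ g y) → ∀ {r s} → E' (f r) (g s) ≡ true →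
  ∀ {x y} → SimplePath E x r → SimplePath E″ s y → SimplePath E' (f x) (g y)
bridge-paths {E' = E'} f f-inj f-edge g g-inj g-edge apart rs (k , p , simple) (m , q , simple') =
  _ , bridge {E' = E'} f f-inj f-edge rs p (map-path g g-inj g-edge q) ,
  bridge-simple {E' = E'} f f-inj f-edge rs p (map-path g g-inj g-edge q) simple
    (proj₂ (proj₂ (map-simple g g-inj g-edge (m , q , simple'))))
    λ v i e → apart (trans (sym e) (map-vertex g g-inj g-edge q i))

-- Between the two halves of a join the path runs through both roots; it is simple because its two
-- pieces lie in different summands.
simple-path : ∀ {τ} (x y : Node τ) → SimplePath edge x y
simple-path {single}   tt       tt       = 0 , nil , λ { zero zero _ → refl }
simple-path {join a b} (inj₁ x) (inj₁ y) = map-simple inj₁ inj₁-injective (λ _ _ → refl) (simple-path x y)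
simple-path {join a b} (inj₂ x) (inj₂ y) = map-simple inj₂ inj₂-injective (λ _ _ → refl) (simple-path x y)
simple-path {join a b} (inj₁ x) (inj₂ y) = bridge-paths {E' = edge {join a b}} inj₁ inj₁-injective (λ _ _ → refl)
  inj₂ inj₂-injective (λ _ _ → refl) (λ ()) (∧-intro (isRoot-root a) (isRoot-root b)) (simple-path x (root a)) (simple-path (root b) y)
simple-path {join a b} (inj₂ x) (inj₁ y) = bridge-paths {E' = edge {join a b}} inj₂ inj₂-injective (λ _ _ → refl)
  inj₁ inj₁-injective (λ _ _ → refl) (λ ()) (∧-intro (isRoot-root b) (isRoot-root a)) (simple-path x (root b)) (simple-path (root a) y)

-- Two neighbours x and y of w in the copy would close a cycle: w followed by the simple path from x
-- to y. As x and y differ, the path has an edge, so the cycle has at least three vertices.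
unique-neighbour : ∀ {t} {T : Graph t} → Acyclic T → ∀ {τ} (e : Node τ → Fin t) → (∀ {x y} → e x ≡ e y → x ≡ y) →
  (∀ x y → adj T (e x) (e y) ≡ edge x y) → ∀ {w} → (∀ x → e x ≢ w) →
  ∀ x y → x ≢ y → adj T (e x) w ≡ true → adj T (e y) w ≡ false
unique-neighbour {t} {T} acyclic {τ} e e-inj e-adj {w} fresh x y x≢y xw = ¬true→false λ yw → loop yw (simple-path x y)
  where
  loop : adj T (e y) w ≡ true → SimplePath edge x y → ⊥
  loop yw (zero , nil , _) = x≢y refl
  loop yw (suc k , p , s) = acyclic k c (c-inj , steps , last)
    where
    c : Fin (suc (suc (suc k))) → Fin t
    c zero    = w
    c (suc i) = e (vertex p i)
    c-inj : Injective _≡_ _≡_ c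
    c-inj {zero}  {zero}  q = refl
    c-inj {zero}  {suc j} q = ⊥-elim (fresh _ (sym q))
    c-inj {suc i} {zero}  q = ⊥-elim (fresh _ q)
    c-inj {suc i} {suc j} q = cong suc (s i j (e-inj q))
    steps : ∀ (i : Fin (suc (suc k))) → adj T (c (inject₁ i)) (c (suc i)) ≡ true
    steps zero    = trans (cong (adj T w ∘ e) (vertex-first p)) (adj-sym-true T xw)
    steps (suc i) = trans (e-adj _ _) (vertex-step p i)
    last : adj T (c (fromℕ (suc (suc k)))) (c zero) ≡ true
    last = trans (cong (λ v → adj T (e v) w) (vertex-last p)) yw

record Copy {t} (T : Graph t) (τ : RT) : Set where
  field
    e     : Node τ → Fin t
    e-inj : ∀ {x y} → e x ≡ e y → x ≡ y
    e-adj : ∀ x y → adj T (e x) (e y) ≡ edge x y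

copy-size : ∀ {t} {T : Graph t} {τ} → Copy T τ → size τ ≤ t
copy-size {τ = τ} c = Fₚ.injective⇒≤ {f = e ∘ proj₁ (nodes τ)} (λ q → proj₂ (nodes τ) (e-inj q))
  where open Copy c

same-refl : ∀ {τ} (x : Node τ) → same x x ≡ true
same-refl {single}   x        = refl
same-refl {join a b} (inj₁ x) = same-refl x
same-refl {join a b} (inj₂ x) = same-refl x

add-leaf : ∀ {t} {T : Graph t} → Acyclic T → ∀ {τ} (c : Copy T τ) x w → (∀ y → Copy.e c y ≢ w) → adj T (Copy.e c x) w ≡ true →
  Copy T (insert τ x)
add-leaf {t} {T} acyclic {τ} c x w fresh xw = record
  { e = λ z → e' (origin x z)
  ; e-inj = λ {z} {z'} q → origin-inj x z z' (e'-inj (origin x z) (origin x z') q)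
  ; e-adj = λ z z' → trans (e'-adj (origin x z) (origin x z')) (sym (origin-edge x z z')) }
  where
  open Copy c
  e' : Node τ ⊎ ⊤ → Fin t
  e' (inj₁ y) = e y
  e' (inj₂ _) = w
  e'-inj : ∀ y z → e' y ≡ e' z → y ≡ z
  e'-inj (inj₁ y) (inj₁ z) q = cong inj₁ (e-inj q)
  e'-inj (inj₁ y) (inj₂ _) q = ⊥-elim (fresh y q)
  e'-inj (inj₂ _) (inj₁ z) q = ⊥-elim (fresh z (sym q))
  e'-inj (inj₂ _) (inj₂ _) q = refl
  leaf : ∀ y → adj T (e y) w ≡ same y x
  leaf y with split-Bool (same y x)
  ... | inj₁ s rewrite s = subst (λ v → adj T (e v) w ≡ true) (sym (same-sound y x s)) xw
  ... | inj₂ s rewrite s = unique-neighbour {T = T} acyclic e e-inj e-adj fresh x y (λ { refl → true≢false (same-refl x) s }) xw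
  e'-adj : ∀ y z → adj T (e' y) (e' z) ≡ edge′ x y z
  e'-adj (inj₁ y) (inj₁ z) = e-adj y z
  e'-adj (inj₁ y) (inj₂ _) = leaf y
  e'-adj (inj₂ _) (inj₁ z) = trans (adj-sym T w (e z)) (leaf z)
  e'-adj (inj₂ _) (inj₂ _) = adj-irrefl T w

leaving : ∀ {t} {T : Graph t} {τ} (c : Copy T τ) {u v} → Reach T u v → (Σ[ x ∈ Node τ ] Copy.e c x ≡ u) → (∀ x → Copy.e c x ≢ v) →
  Σ[ x ∈ Node τ ] Σ[ w ∈ Fin t ] (∀ y → Copy.e c y ≢ w) × adj T (Copy.e c x) w ≡ true
leaving c here (x , q) fresh = ⊥-elim (fresh x q)
leaving {T = T} c (step {w = w} uw r) (x , refl) fresh with any-node? (λ y → Copy.e c y ≡ w) (λ y → Copy.e c y ≟ w)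
... | yes (y , q) = leaving c r (y , q) fresh
... | no h = x , w , (λ y q → h (y , q)) , uw

-- A walk towards a missed vertex leaves the copy along some edge, whose end is added as a leaf. N
-- bounds the number of insertions still possible, since a copy has at most t nodes.
spanning-copy : ∀ {t} {T : Graph t} → IsTree T → Fin t →
  Σ[ τ ∈ RT ] Σ[ c ∈ Copy T τ ] (∀ v → Σ[ x ∈ Node τ ] Copy.e c x ≡ v)
spanning-copy {t} {T} (connected , acyclic) v₀ = grow t single start (ℕₚ.m≤m+n t 1)
  where
  start : Copy T single
  start = record { e = λ _ → v₀ ; e-inj = λ _ → refl ; e-adj = λ _ _ → adj-irrefl T v₀ }
  grow : ∀ N τ (c : Copy T τ) → t ≤ N + size τ → Σ[ τ ∈ RT ] Σ[ c ∈ Copy T τ ] (∀ v → Σ[ x ∈ Node τ ] Copy.e c x ≡ v)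
  grow N τ c h with (all? λ v → any-node? (λ x → Copy.e c x ≡ v) (λ x → Copy.e c x ≟ v))
  ... | yes onto = τ , c , onto
  ... | no ¬onto with Fₚ.¬∀⟶∃¬ t _ (λ v → any-node? (λ x → Copy.e c x ≡ v) (λ x → Copy.e c x ≟ v)) ¬onto
  ...   | v , missed with leaving c (connected (Copy.e c (root τ)) v) (root τ , refl) (λ x q → missed (x , q))
  ...     | x , w , fresh , xw = recurse N h
    where
    c' : Copy T (insert τ x)
    c' = add-leaf acyclic c x w fresh xw
    recurse : ∀ N → t ≤ N + size τ → _
    recurse zero h = ⊥-elim (ℕₚ.1+n≰n (ℕₚ.≤-trans (subst (_≤ t) (size-insert τ x) (copy-size c')) h))
    recurse (suc N) h = grow N (insert τ x) c' (subst (t ≤_) (trans (sym (ℕₚ.+-suc N (size τ))) (cong (N +_) (sym (size-insert τ x)))) h)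

-- From connected graphs to arbitrary graphs

record Found {n} (G : Graph n) (τ : RT) : Set where
  field
    H     : Graph n
    lc    : LC full G H
    g     : Node τ → Fin n
    g-inj : ∀ {x y} → g x ≡ g y → x ≡ y
    g-adj : ∀ x y → adj H (g x) (g y) ≡ edge x y

FormA-adj : ∀ {n τ} {V : Subset n} {H} (F : FormA τ V H) → ∀ x y → adj H (Form.g F x) (Form.g F y) ≡ edge x y
FormA-adj {H = H} F x y with split-Bool (same x y)
... | inj₁ e = subst (λ z → adj H (Form.g F x) (Form.g F z) ≡ edge x z) (same-sound x y e)
                 (trans (adj-irrefl H _) (sym (edge-irrefl x)))
... | inj₂ e = Form.inner F x y λ { refl → true≢false (same-refl x) e }

-- One vertex m is set aside to be the outside, and the dichotomy is applied to all the others.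
-- Placing m last is free, since the full set has no crossing edges.
connected-case : ∀ {n} {G : Graph n} → Conn G full → ∀ {p} → PrimesBounded G p → ∀ τ → Fin n →
  Lin {G = G} (cost p τ) full ⊎ Found G τ
connected-case {n} {G} conn {p} primes τ m with empty-or-nonempty (complement ⁅ m ⁆)
... | inj₂ e = inj₁ (lin-+ {S' = λ _ → false} m refl refl (λ w w≢m → trans (sym (not-false (eq-false w≢m))) (e w))
      (CR-mono z≤n (CR-trivial λ _ _ _ ())) (lin-∅ λ _ → refl))
... | inj₁ (x , p₀) = [ inj₁ ∘ add-m , inj₂ ∘ found ]′
      (Dichotomy.dichotomy conn primes τ (complement ⁅ m ⁆) (Limb-∁ (Limb-singleton G m) , (x , p₀) , (m , cong not (eq-refl m))))
  where
  add-m : Lin {G = G} (cost p τ) (complement ⁅ m ⁆) → Lin {G = G} (cost p τ) full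
  add-m = lin-+ m refl (cong not (eq-refl m)) (λ w w≢m → sym (not-false (eq-false w≢m))) (CR-mono z≤n (CR-trivial λ _ _ _ ()))
  found : FullySupplied G τ (complement ⁅ m ⁆) → Found G τ
  found s = record { H = T.H ; lc = LC-mono (λ _ _ → refl) T.lc ; g = Form.g T.form ; g-inj = Form.g-inj T.form ; g-adj = FormA-adj T.form }
    where module T = Toggled (proj₁ (s G done))

-- Transfer from the subgraph induced on a nonempty set without leaving edges.
module Component {n} {G : Graph n} {C : Subset n} (closed : Closed G full C) {x₀} (Cx₀ : C x₀ ≡ true) where

  open Enumeration (enumerate C) renaming (size to m)

  private
    GC : Graph m
    GC = induce G elem

    retract-spec : ∀ v → Σ[ i ∈ Fin m ] (C v ≡ true → elem i ≡ v)
    retract-spec v with C v in e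
    ... | true  = index v e , λ _ → elem-index v e
    -- Vertices off C need some index as well; `x₀` witnesses that there is one.
    ... | false = index x₀ Cx₀ , λ ()

    retract : Fin n → Fin m
    retract v = proj₁ (retract-spec v)

    elem-retract : ∀ {v} → C v ≡ true → elem (retract v) ≡ v
    elem-retract {v} = proj₂ (retract-spec v)

    retract-elem : ∀ i → retract (elem i) ≡ i
    retract-elem i = inj (elem-retract (sound i))

    push : Subset m → Subset n
    push S v = C v ∧ S (retract v)

    push-elem : ∀ S i → push S (elem i) ≡ S i
    push-elem S i = cong₂ (λ a b → a ∧ S b) (sound i) (retract-elem i)

    adj-retract : ∀ {v w} → C v ≡ true → C w ≡ true → adj G v w ≡ adj GC (retract v) (retract w)
    adj-retract p q = sym (cong₂ (adj G) (elem-retract p) (elem-retract q))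

  push-CR : ∀ {S k} → CR GC S k → CR G (push S) k
  push-CR {S} (mkCR xs len sums) = mkCR (map pull xs) (subst (_≤ _) (sym (Lₚ.length-map pull xs)) len) eqn
    where
    pull : Term m → Term n
    pull (a , b) = a ∘ retract , push b
    eval-pull : ∀ xs v w → eval (map pull xs) v w ≡ C w ∧ eval xs (retract v) (retract w)
    eval-pull [] v w = sym (𝔹ₚ.∧-zeroʳ (C w))
    eval-pull ((a , b) ∷ xs) v w rewrite eval-pull xs v w =
      ⇔→≡ (tautology 4 (λ a c b e → ((a ∧ (c ∧ b)) xor (c ∧ e)) ⇔ (c ∧ ((a ∧ b) xor e))) refl
        (a (retract v)) (C w) (b (retract w)) (eval xs (retract v) (retract w)))
    eqn : ∀ v w → push S v ≡ true → push S w ≡ false → adj G v w ≡ eval (map pull xs) v w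
    eqn v w p q with ∧-elim {C v} p | split-Bool (C w)
    ... | Cv , Sv | inj₂ Cw = trans (closed v w refl refl Cv Cw) (sym (trans (eval-pull xs v w) (cong (_∧ eval xs (retract v) (retract w)) Cw)))
    ... | Cv , Sv | inj₁ Cw = trans (adj-retract Cv Cw) (trans (sums _ _ Sv (trans (cong (_∧ S (retract w)) (sym Cw)) q))
            (sym (trans (eval-pull xs v w) (cong (_∧ eval xs (retract v) (retract w)) Cw))))

  push-Lin : ∀ {S k} → Lin {G = GC} k S → Lin {G = G} k (push S)
  push-Lin (lin-∅ h) = lin-∅ λ v → trans (cong (C v ∧_) (h (retract v))) (𝔹ₚ.∧-zeroʳ (C v))
  push-Lin {S} (lin-+ {S'} i p q r c l) = lin-+ (elem i) (trans (push-elem S i) p) (trans (push-elem S' i) q) same-elsewhere (push-CR c) (push-Lin l)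
    where
    same-elsewhere : ∀ w → w ≢ elem i → push S w ≡ push S' w
    same-elsewhere w h with split-Bool (C w)
    ... | inj₂ e = trans (cong (_∧ S (retract w)) e) (sym (cong (_∧ S' (retract w)) e))
    ... | inj₁ e = cong (C w ∧_) (r (retract w) λ f → h (trans (sym (elem-retract e)) (cong elem f)))

  push-Conn : (∀ S → Closed G full S → S ⊆ C → Nonempty S → ¬ Nonempty (C ∖ S)) → Conn GC full
  push-Conn minimal = mkConn λ S cl i j _ _ Si → ¬false→true λ Sj →
    minimal (push S) (closed-push S cl) (λ v p → proj₁ (∧-elim {C v} p)) (elem i , trans (push-elem S i) Si)
      (elem j , ∧-intro (sound j) (not-false (trans (push-elem S j) Sj)))
    where
    closed-push : ∀ S → Closed GC full S → Closed G full (push S)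
    closed-push S cl v w _ _ p q with ∧-elim {C v} p | split-Bool (C w)
    ... | Cv , Sv | inj₂ Cw = closed v w refl refl Cv Cw
    ... | Cv , Sv | inj₁ Cw = trans (adj-retract Cv Cw) (cl _ _ refl refl Sv (trans (cong (_∧ S (retract w)) (sym Cw)) q))

  neq-elem : ∀ i j → neq (elem i) (elem j) ≡ neq i j
  neq-elem i j with i ≟ j
  ... | yes refl = neq-refl (elem i)
  ... | no i≢j = neq-true λ e → i≢j (inj e)

  push-LC : ∀ {H K} → LC full H K → ∀ {H'} → (∀ i j → adj H' (elem i) (elem j) ≡ adj H i j) →
    Σ[ K' ∈ Graph n ] LC full H' K' × (∀ i j → adj K' (elem i) (elem j) ≡ adj K i j)
  push-LC done {H'} h = H' , done , h
  push-LC {H} (at x p r) {H'} h with push-LC r {localComp H' (elem x)} (λ i j →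
      cong₂ _xor_ (h i j) (cong₂ _∧_ (h x i) (cong₂ _∧_ (h x j) (neq-elem i j))))
  ... | K' , r' , h' = K' , at (elem x) refl r' , h'

  push-Found : ∀ {τ} → Found GC τ → Found G τ
  push-Found F with push-LC (Found.lc F) {G} (λ _ _ → refl)
  ... | K' , r , h = record
    { H = K' ; lc = r ; g = elem ∘ Found.g F ; g-inj = λ e → Found.g-inj F (inj e)
    ; g-adj = λ x y → trans (h _ _) (Found.g-adj F x y) }

  component-case : ∀ {p} → PrimesBounded G p → ∀ τ →
    (∀ S → Closed G full S → S ⊆ C → Nonempty S → ¬ Nonempty (C ∖ S)) → Lin {G = G} (cost p τ) C ⊎ Found G τ
  component-case primes τ minimal with connected-case (push-Conn minimal) (λ f f-inj → primes (elem ∘ f) (λ e → f-inj (inj e))) τ (index x₀ Cx₀)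
  ... | inj₁ lin = inj₁ (Lin-≗ (λ v → 𝔹ₚ.∧-identityʳ (C v)) (push-Lin lin))
  ... | inj₂ F = inj₂ (push-Found F)

-- Recursion down to the minimal nonempty closed sets, which are the components. The two parts of a
-- closed set have no edges between them, so joining their layouts adds nothing to the width.
closed-set-case : ∀ {n} {G : Graph n} {p} → PrimesBounded G p → ∀ τ N C → count C ≤ N → Closed G full C → Lin {G = G} (cost p τ) C ⊎ Found G τ
closed-set-case {n} {G} {p} primes τ N C h closed with empty-or-nonempty C
... | inj₂ e = inj₁ (lin-∅ e)
... | inj₁ (x₀ , Cx₀) with search (λ S → Closed G full S × S ⊆ C × Nonempty S × Nonempty (C ∖ S))
      (λ S → (all? λ u → all? λ v → yes refl →-dec yes refl →-dec (S u ≟𝔹 true) →-dec (S v ≟𝔹 false) →-dec (adj G u v ≟𝔹 false))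
        ×-dec Subset? S C ×-dec nonempty? S ×-dec nonempty? (C ∖ S))
      (λ e (c , s , (x , p) , (y , q)) → (λ u v a b r t → c u v a b (trans (e u) r) (trans (e v) t)) , (λ v r → s v (trans (e v) r)) ,
        (x , trans (sym (e x)) p) , (y , trans (cong (λ c → C y ∧ not c) (sym (e y))) q))
... | inj₂ none = Component.component-case closed Cx₀ primes τ λ S c s ne ne' → none S (c , s , ne , ne')
... | inj₁ (S , cS , S⊆C , (x , Sx) , (y , Dy)) = split-off N h
  where
  D : Subset n
  D = C ∖ S
  D⊆C : D ⊆ C
  D⊆C v r = proj₁ (∧-elim {C v} r)
  closed-D : Closed G full D
  closed-D u v a b p q with ∧-elim {C u} p | split-Bool (C v) | split-Bool (S v)
  ... | Cu , Su | inj₂ Cv | _ = closed u v a b Cu Cv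
  ... | Cu , Su | inj₁ Cv | inj₁ Sv = adj-sym-false G (cS v u b a Sv (not-true Su))
  ... | Cu , Su | inj₁ Cv | inj₂ Sv = true≢false (∧-intro Cv (not-false Sv)) q
  split-off : ∀ N → count C ≤ N → Lin {G = G} (cost p τ) C ⊎ Found G τ
  split-off zero h = ⊥-elim (ℕₚ.n≮0 (ℕₚ.≤-trans (count-strict {S = λ _ → false} {C} (λ _ ()) x₀ Cx₀ refl) h))
  split-off (suc N) h
    with closed-set-case {G = G} primes τ N S (ℕₚ.≤-pred (ℕₚ.≤-trans (count-strict S⊆C y (D⊆C y Dy) (not-true (proj₂ (∧-elim {C y} Dy)))) h)) cS
       | closed-set-case {G = G} primes τ N D (ℕₚ.≤-pred (ℕₚ.≤-trans (count-strict D⊆C x (S⊆C x Sx) (trans (cong (λ c → C x ∧ not c) Sx) (𝔹ₚ.∧-zeroʳ (C x)))) h)) closed-D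
  ... | inj₂ F | _ = inj₂ F
  ... | inj₁ _ | inj₂ F = inj₂ F
  ... | inj₁ l | inj₁ l' = inj₁ (Lin-≗ (λ v → ⇔→≡ (mp (tautology 2 (λ s c → (s ⇒ c) ⇒ (s ∨ (c ∧ not s) ⇔ c)) refl (S v) (C v)) (⇒-intro (S⊆C v))))
        (Lin-∪ (CR-trivial λ u w p q → cS u w refl refl p q) ℕₚ.≤-refl l l'))

-- Layouts as permutations

record Order {n} (G : Graph n) (K : ℕ) (S : Subset n) : Set where
  field
    len      : ℕ
    pos      : Fin n → ℕ
    pos<     : ∀ v → S v ≡ true → pos v < len
    onto     : ∀ i → i < len → Σ[ v ∈ Fin n ] S v ≡ true × pos v ≡ i
    pos-inj  : ∀ u v → S u ≡ true → S v ≡ true → pos u ≡ pos v → u ≡ v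
    segments : ∀ i → CR G (λ v → S v ∧ (pos v <ᵇ i)) K

-- The outermost vertex takes the last position `len`. Hence a segment of length at most `len`
-- belongs to the inner layout, and a longer one is all of S.
order : ∀ {n} {G : Graph n} {K S} → Lin {G = G} K S → Order G K S
order (lin-∅ h) = record
  { len = 0 ; pos = λ _ → 0 ; pos< = λ v p → true≢false p (h v) ; onto = λ _ ()
  ; pos-inj = λ u _ p _ _ → true≢false p (h u)
  ; segments = λ i → CR-mono z≤n (CR-trivial λ u _ p _ → true≢false (proj₁ (∧-elim p)) (h u)) }
order {n} {G} {K} {S} (lin-+ {S'} v p q r c l) = record
  { len = suc len ; pos = pos' ; pos< = bound ; onto = onto' ; pos-inj = inj' ; segments = segments' }
  where
  open Order (order l)
  pos' : Fin n → ℕ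
  pos' w = if eq w v then len else pos w
  at-v : pos' v ≡ len
  at-v rewrite eq-refl v = refl
  elsewhere : ∀ {w} → w ≢ v → pos' w ≡ pos w
  elsewhere h rewrite eq-false h = refl
  old : ∀ {w} → w ≢ v → S w ≡ true → S' w ≡ true
  old {w} h s = trans (sym (r w h)) s
  bound : ∀ w → S w ≡ true → pos' w < suc len
  bound w s with w ≟ v
  ... | yes refl = ℕₚ.n<1+n len
  ... | no h = ℕₚ.<-trans (pos< w (old h s)) (ℕₚ.n<1+n len)
  onto' : ∀ i → i < suc len → Σ[ w ∈ Fin n ] S w ≡ true × pos' w ≡ i
  onto' i h with i ℕₚ.≟ len
  ... | yes refl = v , p , at-v
  ... | no i≢ with onto i (ℕₚ.≤∧≢⇒< (ℕₚ.≤-pred h) i≢)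
  ...   | w , s , e = w , trans (r w w≢v) s , trans (elsewhere w≢v) e
    where w≢v = ∈≢∉ S' s q
  inj' : ∀ u w → S u ≡ true → S w ≡ true → pos' u ≡ pos' w → u ≡ w
  inj' u w a b e with u ≟ v | w ≟ v
  ... | yes refl | yes refl = refl
  ... | yes refl | no h = ⊥-elim (ℕₚ.<-irrefl (sym e) (pos< w (old h b)))
  ... | no h | yes refl = ⊥-elim (ℕₚ.<-irrefl e (pos< u (old h a)))
  ... | no h | no h' = pos-inj u w (old h a) (old h' b) e
  segments' : ∀ i → CR G (λ w → S w ∧ (pos' w <ᵇ i)) K
  segments' i with i ℕₚ.≤? len
  ... | yes i≤ = CR-≗ same-segment (segments i)
    where
    same-segment : ∀ w → S' w ∧ (pos w <ᵇ i) ≡ S w ∧ (pos' w <ᵇ i)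
    same-segment w with w ≟ v
    ... | no h = cong (_∧ (pos w <ᵇ i)) (sym (r w h))
    ... | yes refl rewrite q = sym (trans (cong (S w ∧_) (¬true→false λ e → ℕₚ.<⇒≱ (<ᵇ-sound e) i≤)) (𝔹ₚ.∧-zeroʳ (S w)))
  ... | no i≰ = CR-≗ everything c
    where
    everything : ∀ w → S w ≡ S w ∧ (pos' w <ᵇ i)
    everything w with split-Bool (S w)
    ... | inj₂ e rewrite e = refl
    ... | inj₁ e = trans e (sym (∧-intro e (<ᵇ-true (ℕₚ.<-≤-trans (bound w e) (ℕₚ.≰⇒> i≰)))))

Lin⇒LrwAtMost : ∀ {n} {G : Graph n} {K} → Lin {G = G} K full → LrwAtMost G K
Lin⇒LrwAtMost {n} {G} {K} l = layout (↔⇒≡ π) π (λ v → Fₚ.toℕ-fromℕ< (pos< v refl))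
  where
  open Order (order l)
  π : Permutation len n
  π = permutation (λ i → proj₁ (onto (toℕ i) (Fₚ.toℕ<n i))) (λ v → fromℕ< (pos< v refl))
    (λ v → let (w , _ , e) = onto _ (Fₚ.toℕ<n (fromℕ< (pos< v refl))) in pos-inj w v refl refl (trans e (Fₚ.toℕ-fromℕ< (pos< v refl))))
    (λ i → Fₚ.toℕ-injective (trans (Fₚ.toℕ-fromℕ< _) (proj₂ (proj₂ (onto (toℕ i) (Fₚ.toℕ<n i))))))
  -- The length of the order equals n only propositionally; generalizing over it allows the match on
  -- `refl`, and the last argument preserves what has to be known about the positions.
  layout : ∀ {m} → m ≡ n → (π : Permutation m n) → (∀ v → toℕ (π ⟨$⟩ˡ v) ≡ pos v) → LrwAtMost G K
  layout refl π spec = π , λ i _ _ → CR⇒CutRankAtMost (CR-≗ (λ v → cong (_<ᵇ i) (sym (spec v))) (segments i))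

-- Vertex-minors and the final estimate

LC⇒VertexMinor : ∀ {n m} {V : Subset n} {G H} {M : Graph m} → LC V G H → VertexMinor H M → VertexMinor G M
LC⇒VertexMinor done       v = v
LC⇒VertexMinor (at x _ r) v = vm-lc x (LC⇒VertexMinor r v)

-- Vertices missed by `g` are deleted one by one. Once none is left, `g` is a bijection, which is
-- why the result is an isomorphic graph and not the induced one itself.
induced-minor : ∀ {n t} (G : Graph n) (g : Fin t → Fin n) → Injective _≡_ _≡_ g →
  Σ[ m ∈ ℕ ] Σ[ M ∈ Graph m ] VertexMinor G M × Isomorphic M (induce G g)
induced-minor {zero} {t} G g g-inj = 0 , G , vm-refl , permutation (λ ()) g (λ i → case g i of λ ()) (λ ()) , λ ()
induced-minor {suc n} {t} G g g-inj with (any? λ v → all? λ i → ¬? (g i ≟ v))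
... | yes (v , missed) with induced-minor (delete G v) (λ i → punchOut (λ e → missed i (sym e))) (λ {i} {j} e → g-inj (Fₚ.punchOut-injective (λ q → missed i (sym q)) (λ q → missed j (sym q)) e))
...   | m , M , minor , π , iso = m , M , vm-del v minor , π , λ a b →
          trans (sym (cong₂ (adj G) (Fₚ.punchIn-punchOut _) (Fₚ.punchIn-punchOut _))) (iso a b)
induced-minor {suc n} {t} G g g-inj | no onto = suc n , G , vm-refl ,
    permutation (λ v → proj₁ (hit v)) g (λ i → g-inj (proj₂ (hit (g i)))) (λ v → proj₂ (hit v)) ,
    λ a b → cong₂ (adj G) (proj₂ (hit a)) (proj₂ (hit b))
  where
  hit : ∀ v → Σ[ i ∈ Fin t ] g i ≡ v
  hit v with (any? λ i → g i ≟ v)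
  ... | yes p = p
  ... | no h = ⊥-elim (onto (v , λ i e → h (i , e)))

embedding⇒minor : ∀ {n t} (G H : Graph n) (T : Graph t) → LC full G H → (g : Fin t → Fin n) → Injective _≡_ _≡_ g →
  (∀ i j → adj H (g i) (g j) ≡ adj T i j) → Σ ℕ λ m → Σ (Graph m) λ M → VertexMinor G M × Isomorphic M T
embedding⇒minor G H T lc g g-inj e with induced-minor H g g-inj
... | m , M , minor , π , iso = m , M , LC⇒VertexMinor lc minor , π , λ a b → trans (sym (e _ _)) (iso a b)

budget : ∀ p τ t → size τ ≤ t → 1 ≤ t → cost p τ < 40 * (p + 2) * t
budget p τ t s (s≤s {n = t'} _) = begin-strict
  cost p τ                 <⟨ ℕₚ.m<m+n (cost p τ) (s≤s z≤n) ⟩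
  cost p τ + 4 * (3 + p)   ≡⟨ cost-bound p τ ⟩
  7 * (3 + p) * size τ     ≤⟨ ℕₚ.*-mono-≤ factor s ⟩
  40 * (p + 2) * t         ∎
  where
  open ℕₚ.≤-Reasoning
  factor : 7 * (3 + p) ≤ 40 * (p + 2)
  -- The slack: 40 (p + 2) - 7 (3 + p) = 59 + 33 p.
  factor = ℕₚ.≤-trans (ℕₚ.m≤m+n (7 * (3 + p)) (59 + 33 * p))
    (ℕₚ.≤-reflexive (solve 1 (λ p → con 7 :* (con 3 :+ p) :+ (con 59 :+ con 33 :* p) := con 40 :* (p :+ con 2)) refl p))
    where open +-*-Solver

theorem4p1 : (p : ℕ) → 1 ≤ p →
    {t : ℕ} (T : Graph t) → IsTree T →
    {n : ℕ} (G : Graph n) →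
    (∀ {m : ℕ} (f : Fin m → Fin n) → Injective _≡_ _≡_ f →
    Prime (induce G f) → LrwAtMost (induce G f) p) →
    LrwAtLeast G (40 * (p + 2) * t) →
    Σ ℕ λ m → Σ (Graph m) λ H → VertexMinor G H × Isomorphic H T
-- `IsTree` admits the empty graph, which no rooted tree represents; it is obtained by deleting
-- every vertex.
theorem4p1 p _ {zero} T tree G primes large = embedding⇒minor G G T done (λ ()) (λ { {()} }) (λ ())
theorem4p1 p _ {suc t} T tree {n} G primes large with spanning-copy tree zero
... | τ , c , onto with closed-set-case {G = G} primes τ (count {n} full) full ℕₚ.≤-refl (λ _ _ _ _ _ ())
...   | inj₁ lin = ⊥-elim (ℕₚ.<⇒≱ (budget p τ (suc t) (copy-size c) (s≤s z≤n)) (large _ (Lin⇒LrwAtMost lin)))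
...   | inj₂ F = embedding⇒minor G H T lc (g ∘ node) node-inj λ i j →
          trans (g-adj _ _) (trans (sym (Copy.e-adj c _ _)) (cong₂ (adj T) (proj₂ (onto i)) (proj₂ (onto j))))
  where
  open Found F
  node : Fin (suc t) → Node τ
  node i = proj₁ (onto i)
  node-inj : Injective _≡_ _≡_ (g ∘ node)
  node-inj {i} {j} e = trans (sym (proj₂ (onto i))) (trans (cong (Copy.e c) (g-inj e)) (proj₂ (onto j)))
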